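{- Let $D\in\mathrm{Mat}_{d\times d}(\mathcal{L})$ be a non-zero matrix ($d\ge1$), and let $\lambda_d\in\mathcal{L}[t]$ be its last invariant factor. For $n\ge1$ let $s_n$ be the least non-negative integer such that all entries of $D,D^2,\dots,D^n$ have valuation $\ge -s_n$. The following are equivalent: (1) there is $n\ge1$ such that $\sigma^{s_n}D^n\in\mathrm{Mat}_{d\times d}(\mathcal{O})$ has rank $d$ modulo $\sigma^{s_n}$; (2) there is $n\ge1$ such that the block column matrix with blocks $\sigma^{s_n}D,\sigma^{s_n}D^2,\dots,\sigma^{s_n}D^n$ (stacked vertically, in $\mathrm{Mat}_{nd\times d}(\mathcal{O})$) has rank $d$ modulo $\sigma^{s_n}$; (2') there is $n\ge1$ such that the block row matrix $(\sigma^{s_n}D,\sigma^{s_n}D^2,\dots,\sigma^{s_n}D^n)\in\mathrm{Mat}_{d\times nd}(\mathcal{O})$ has rank $d$ modulo $\sigma^{s_n}$; (3) all slopes of the Newton polygon of $\lambda_d$ are positive.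
   Context: $(\mathcal{L},v)$ is a complete discretely valued skew field: a division ring with a map $v:\mathcal{L}\to\mathbb{Z}\cup\{\infty\}$ with $v(x)=\infty\iff x=0$, $v(x+y)\ge\min\{v(x),v(y)\}$, $v(xy)=v(x)+v(y)$, such that every series $\sum x_i$ with $v(x_i)\to\infty$ converges. $\mathcal{O}=\{x:v(x)\ge0\}$ is its valuation ring and $\sigma\in\mathcal{O}$ a fixed uniformizer ($v(\sigma)=1$). $\mathcal{L}[t]$ is the polynomial ring in a central indeterminate $t$. Rank modulo $\sigma^s$: any rectangular matrix $B$ over $\mathcal{O}$ can be brought by elementary row and column operations over $\mathcal{O}$ to a diagonal form whose non-zero diagonal entries are $\sigma^{\nu_1},\dots,\sigma^{\nu_n}$ with $0\le\nu_1\le\dots\le\nu_n$; $B$ has rank $r$ modulo $\sigma^s$ if $\#\{i:\nu_i<s\}=r$. Invariant factors of $D$: monic $\lambda_1,\dots,\lambda_d\in\mathcal{L}[t]$ obtained by bringing $t\mathbf{1}_d-D$ to diagonal form $\mathrm{diag}(\lambda_1,\dots,\lambda_d)$ by elementary row and column operations over $\mathcal{L}[t]$, with each $\lambda_i$ a left and right divisor of $\lambda_{i+1}$ (Newton polygons are independent of choices). Newton polygon of $f=\sum a_it^i\in\mathcal{L}[t]$: lower convex hull of the points $(i,v(a_i))$, $a_i\ne0$; slope of an edge from $(i,w_i)$ to $(j,w_j)$ is $(w_j-w_i)/(j-i)$. "All slopes positive" is understood to include that the constant coefficient is non-zero. -}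

module Defs where

open import Level using (Level; _⊔_) renaming (suc to lsuc)
open import Algebra.Bundles using (Ring)
open import Algebra.Bundles.Raw using (RawRing)
open import Algebra.Definitions using (Invertible)
import Algebra.Definitions.RawMagma as Divisibility
import Algebra.Definitions.RawMonoid as Summation
import Algebra.Definitions.RawSemiring as Exponentiation
import Algebra.Properties.Ring as RingProperties
open import Data.Bool.Base using (if_then_else_)
open import Data.Empty using (⊥-elim)
open import Data.Fin.Base using (Fin; zero; suc; toℕ; fromℕ<; remQuot)
open import Data.Fin.Permutation.Components using (transpose)
import Data.Fin.Properties as Fin
open import Data.Integer.Base as ℤ using (ℤ; +_; -[1+_])
import Data.Integer.Properties as ℤ
open import Data.List.Base as List using (List; []; _∷_; length; filter)
open import Data.List.Relation.Unary.Linked using (Linked)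
open import Data.Nat.Base as ℕ using (ℕ; zero; suc; z≤n; s≤s; _≤_; _<_; _∸_)
import Data.Nat.Properties as ℕ
open import Data.Product.Base using (Σ; ∃-syntax; _×_; _,_; proj₁)
open import Data.Rational.Base as ℚ using (ℚ)
open import Data.Vec.Base as Vec using (Vec)
open import Data.Vec.Functional using (Vector; updateAt; foldr)
open import Data.Vec.Relation.Unary.All using (All)
import Data.Vec.Relation.Unary.Linked as VecLinked
open import Function.Base using (_∘_)
open import Function.Bundles using (_⇔_; Equivalence)
open import Relation.Binary.Construct.Add.Supremum.NonStrict ℤ._≤_ public
  using ([_]; _≤⊤⁺; ≤⁺-trans) renaming (_≤⁺_ to _≤∞_)
open import Relation.Binary.PropositionalEquality.Core
  using (_≡_; _≢_; refl; sym; trans; subst)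
open import Relation.Nullary.Construct.Add.Supremum public
  using (_⁺; [_]) renaming (⊤⁺ to ∞)
open import Relation.Nullary.Decidable using (does)
open import Relation.Nullary.Negation using (¬_)

ℤ∞ : Set
ℤ∞ = ℤ ⁺

infixl 6 _+∞_
_+∞_ : ℤ∞ → ℤ∞ → ℤ∞
[ a ] +∞ [ b ] = [ a ℤ.+ b ]
[ _ ] +∞ ∞     = ∞
∞     +∞ _     = ∞

infixl 6 _⊓∞_
_⊓∞_ : ℤ∞ → ℤ∞ → ℤ∞
[ a ] ⊓∞ [ b ] = [ a ℤ.⊓ b ]
[ a ] ⊓∞ ∞     = [ a ]
∞     ⊓∞ y     = y

record CompleteDiscretelyValuedSkewField (c ℓ : Level) : Set (lsuc (c ⊔ ℓ)) where
  field
    ring : Ring c ℓ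
  open Ring ring public

  open Summation +-rawMonoid public using (sum)
  open Exponentiation (RawRing.rawSemiring rawRing) public using (_^_)

  field
    1≉0     : ¬ (1# ≈ 0#)
    inverse : ∀ x → ¬ (x ≈ 0#) → Invertible _≈_ 1# _*_ x

    v       : Carrier → ℤ∞
    v-cong  : ∀ {x y} → x ≈ y → v x ≡ v y
    v-∞     : ∀ x → v x ≡ ∞ ⇔ x ≈ 0#
    v-+     : ∀ x y → (v x ⊓∞ v y) ≤∞ v (x + y)
    v-*     : ∀ x y → v (x * y) ≡ v x +∞ v y

    σ       : Carrier
    v-σ     : v σ ≡ [ + 1 ]

  TendsToInfinity : (ℕ → ℤ∞) → Set
  TendsToInfinity w = ∀ (N : ℤ) → ∃[ m ] ∀ i → m ≤ i → [ N ] ≤∞ w i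

  partialSum : (ℕ → Carrier) → ℕ → Carrier
  partialSum x m = sum {m} (λ i → x (toℕ i))

  field
    complete : ∀ (x : ℕ → Carrier) → TendsToInfinity (λ i → v (x i)) →
               ∃[ l ] TendsToInfinity (λ m → v (partialSum x m - l))

-- The notions below use only the operations of a ring, so they are stated
-- for raw rings: this covers 𝓛, its valuation ring and 𝓛[t] uniformly.

module _ {c ℓ : Level} (R : RawRing c ℓ) where

  open RawRing R

  -- Also reads off the coefficients of a polynomial.
  nth : List Carrier → ℕ → Carrier
  nth []       _       = 0#
  nth (x ∷ _)  zero    = x
  nth (_ ∷ xs) (suc i) = nth xs i

  Matrix : ℕ → ℕ → Set c
  Matrix m n = Vector (Vector Carrier n) m

module Matrices {c ℓ : Level} (R : RawRing c ℓ) where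

  open RawRing R
  open Summation +-rawMonoid using (sum)

  infix 4 _≋_
  _≋_ : ∀ {m n} → Matrix R m n → Matrix R m n → Set ℓ
  M ≋ N = ∀ i j → M i j ≈ N i j

  0ₘ : ∀ {m n} → Matrix R m n
  0ₘ _ _ = 0#

  1ₘ : ∀ {d} → Matrix R d d
  1ₘ i j = if does (i Fin.≟ j) then 1# else 0#

  infixl 7 _*ₘ_
  _*ₘ_ : ∀ {m n p} → Matrix R m n → Matrix R n p → Matrix R m p
  (M *ₘ N) i j = sum (λ k → M i k * N k j)

  infixr 8 _^ₘ_
  _^ₘ_ : ∀ {d} → Matrix R d d → ℕ → Matrix R d d
  D ^ₘ zero  = 1ₘ
  D ^ₘ suc n = D *ₘ D ^ₘ n

  diagonal : ∀ {m n} → List Carrier → Matrix R m n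
  diagonal xs i j = if toℕ i ℕ.≡ᵇ toℕ j then nth R xs (toℕ i) else 0#

  column : ∀ {n m p} → (Fin n → Matrix R m p) → Matrix R (n ℕ.* m) p
  column {n} {m} B i j = let (q , r) = remQuot {n} m i in B q r j

  row : ∀ {n m p} → (Fin n → Matrix R m p) → Matrix R m (n ℕ.* p)
  row {n} {m} {p} B i j = let (q , r) = remQuot {n} p j in B q i r

  addRow : ∀ {m n} → Fin m → Fin m → Carrier → Matrix R m n → Matrix R m n
  addRow i j c M = updateAt M i (λ Mᵢ l → Mᵢ l + c * M j l)

  addColumn : ∀ {m n} → Fin n → Fin n → Carrier → Matrix R m n → Matrix R m n
  addColumn i j c M k = updateAt (M k) i (λ x → x + M k j * c)

  scaleRow : ∀ {m n} → Fin m → Carrier → Matrix R m n → Matrix R m n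
  scaleRow i u M = updateAt M i (λ Mᵢ l → u * Mᵢ l)

  scaleColumn : ∀ {m n} → Fin n → Carrier → Matrix R m n → Matrix R m n
  scaleColumn i u M k = updateAt (M k) i (λ x → x * u)

  swapRows : ∀ {m n} → Fin m → Fin m → Matrix R m n → Matrix R m n
  swapRows i j M = M ∘ transpose i j

  swapColumns : ∀ {m n} → Fin n → Fin n → Matrix R m n → Matrix R m n
  swapColumns i j M k = M k ∘ transpose i j

  -- M ⇝ N : finitely many elementary operations over R bring M to N.
  -- Row operations act by multiplication on the left, column operations
  -- by multiplication on the right.
  infix 4 _⇝_
  data _⇝_ {m n : ℕ} (M N : Matrix R m n) : Set (c ⊔ ℓ) where
    done    : M ≋ N → M ⇝ N
    row+    : ∀ {i j} c → i ≢ j → addRow i j c M ⇝ N → M ⇝ N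
    column+ : ∀ {i j} c → i ≢ j → addColumn i j c M ⇝ N → M ⇝ N
    row*    : ∀ {i u} → Invertible _≈_ 1# _*_ u → scaleRow i u M ⇝ N → M ⇝ N
    column* : ∀ {i u} → Invertible _≈_ 1# _*_ u → scaleColumn i u M ⇝ N → M ⇝ N
    row↔    : ∀ i j → swapRows i j M ⇝ N → M ⇝ N
    column↔ : ∀ i j → swapColumns i j M ⇝ N → M ⇝ N

-- R[t] for a central indeterminate t. A list holds the coefficients, constant
-- one first; it may end in zeros, so equality compares all coefficients.

module Polynomials {c ℓ : Level} (R : RawRing c ℓ) where

  open RawRing R

  Polynomial : Set c
  Polynomial = List Carrier

  coefficient : Polynomial → ℕ → Carrier
  coefficient = nth R

  infix 4 _≈ₚ_
  _≈ₚ_ : Polynomial → Polynomial → Set ℓ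
  f ≈ₚ g = ∀ i → coefficient f i ≈ coefficient g i

  constant : Carrier → Polynomial
  constant a = a ∷ []

  t : Polynomial
  t = 0# ∷ 1# ∷ []

  infixl 6 _+ₚ_
  _+ₚ_ : Polynomial → Polynomial → Polynomial
  []      +ₚ g       = g
  (a ∷ f) +ₚ []      = a ∷ f
  (a ∷ f) +ₚ (b ∷ g) = (a + b) ∷ (f +ₚ g)

  infixl 7 _*ₚ_
  _*ₚ_ : Polynomial → Polynomial → Polynomial
  []      *ₚ g = []
  (a ∷ f) *ₚ g = List.map (a *_) g +ₚ (0# ∷ (f *ₚ g))

  rawRing : RawRing c ℓ
  rawRing = record
    { Carrier = Polynomial
    ; _≈_     = _≈ₚ_
    ; _+_     = _+ₚ_
    ; _*_     = _*ₚ_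
    ; -_      = List.map -_
    ; 0#      = []
    ; 1#      = constant 1#
    }

  Monic : Polynomial → Set ℓ
  Monic f = ∃[ n ] (coefficient f n ≈ 1# × (∀ i → n < i → coefficient f i ≈ 0#))

  -- x ∣ˡ y : x * q ≈ y for some q ;  x ∣ʳ y : q * x ≈ y for some q.
  open Divisibility (RawRing.*-rawMagma rawRing) public using (_∣ˡ_; _∣ʳ_)

  characteristic : ∀ {d} → Matrix R d d → Matrix rawRing d d
  characteristic D i j = t *ₚ 1ₘ i j +ₚ List.map -_ (constant (D i j))
    where open Matrices rawRing using (1ₘ)

  record InvariantFactors {d : ℕ} (D : Matrix R d d) (λs : Vec Polynomial d)
                          : Set (c ⊔ ℓ) where
    open Matrices rawRing using (_⇝_; diagonal)
    field
      monic    : All Monic λs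
      reduces  : characteristic D ⇝ diagonal (Vec.toList λs)
      divides  : VecLinked.Linked (λ f g → f ∣ˡ g × f ∣ʳ g) λs

module Valuation {c ℓ : Level} (𝓛 : CompleteDiscretelyValuedSkewField c ℓ) where

  open CompleteDiscretelyValuedSkewField 𝓛 hiding (refl; sym; trans; zero)
  open Matrices rawRing using (_^ₘ_)
  open Polynomials rawRing using (Polynomial; coefficient)
  open RingProperties ring using (-1*x≈-x; -‿involutive)

  ≤∞-trans : ∀ {x y z} → x ≤∞ y → y ≤∞ z → x ≤∞ z
  ≤∞-trans = ≤⁺-trans ℤ.≤-trans

  +∞-mono : ∀ {a b x y} → [ a ] ≤∞ x → [ b ] ≤∞ y → [ a ℤ.+ b ] ≤∞ (x +∞ y)
  +∞-mono [ p ]      [ q ]      = [ ℤ.+-mono-≤ p q ]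
  +∞-mono [ p ]      (_ ≤⊤⁺)    = _ ≤⊤⁺
  +∞-mono (_ ≤⊤⁺)    _          = _ ≤⊤⁺

  ⊓∞-glb : ∀ {a x y} → [ a ] ≤∞ x → [ a ] ≤∞ y → [ a ] ≤∞ (x ⊓∞ y)
  ⊓∞-glb [ p ]      [ q ]      = [ ℤ.⊓-glb p q ]
  ⊓∞-glb [ p ]      (_ ≤⊤⁺)    = [ p ]
  ⊓∞-glb (_ ≤⊤⁺)    q          = q

  Integral : Carrier → Set
  Integral x = [ + 0 ] ≤∞ v x

  integral-cong : ∀ {x y} → x ≈ y → Integral x → Integral y
  integral-cong x≈y = subst ([ + 0 ] ≤∞_) (v-cong x≈y)

  integral-half : ∀ x → [ + 0 ] ≤∞ (x +∞ x) → [ + 0 ] ≤∞ x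
  integral-half [ + _ ]      _     = [ ℤ.+≤+ z≤n ]
  integral-half [ -[1+ _ ] ] [ () ]
  integral-half ∞            _     = _ ≤⊤⁺

  integral-0 : Integral 0#
  integral-0 = subst ([ + 0 ] ≤∞_) (sym (Equivalence.from (v-∞ 0#) (Ring.refl ring))) (_ ≤⊤⁺)

  integral-+ : ∀ {x y} → Integral x → Integral y → Integral (x + y)
  integral-+ p q = ≤∞-trans (⊓∞-glb p q) (v-+ _ _)

  integral-* : ∀ {x y} → Integral x → Integral y → Integral (x * y)
  integral-* {x} {y} p q = subst ([ + 0 ] ≤∞_) (sym (v-* x y)) (+∞-mono p q)

  integral-1 : Integral 1#
  integral-1 = idempotent (v 1#) (trans (v-cong (Ring.sym ring (*-identityˡ 1#))) (v-* 1# 1#))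
    where
    idempotent : ∀ x → x ≡ x +∞ x → [ + 0 ] ≤∞ x
    idempotent [ + _ ]      _  = [ ℤ.+≤+ z≤n ]
    idempotent [ -[1+ n ] ] eq = ⊥-elim (ℕ.m≢1+m+n n (-[1+]-injective eq))
      where
      -[1+]-injective : ∀ {m n} → _≡_ {A = ℤ∞} [ -[1+ m ] ] [ -[1+ n ] ] → m ≡ n
      -[1+]-injective refl = refl
    idempotent ∞            _  = _ ≤⊤⁺

  integral-neg : ∀ {x} → Integral x → Integral (- x)
  integral-neg {x} p = integral-cong (-1*x≈-x x) (integral-* integral--1 p)
    where
    -1*-1≈1 : - 1# * - 1# ≈ 1#
    -1*-1≈1 = Ring.trans ring (-1*x≈-x (- 1#)) (-‿involutive 1#)

    integral--1 : Integral (- 1#)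
    integral--1 = integral-half (v (- 1#))
      (subst ([ + 0 ] ≤∞_) (v-* (- 1#) (- 1#)) (integral-cong (Ring.sym ring -1*-1≈1) integral-1))

  𝓞 : RawRing c ℓ
  𝓞 = record
    { Carrier = Σ Carrier Integral
    ; _≈_     = λ x y → proj₁ x ≈ proj₁ y
    ; _+_     = λ (x , p) (y , q) → x + y , integral-+ p q
    ; _*_     = λ (x , p) (y , q) → x * y , integral-* p q
    ; -_      = λ (x , p) → - x , integral-neg p
    ; 0#      = 0# , integral-0
    ; 1#      = 1# , integral-1
    }

  σ𝓞 : RawRing.Carrier 𝓞
  σ𝓞 = σ , subst ([ + 0 ] ≤∞_) (sym v-σ) [ ℤ.+≤+ z≤n ]

  open Exponentiation (RawRing.rawSemiring 𝓞) using () renaming (_^_ to _^𝓞_)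

  record HasRank {m n : ℕ} (B : Matrix 𝓞 m n) (s r : ℕ) : Set (c ⊔ ℓ) where
    open Matrices 𝓞 using (_⇝_; diagonal)
    field
      ν       : List ℕ
      rows    : length ν ≤ m
      columns : length ν ≤ n
      sorted  : Linked _≤_ ν
      reduces : B ⇝ diagonal (List.map (σ𝓞 ^𝓞_) ν)
      count   : length (filter (ℕ._<? s) ν) ≡ r

  BoundedBelow : ∀ {m n} → ℕ → Matrix rawRing m n → Set
  BoundedBelow s M = ∀ i j → [ ℤ.- (+ s) ] ≤∞ v (M i j)

  PowersBoundedBelow : ∀ {d} → Matrix rawRing d d → ℕ → ℕ → Set
  PowersBoundedBelow D n s = ∀ k → 1 ≤ k → k ≤ n → BoundedBelow s (D ^ₘ k)

  record LeastExponent {d : ℕ} (D : Matrix rawRing d d) (n : ℕ) : Set where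
    field
      exponent : ℕ
      bounded  : PowersBoundedBelow D n exponent
      least    : ∀ s → PowersBoundedBelow D n s → exponent ≤ s

  module _ where

    private

      pole : ℤ∞ → ℕ
      pole [ + _ ]      = 0
      pole [ -[1+ n ] ] = suc n
      pole ∞            = 0

      pole-bounded : ∀ x → [ ℤ.- (+ pole x) ] ≤∞ x
      pole-bounded [ + _ ]      = [ ℤ.+≤+ z≤n ]
      pole-bounded [ -[1+ _ ] ] = [ ℤ.≤-refl ]
      pole-bounded ∞            = _ ≤⊤⁺

      pole-least : ∀ {s} x → [ ℤ.- (+ s) ] ≤∞ x → pole x ≤ s
      pole-least         [ + _ ]      _               = z≤n
      pole-least {suc _} [ -[1+ _ ] ] [ ℤ.-≤- n≤m ]   = s≤s n≤m
      pole-least         ∞            _               = z≤n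

      maximum : ∀ {n} → (Fin n → ℕ) → ℕ
      maximum = foldr ℕ._⊔_ 0

      ≤maximum : ∀ {n} (f : Fin n → ℕ) i → f i ≤ maximum f
      ≤maximum f zero    = ℕ.m≤m⊔n _ _
      ≤maximum f (suc i) = ℕ.≤-trans (≤maximum (f ∘ suc) i) (ℕ.m≤n⊔m (f zero) _)

      maximum≤ : ∀ {n s} (f : Fin n → ℕ) → (∀ i → f i ≤ s) → maximum f ≤ s
      maximum≤ {zero}  f f≤ = z≤n
      maximum≤ {suc _} f f≤ = ℕ.⊔-lub (f≤ zero) (maximum≤ (f ∘ suc) (f≤ ∘ suc))

      relax : ∀ {s s′ x} → s ≤ s′ → [ ℤ.- (+ s) ] ≤∞ x → [ ℤ.- (+ s′) ] ≤∞ x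
      relax s≤s′ = ≤∞-trans [ ℤ.neg-mono-≤ (ℤ.+≤+ s≤s′) ]

      poleₘ : ∀ {m n} → Matrix rawRing m n → ℕ
      poleₘ M = maximum (λ i → maximum (λ j → pole (v (M i j))))

      poleₘ-bounded : ∀ {m n} (M : Matrix rawRing m n) → BoundedBelow (poleₘ M) M
      poleₘ-bounded M i j = relax
        (ℕ.≤-trans (≤maximum (λ j → pole (v (M i j))) j)
                   (≤maximum (λ i → maximum (λ j → pole (v (M i j)))) i))
        (pole-bounded (v (M i j)))

      poleₘ-least : ∀ {m n s} (M : Matrix rawRing m n) → BoundedBelow s M → poleₘ M ≤ s
      poleₘ-least M b = maximum≤ _ (λ i → maximum≤ _ (λ j → pole-least _ (b i j)))

    leastExponent : ∀ {d} (D : Matrix rawRing d d) n → LeastExponent D n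
    leastExponent D n = record
      { exponent = maximum poles
      ; bounded  = bounded
      ; least    = λ s b → maximum≤ poles λ i →
                     poleₘ-least (D ^ₘ suc (toℕ i)) (b (suc (toℕ i)) (s≤s z≤n) (Fin.toℕ<n i))
      }
      where
      poles : Fin n → ℕ
      poles i = poleₘ (D ^ₘ suc (toℕ i))

      bounded : PowersBoundedBelow D n (maximum poles)
      bounded (suc k) _ k<n i j = relax
        (subst (λ k → poleₘ (D ^ₘ suc k) ≤ maximum poles) (Fin.toℕ-fromℕ< k<n)
               (≤maximum poles (fromℕ< k<n)))
        (poleₘ-bounded (D ^ₘ suc k) i j)

  s : ∀ {d} → Matrix rawRing d d → ℕ → ℕ
  s D n = LeastExponent.exponent (leastExponent D n)

  v-σ^ : ∀ s → [ + s ] ≤∞ v (σ ^ s)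
  v-σ^ zero    = integral-1
  v-σ^ (suc s) = subst ([ + suc s ] ≤∞_) (sym (v-* σ (σ ^ s)))
    (+∞-mono (subst ([ + 1 ] ≤∞_) (sym v-σ) [ ℤ.≤-refl ]) (v-σ^ s))

  scale : ∀ {m n} (s : ℕ) (M : Matrix rawRing m n) → BoundedBelow s M → Matrix 𝓞 m n
  scale s M b i j = σ ^ s * M i j ,
    subst ([ + 0 ] ≤∞_) (sym (v-* (σ ^ s) (M i j)))
      (subst (λ a → [ a ] ≤∞ (v (σ ^ s) +∞ v (M i j))) (ℤ.+-inverseʳ (+ s)) (+∞-mono (v-σ^ s) (b i j)))

  -- σ^{s_n} D^k
  scaledPower : ∀ {d} (D : Matrix rawRing d d) (n k : ℕ) → 1 ≤ k → k ≤ n → Matrix 𝓞 d d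
  scaledPower D n k 1≤k k≤n =
    scale (s D n) (D ^ₘ k) (LeastExponent.bounded (leastExponent D n) k 1≤k k≤n)

  scaledPowers : ∀ {d} (D : Matrix rawRing d d) (n : ℕ) → Fin n → Matrix 𝓞 d d
  scaledPowers D n i = scaledPower D n (suc (toℕ i)) (s≤s z≤n) (Fin.toℕ<n i)

  -- The segment from (i , wᵢ) to (j , wⱼ) is an edge of the lower convex hull of
  -- the points (k , v aₖ): none of them lies below the line through its two ends,
  -- and those on that line lie between the ends. The line is written with the
  -- denominator j - i cleared.
  record Edge (f : Polynomial) (i j : ℕ) (wᵢ wⱼ : ℤ) : Set where
    field
      i<j   : i < j
      left  : v (coefficient f i) ≡ [ wᵢ ]
      right : v (coefficient f j) ≡ [ wⱼ ]

    line : ℕ → ℤ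
    line k = wᵢ ℤ.* (+ j ℤ.- + k) ℤ.+ wⱼ ℤ.* (+ k ℤ.- + i)

    field
      below   : ∀ k w → v (coefficient f k) ≡ [ w ] → line k ℤ.≤ w ℤ.* (+ j ℤ.- + i)
      maximal : ∀ k w → v (coefficient f k) ≡ [ w ] → line k ≡ w ℤ.* (+ j ℤ.- + i) →
                i ≤ k × k ≤ j

    slope : ℚ
    slope = ((wⱼ ℤ.- wᵢ) ℚ./ (j ∸ i)) {{ℕ.>-nonZero (ℕ.m<n⇒0<n∸m i<j)}}

  AllSlopesPositive : Polynomial → Set ℓ
  AllSlopesPositive f =
    ¬ (coefficient f 0 ≈ 0#) ×
    (∀ {i j wᵢ wⱼ} (e : Edge f i j wᵢ wⱼ) → ℚ.0ℚ ℚ.< Edge.slope e)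

{-
Write V = 𝓛ᵈ. The scaling by σ^s cancels out of all rank conditions: by the Smith normal form
over 𝓞, condition (1) says that Dⁿ x ∈ σᵃ 𝓞ᵈ forces x ∈ σᵃ⁺¹ 𝓞ᵈ (equivalently, the same for row
vectors y Dⁿ), and (2) says that x ∈ σᵃ⁺¹ 𝓞ᵈ as soon as D x, …, Dⁿ x all lie in σᵃ 𝓞ᵈ. So (1) implies (2).
Conversely, under (2) the valuations u(j) of Dʲ x satisfy u(j) ≥ 1 + min (u(j+1), …, u(j+n)); descending
from j = N, where D can only have lost a bounded amount, u(0) exceeds u(N) once N is large. Row vectors
give (2′).

By convexity (3) says that the constant coefficient a₀ of λ = λ_d has strictly smaller valuation than all
other coefficients. Let P (t - D) Q = diag(λ₁, …, λ_d).

(3) ⇒ (1): let t act on sequences as the shift. The row of sequences w = (y Dʲ)ⱼ is annihilated by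
t - D, so each entry of w P⁻¹ is annihilated by some λᵢ, hence by λ. As a₀ dominates λ, these entries
satisfy the recurrence inequality above, and w = (w P⁻¹) P recovers y.

(1) ⇒ (3): Dᴺ has a right inverse F divisible by any prescribed power of σ. As tᴺ ≡ Dᴺ modulo left
multiples of t - D, the last diagonal entry of P (tᴺ F - 1) P⁻¹ is a right multiple of λ: λ w = 1 - tᴺ r with
r ∈ σ 𝓞[t]. By Gauss' lemma λ is, up to scaling, a nonzero constant modulo σ.
-}

{-# OPTIONS --safe #-}
module Submission where

open import Defs
open import Level using (Level; _⊔_)
open import Algebra.Bundles using (Ring)
open import Algebra.Bundles.Raw using (RawRing)
open import Algebra.Definitions using (Invertible)
import Algebra.Definitions.RawMagma as Divisibility
import Algebra.Definitions.RawMonoid as Summation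
import Algebra.Definitions.RawSemiring as Exponentiation
import Algebra.Properties.CommutativeSemigroup as CommutativeSemigroupProperties
import Algebra.Properties.Ring as RingProperties
import Algebra.Properties.Semiring.Sum as SumProperties
open import Data.Bool.Base as Bool using (true; false)
open import Data.Fin.Base using (Fin; zero; suc; toℕ; fromℕ; fromℕ<; inject≤; combine; remQuot)
open import Data.Fin.Permutation.Components using (transpose; transpose-inverse)
import Data.Fin.Properties as Fin
open import Data.Integer.Base as ℤ using (ℤ; +_; -[1+_])
import Data.Integer.Properties as ℤ
open import Data.Integer.Tactic.RingSolver using (solve-∀)
open import Data.List.Base as List using (List; []; _∷_; length; allFin; filter)
open import Data.List.Membership.Propositional using (_∈_)
open import Data.List.Membership.Propositional.Properties using (∈-allFin)
open import Data.List.Properties using (length-filter; filter-all; filter-notAll)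
open import Data.List.Relation.Unary.All as All using (All; []; _∷_)
open import Data.List.Relation.Unary.All.Properties using (¬All⇒Any¬)
open import Data.List.Relation.Unary.Any using (here; there)
open import Data.List.Relation.Unary.Linked as Linked using (Linked; [-]; _∷_)
open import Data.Nat.Base as ℕ using (ℕ; zero; suc; z≤n; s≤s; _≤_; _<_)
import Data.Nat.Properties as ℕ
open import Data.Nat.Properties using (≤-refl)
open import Data.Product.Base using (Σ; ∃-syntax; _×_; _,_; proj₁; proj₂)
open import Data.Rational.Base as ℚ using (ℚ)
import Data.Rational.Properties as ℚ
open import Data.Rational.Unnormalised.Base as ℚᵘ using (ℚᵘ; mkℚᵘ)
import Data.Rational.Unnormalised.Properties as ℚᵘ
open import Data.Sum.Base using (_⊎_; inj₁; inj₂)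
open import Data.Vec.Base as Vec using (Vec; []; _∷_; last)
open import Data.Vec.Functional.Properties using (updateAt-updates; updateAt-minimal)
import Data.Vec.Relation.Unary.Linked as VecLinked
open import Function.Base using (_∘_)
open import Function.Bundles using (_⇔_; mk⇔; Equivalence)
open import Relation.Binary.Construct.Add.Supremum.NonStrict ℤ._≤_ using (≤⁺-dec; ≤⁺-total)
open import Relation.Binary.PropositionalEquality.Core as ≡ using (_≡_; _≢_)
open import Relation.Nullary.Decidable using (Dec; yes; no; does)
open import Relation.Nullary.Negation using (¬_; contradiction)

-- There is no commutative determinant to compare valuations with, and `σ` need not be central, so
-- every rank condition is turned into a statement about vectors, once for columns and once for
-- rows. The obstacle in relating `D` to its last invariant factor is that the transforming matrices
-- `P` and `Q` are invertible over 𝓛[t] only: passing through them may lower valuations and shift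
-- indices. These losses are fixed, since polynomials are finite, whereas the gain from a
-- contraction, or from powers of a small inverse, grows without bound with the exponent. The
-- exponents are chosen so that the gain exceeds the total loss by one. All searches (for pivots,
-- last minima, first edges) are effective because `v` decides whether an element vanishes.

-- Matrices over a ring; elementary operations as multiplication by invertible matrices.

module MatrixProperties {c ℓ : Level} (R : Ring c ℓ) where

  open Ring R hiding (zero)
  open Matrices rawRing
  open SumProperties semiring
  open import Relation.Binary.Reasoning.Setoid setoid

  Mat : ℕ → ℕ → Set c
  Mat = Matrix rawRing

  sum-zero : ∀ {n} {f : Fin n → Carrier} → (∀ i → f i ≈ 0#) → sum f ≈ 0#
  sum-zero {n} f≈0 = trans (sum-cong-≋ f≈0) (sum-replicate-zero n)

  sum-single : ∀ {n} {f : Fin n → Carrier} i → (∀ k → k ≢ i → f k ≈ 0#) → sum f ≈ f i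
  sum-single zero f≈0 =
    trans (+-congˡ (sum-zero (λ k → f≈0 (suc k) λ ()))) (+-identityʳ _)
  sum-single (suc i) f≈0 =
    trans (+-cong (f≈0 zero λ ()) (sum-single i (λ k k≢i → f≈0 (suc k) (k≢i ∘ Fin.suc-injective))))
          (+-identityˡ _)

  ≋-refl : ∀ {m n} {A : Mat m n} → A ≋ A
  ≋-refl i j = refl

  ≋-sym : ∀ {m n} {A B : Mat m n} → A ≋ B → B ≋ A
  ≋-sym A≋B i j = sym (A≋B i j)

  ≋-trans : ∀ {m n} {A B C : Mat m n} → A ≋ B → B ≋ C → A ≋ C
  ≋-trans A≋B B≋C i j = trans (A≋B i j) (B≋C i j)

  1ₘ-diagonal : ∀ {n} (i : Fin n) → 1ₘ i i ≈ 1#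
  1ₘ-diagonal i with i Fin.≟ i
  ... | yes _   = refl
  ... | no  i≢i = contradiction ≡.refl i≢i

  1ₘ-off : ∀ {n} {i j : Fin n} → i ≢ j → 1ₘ i j ≈ 0#
  1ₘ-off {i = i} {j} i≢j with i Fin.≟ j
  ... | yes i≡j = contradiction i≡j i≢j
  ... | no  _   = refl

  *ₘ-cong : ∀ {m n p} {A A′ : Mat m n} {B B′ : Mat n p} → A ≋ A′ → B ≋ B′ → A *ₘ B ≋ A′ *ₘ B′
  *ₘ-cong A≋A′ B≋B′ i j = sum-cong-≋ (λ k → *-cong (A≋A′ i k) (B≋B′ k j))

  *ₘ-congˡ : ∀ {m n p} (A : Mat m n) {B B′ : Mat n p} → B ≋ B′ → A *ₘ B ≋ A *ₘ B′
  *ₘ-congˡ A = *ₘ-cong {A = A} ≋-refl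

  *ₘ-congʳ : ∀ {m n p} {A A′ : Mat m n} (B : Mat n p) → A ≋ A′ → A *ₘ B ≋ A′ *ₘ B
  *ₘ-congʳ B A≋A′ = *ₘ-cong {B = B} A≋A′ ≋-refl

  *ₘ-assoc : ∀ {m n p q} (A : Mat m n) (B : Mat n p) (C : Mat p q) →
             (A *ₘ B) *ₘ C ≋ A *ₘ (B *ₘ C)
  *ₘ-assoc A B C i j = begin
    sum (λ l → sum (λ k → A i k * B k l) * C l j)    ≈⟨ sum-cong-≋ (λ l → *-distribʳ-sum (C l j) (λ k → A i k * B k l)) ⟩
    sum (λ l → sum (λ k → A i k * B k l * C l j))    ≈⟨ ∑-comm (λ l k → A i k * B k l * C l j) ⟩
    sum (λ k → sum (λ l → A i k * B k l * C l j))    ≈⟨ sum-cong-≋ (λ k → sum-cong-≋ (λ l → *-assoc (A i k) (B k l) (C l j))) ⟩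
    sum (λ k → sum (λ l → A i k * (B k l * C l j)))  ≈⟨ sum-cong-≋ (λ k → *-distribˡ-sum (A i k) (λ l → B k l * C l j)) ⟨
    sum (λ k → A i k * sum (λ l → B k l * C l j))    ∎

  *ₘ-identityˡ : ∀ {m n} (A : Mat m n) → 1ₘ *ₘ A ≋ A
  *ₘ-identityˡ A i j = begin
    sum (λ k → 1ₘ i k * A k j)  ≈⟨ sum-single i (λ k k≢i → trans (*-congʳ (1ₘ-off (k≢i ∘ ≡.sym))) (zeroˡ _)) ⟩
    1ₘ i i * A i j              ≈⟨ *-congʳ (1ₘ-diagonal i) ⟩
    1# * A i j                  ≈⟨ *-identityˡ _ ⟩
    A i j                       ∎

  *ₘ-identityʳ : ∀ {m n} (A : Mat m n) → A *ₘ 1ₘ ≋ A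
  *ₘ-identityʳ A i j = begin
    sum (λ k → A i k * 1ₘ k j)  ≈⟨ sum-single j (λ k k≢j → trans (*-congˡ (1ₘ-off k≢j)) (zeroʳ _)) ⟩
    A i j * 1ₘ j j              ≈⟨ *-congˡ (1ₘ-diagonal j) ⟩
    A i j * 1#                  ≈⟨ *-identityʳ _ ⟩
    A i j                       ∎

  *ₘ-cancel : ∀ {m n p} (U : Mat m n) (U′ : Mat n m) → U *ₘ U′ ≋ 1ₘ →
              (A : Mat m p) → U *ₘ (U′ *ₘ A) ≋ A
  *ₘ-cancel U U′ UU′ A =
    ≋-trans (≋-sym (*ₘ-assoc U U′ A)) (≋-trans (*ₘ-congʳ A UU′) (*ₘ-identityˡ A))

  *ₘ-cancelʳ : ∀ {m n p} (U : Mat m n) (U′ : Mat n m) → U *ₘ U′ ≋ 1ₘ →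
               (A : Mat p m) → (A *ₘ U) *ₘ U′ ≋ A
  *ₘ-cancelʳ U U′ UU′ A =
    ≋-trans (*ₘ-assoc A U U′) (≋-trans (*ₘ-congˡ A UU′) (*ₘ-identityʳ A))

  ^ₘ-+ : ∀ {d} (A : Mat d d) k l → A ^ₘ (k ℕ.+ l) ≋ A ^ₘ k *ₘ A ^ₘ l
  ^ₘ-+ A zero    l = ≋-sym (*ₘ-identityˡ (A ^ₘ l))
  ^ₘ-+ A (suc k) l = ≋-trans (*ₘ-congˡ A (^ₘ-+ A k l)) (≋-sym (*ₘ-assoc A (A ^ₘ k) (A ^ₘ l)))

  ^ₘ-sucʳ : ∀ {d} (A : Mat d d) k → A ^ₘ suc k ≋ A ^ₘ k *ₘ A
  ^ₘ-sucʳ A zero    = ≋-trans (*ₘ-identityʳ A) (≋-sym (*ₘ-identityˡ A))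
  ^ₘ-sucʳ A (suc k) = ≋-trans (*ₘ-congˡ A (^ₘ-sucʳ A k)) (≋-sym (*ₘ-assoc A (A ^ₘ k) A))

  module _ {m : ℕ} (f : ∀ {n} → Mat m n → Mat m n) where

    -- Polymorphic in the number of columns, so that `f` applies to `1ₘ` too: compatibility with
    -- right multiplication then gives `f A = f 1ₘ *ₘ A`, and the elementary matrix `f 1ₘ` never has
    -- to be written out.
    record RowOperation : Set (c ⊔ ℓ) where
      field
        cong    : ∀ {n} {A B : Mat m n} → A ≋ B → f A ≋ f B
        act     : ∀ {n p} (A : Mat m n) (B : Mat n p) → f (A *ₘ B) ≋ f A *ₘ B

  module _ {n : ℕ} (f : ∀ {m} → Mat m n → Mat m n) where

    record ColumnOperation : Set (c ⊔ ℓ) where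
      field
        cong    : ∀ {m} {A B : Mat m n} → A ≋ B → f A ≋ f B
        act     : ∀ {m p} (A : Mat p m) (B : Mat m n) → f (A *ₘ B) ≋ A *ₘ f B

  addRow-at : ∀ {m n} i j c (A : Mat m n) l → addRow i j c A i l ≡ A i l + c * A j l
  addRow-at i j c A l = ≡.cong (λ r → r l) (updateAt-updates i A)

  addRow-off : ∀ {m n} i j c (A : Mat m n) {k} → k ≢ i → ∀ l → addRow i j c A k l ≡ A k l
  addRow-off i j c A k≢i l = ≡.cong (λ r → r l) (updateAt-minimal _ i A k≢i)

  scaleRow-at : ∀ {m n} i u (A : Mat m n) l → scaleRow i u A i l ≡ u * A i l
  scaleRow-at i u A l = ≡.cong (λ r → r l) (updateAt-updates i A)

  scaleRow-off : ∀ {m n} i u (A : Mat m n) {k} → k ≢ i → ∀ l → scaleRow i u A k l ≡ A k l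
  scaleRow-off i u A k≢i l = ≡.cong (λ r → r l) (updateAt-minimal _ i A k≢i)

  addColumn-at : ∀ {m n} i j c (A : Mat m n) k → addColumn i j c A k i ≡ A k i + A k j * c
  addColumn-at i j c A k = updateAt-updates i (A k)

  addColumn-off : ∀ {m n} i j c (A : Mat m n) k {l} → l ≢ i → addColumn i j c A k l ≡ A k l
  addColumn-off i j c A k l≢i = updateAt-minimal _ i (A k) l≢i

  scaleColumn-at : ∀ {m n} i u (A : Mat m n) k → scaleColumn i u A k i ≡ A k i * u
  scaleColumn-at i u A k = updateAt-updates i (A k)

  scaleColumn-off : ∀ {m n} i u (A : Mat m n) k {l} → l ≢ i → scaleColumn i u A k l ≡ A k l
  scaleColumn-off i u A k l≢i = updateAt-minimal _ i (A k) l≢i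

  addRow-operation : ∀ {m} (i j : Fin m) c → RowOperation (addRow i j c)
  addRow-operation i j c = record { cong = cong′ ; act = act′ }
    where
    cong′ : ∀ {n} {A B : Mat _ n} → A ≋ B → addRow i j c A ≋ addRow i j c B
    cong′ {A = A} {B} A≋B k l with k Fin.≟ i
    ... | yes ≡.refl = begin
      addRow i j c A i l  ≡⟨ addRow-at i j c A l ⟩
      A i l + c * A j l   ≈⟨ +-cong (A≋B i l) (*-congˡ (A≋B j l)) ⟩
      B i l + c * B j l   ≡⟨ addRow-at i j c B l ⟨
      addRow i j c B i l  ∎
    ... | no k≢i = begin
      addRow i j c A k l  ≡⟨ addRow-off i j c A k≢i l ⟩
      A k l               ≈⟨ A≋B k l ⟩
      B k l               ≡⟨ addRow-off i j c B k≢i l ⟨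
      addRow i j c B k l  ∎

    act′ : ∀ {n p} (A : Mat _ n) (B : Mat n p) → addRow i j c (A *ₘ B) ≋ addRow i j c A *ₘ B
    act′ A B k l with k Fin.≟ i
    ... | yes ≡.refl = begin
      addRow i j c (A *ₘ B) i l                                  ≡⟨ addRow-at i j c (A *ₘ B) l ⟩
      (A *ₘ B) i l + c * (A *ₘ B) j l                            ≈⟨ +-congˡ (*-distribˡ-sum c (λ x → A j x * B x l)) ⟩
      (A *ₘ B) i l + sum (λ x → c * (A j x * B x l))             ≈⟨ ∑-distrib-+ (λ x → A i x * B x l) (λ x → c * (A j x * B x l)) ⟨
      sum (λ x → A i x * B x l + c * (A j x * B x l))            ≈⟨ sum-cong-≋ (λ x → trans (+-congˡ (sym (*-assoc c _ _))) (sym (distribʳ (B x l) (A i x) (c * A j x)))) ⟩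
      sum (λ x → (A i x + c * A j x) * B x l)                    ≈⟨ sum-cong-≋ (λ x → *-congʳ (reflexive (addRow-at i j c A x))) ⟨
      sum (λ x → addRow i j c A i x * B x l)                     ∎
    ... | no k≢i = begin
      addRow i j c (A *ₘ B) k l                ≡⟨ addRow-off i j c (A *ₘ B) k≢i l ⟩
      (A *ₘ B) k l                             ≈⟨ sum-cong-≋ (λ x → *-congʳ (reflexive (addRow-off i j c A k≢i x))) ⟨
      sum (λ x → addRow i j c A k x * B x l)   ∎

  -- As `i ≢ j`, the first operation leaves row `j` alone, so the second one adds a multiple of the
  -- same row and the two coefficients add up.
  addRow-inverse : ∀ {m n} {i j : Fin m} {c c′} → i ≢ j → c + c′ ≈ 0# →
                   (A : Mat m n) → addRow i j c′ (addRow i j c A) ≋ A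
  addRow-inverse {i = i} {j} {c} {c′} i≢j c+c′≈0 A k l with k Fin.≟ i
  ... | yes ≡.refl = begin
    addRow i j c′ (addRow i j c A) i l              ≡⟨ addRow-at i j c′ (addRow i j c A) l ⟩
    addRow i j c A i l + c′ * addRow i j c A j l    ≡⟨ ≡.cong₂ (λ x y → x + c′ * y) (addRow-at i j c A l) (addRow-off i j c A (i≢j ∘ ≡.sym) l) ⟩
    A i l + c * A j l + c′ * A j l                  ≈⟨ +-assoc _ _ _ ⟩
    A i l + (c * A j l + c′ * A j l)                ≈⟨ +-congˡ (trans (sym (distribʳ (A j l) c c′)) (trans (*-congʳ c+c′≈0) (zeroˡ _))) ⟩
    A i l + 0#                                      ≈⟨ +-identityʳ _ ⟩
    A i l                                           ∎
  ... | no k≢i = reflexive (≡.trans (addRow-off i j c′ (addRow i j c A) k≢i l) (addRow-off i j c A k≢i l))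

  addColumn-operation : ∀ {n} (i j : Fin n) c → ColumnOperation (addColumn i j c)
  addColumn-operation i j c = record { cong = cong′ ; act = act′ }
    where
    cong′ : ∀ {m} {A B : Mat m _} → A ≋ B → addColumn i j c A ≋ addColumn i j c B
    cong′ {A = A} {B} A≋B k l with l Fin.≟ i
    ... | yes ≡.refl = begin
      addColumn i j c A k i  ≡⟨ addColumn-at i j c A k ⟩
      A k i + A k j * c      ≈⟨ +-cong (A≋B k i) (*-congʳ (A≋B k j)) ⟩
      B k i + B k j * c      ≡⟨ addColumn-at i j c B k ⟨
      addColumn i j c B k i  ∎
    ... | no l≢i = begin
      addColumn i j c A k l  ≡⟨ addColumn-off i j c A k l≢i ⟩
      A k l                  ≈⟨ A≋B k l ⟩
      B k l                  ≡⟨ addColumn-off i j c B k l≢i ⟨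
      addColumn i j c B k l  ∎

    act′ : ∀ {m p} (A : Mat p m) (B : Mat m _) → addColumn i j c (A *ₘ B) ≋ A *ₘ addColumn i j c B
    act′ A B k l with l Fin.≟ i
    ... | yes ≡.refl = begin
      addColumn i j c (A *ₘ B) k i                       ≡⟨ addColumn-at i j c (A *ₘ B) k ⟩
      (A *ₘ B) k i + (A *ₘ B) k j * c                    ≈⟨ +-congˡ (*-distribʳ-sum c (λ x → A k x * B x j)) ⟩
      (A *ₘ B) k i + sum (λ x → A k x * B x j * c)       ≈⟨ ∑-distrib-+ (λ x → A k x * B x i) (λ x → A k x * B x j * c) ⟨
      sum (λ x → A k x * B x i + A k x * B x j * c)      ≈⟨ sum-cong-≋ (λ x → trans (+-congˡ (*-assoc _ _ c)) (sym (distribˡ (A k x) (B x i) (B x j * c)))) ⟩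
      sum (λ x → A k x * (B x i + B x j * c))            ≈⟨ sum-cong-≋ (λ x → *-congˡ (reflexive (addColumn-at i j c B x))) ⟨
      sum (λ x → A k x * addColumn i j c B x i)          ∎
    ... | no l≢i = begin
      addColumn i j c (A *ₘ B) k l                ≡⟨ addColumn-off i j c (A *ₘ B) k l≢i ⟩
      (A *ₘ B) k l                                ≈⟨ sum-cong-≋ (λ x → *-congˡ (reflexive (addColumn-off i j c B x l≢i))) ⟨
      sum (λ x → A k x * addColumn i j c B x l)   ∎

  addColumn-inverse : ∀ {m n} {i j : Fin n} {c c′} → i ≢ j → c + c′ ≈ 0# →
                      (A : Mat m n) → addColumn i j c′ (addColumn i j c A) ≋ A
  addColumn-inverse {i = i} {j} {c} {c′} i≢j c+c′≈0 A k l with l Fin.≟ i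
  ... | yes ≡.refl = begin
    addColumn i j c′ (addColumn i j c A) k i               ≡⟨ addColumn-at i j c′ (addColumn i j c A) k ⟩
    addColumn i j c A k i + addColumn i j c A k j * c′     ≡⟨ ≡.cong₂ (λ x y → x + y * c′) (addColumn-at i j c A k) (addColumn-off i j c A k (i≢j ∘ ≡.sym)) ⟩
    A k i + A k j * c + A k j * c′                         ≈⟨ +-assoc _ _ _ ⟩
    A k i + (A k j * c + A k j * c′)                       ≈⟨ +-congˡ (trans (sym (distribˡ (A k j) c c′)) (trans (*-congˡ c+c′≈0) (zeroʳ _))) ⟩
    A k i + 0#                                             ≈⟨ +-identityʳ _ ⟩
    A k i                                                  ∎
  ... | no l≢i = reflexive (≡.trans (addColumn-off i j c′ (addColumn i j c A) k l≢i) (addColumn-off i j c A k l≢i))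

  scaleRow-operation : ∀ {m} (i : Fin m) u → RowOperation (scaleRow i u)
  scaleRow-operation i u = record { cong = cong′ ; act = act′ }
    where
    cong′ : ∀ {n} {A B : Mat _ n} → A ≋ B → scaleRow i u A ≋ scaleRow i u B
    cong′ {A = A} {B} A≋B k l with k Fin.≟ i
    ... | yes ≡.refl = begin
      scaleRow i u A i l  ≡⟨ scaleRow-at i u A l ⟩
      u * A i l           ≈⟨ *-congˡ (A≋B i l) ⟩
      u * B i l           ≡⟨ scaleRow-at i u B l ⟨
      scaleRow i u B i l  ∎
    ... | no k≢i = begin
      scaleRow i u A k l  ≡⟨ scaleRow-off i u A k≢i l ⟩
      A k l               ≈⟨ A≋B k l ⟩
      B k l               ≡⟨ scaleRow-off i u B k≢i l ⟨
      scaleRow i u B k l  ∎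

    act′ : ∀ {n p} (A : Mat _ n) (B : Mat n p) → scaleRow i u (A *ₘ B) ≋ scaleRow i u A *ₘ B
    act′ A B k l with k Fin.≟ i
    ... | yes ≡.refl = begin
      scaleRow i u (A *ₘ B) i l                 ≡⟨ scaleRow-at i u (A *ₘ B) l ⟩
      u * (A *ₘ B) i l                          ≈⟨ *-distribˡ-sum u (λ x → A i x * B x l) ⟩
      sum (λ x → u * (A i x * B x l))           ≈⟨ sum-cong-≋ (λ x → *-assoc u (A i x) (B x l)) ⟨
      sum (λ x → u * A i x * B x l)             ≈⟨ sum-cong-≋ (λ x → *-congʳ (reflexive (scaleRow-at i u A x))) ⟨
      sum (λ x → scaleRow i u A i x * B x l)    ∎
    ... | no k≢i = begin
      scaleRow i u (A *ₘ B) k l                 ≡⟨ scaleRow-off i u (A *ₘ B) k≢i l ⟩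
      (A *ₘ B) k l                              ≈⟨ sum-cong-≋ (λ x → *-congʳ (reflexive (scaleRow-off i u A k≢i x))) ⟨
      sum (λ x → scaleRow i u A k x * B x l)    ∎

  scaleRow-inverse : ∀ {m n} {i : Fin m} {u u′} → u′ * u ≈ 1# →
                     (A : Mat m n) → scaleRow i u′ (scaleRow i u A) ≋ A
  scaleRow-inverse {i = i} {u} {u′} u′u≈1 A k l with k Fin.≟ i
  ... | yes ≡.refl = begin
    scaleRow i u′ (scaleRow i u A) i l  ≡⟨ scaleRow-at i u′ (scaleRow i u A) l ⟩
    u′ * scaleRow i u A i l             ≡⟨ ≡.cong (u′ *_) (scaleRow-at i u A l) ⟩
    u′ * (u * A i l)                    ≈⟨ *-assoc u′ u (A i l) ⟨
    u′ * u * A i l                      ≈⟨ *-congʳ u′u≈1 ⟩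
    1# * A i l                          ≈⟨ *-identityˡ _ ⟩
    A i l                               ∎
  ... | no k≢i = reflexive (≡.trans (scaleRow-off i u′ (scaleRow i u A) k≢i l) (scaleRow-off i u A k≢i l))

  scaleColumn-operation : ∀ {n} (i : Fin n) u → ColumnOperation (scaleColumn i u)
  scaleColumn-operation i u = record { cong = cong′ ; act = act′ }
    where
    cong′ : ∀ {m} {A B : Mat m _} → A ≋ B → scaleColumn i u A ≋ scaleColumn i u B
    cong′ {A = A} {B} A≋B k l with l Fin.≟ i
    ... | yes ≡.refl = begin
      scaleColumn i u A k i  ≡⟨ scaleColumn-at i u A k ⟩
      A k i * u              ≈⟨ *-congʳ (A≋B k i) ⟩
      B k i * u              ≡⟨ scaleColumn-at i u B k ⟨
      scaleColumn i u B k i  ∎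
    ... | no l≢i = begin
      scaleColumn i u A k l  ≡⟨ scaleColumn-off i u A k l≢i ⟩
      A k l                  ≈⟨ A≋B k l ⟩
      B k l                  ≡⟨ scaleColumn-off i u B k l≢i ⟨
      scaleColumn i u B k l  ∎

    act′ : ∀ {m p} (A : Mat p m) (B : Mat m _) → scaleColumn i u (A *ₘ B) ≋ A *ₘ scaleColumn i u B
    act′ A B k l with l Fin.≟ i
    ... | yes ≡.refl = begin
      scaleColumn i u (A *ₘ B) k i                ≡⟨ scaleColumn-at i u (A *ₘ B) k ⟩
      (A *ₘ B) k i * u                            ≈⟨ *-distribʳ-sum u (λ x → A k x * B x i) ⟩
      sum (λ x → A k x * B x i * u)               ≈⟨ sum-cong-≋ (λ x → *-assoc (A k x) (B x i) u) ⟩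
      sum (λ x → A k x * (B x i * u))             ≈⟨ sum-cong-≋ (λ x → *-congˡ (reflexive (scaleColumn-at i u B x))) ⟨
      sum (λ x → A k x * scaleColumn i u B x i)   ∎
    ... | no l≢i = begin
      scaleColumn i u (A *ₘ B) k l                ≡⟨ scaleColumn-off i u (A *ₘ B) k l≢i ⟩
      (A *ₘ B) k l                                ≈⟨ sum-cong-≋ (λ x → *-congˡ (reflexive (scaleColumn-off i u B x l≢i))) ⟨
      sum (λ x → A k x * scaleColumn i u B x l)   ∎

  scaleColumn-inverse : ∀ {m n} {i : Fin n} {u u′} → u * u′ ≈ 1# →
                        (A : Mat m n) → scaleColumn i u′ (scaleColumn i u A) ≋ A
  scaleColumn-inverse {i = i} {u} {u′} uu′≈1 A k l with l Fin.≟ i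
  ... | yes ≡.refl = begin
    scaleColumn i u′ (scaleColumn i u A) k i  ≡⟨ scaleColumn-at i u′ (scaleColumn i u A) k ⟩
    scaleColumn i u A k i * u′                ≡⟨ ≡.cong (_* u′) (scaleColumn-at i u A k) ⟩
    A k i * u * u′                            ≈⟨ *-assoc (A k i) u u′ ⟩
    A k i * (u * u′)                          ≈⟨ *-congˡ uu′≈1 ⟩
    A k i * 1#                                ≈⟨ *-identityʳ _ ⟩
    A k i                                     ∎
  ... | no l≢i = reflexive (≡.trans (scaleColumn-off i u′ (scaleColumn i u A) k l≢i) (scaleColumn-off i u A k l≢i))

  swapRows-operation : ∀ {m} (i j : Fin m) → RowOperation (swapRows i j)
  swapRows-operation i j = record { cong = λ A≋B k → A≋B (transpose i j k) ; act = λ _ _ _ _ → refl }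

  swapRows-inverse : ∀ {m n} (i j : Fin m) (A : Mat m n) → swapRows j i (swapRows i j A) ≋ A
  swapRows-inverse i j A k l = reflexive (≡.cong (λ x → A x l) (transpose-inverse i j))

  swapColumns-operation : ∀ {n} (i j : Fin n) → ColumnOperation (swapColumns i j)
  swapColumns-operation i j = record { cong = λ A≋B k l → A≋B k (transpose i j l) ; act = λ _ _ _ _ → refl }

  swapColumns-inverse : ∀ {m n} (i j : Fin n) (A : Mat m n) → swapColumns j i (swapColumns i j A) ≋ A
  swapColumns-inverse i j A k l = reflexive (≡.cong (A k) (transpose-inverse i j))

  -- Both products with each inverse are recorded, because a one-sided inverse of a square matrix
  -- over a general ring need not be two-sided; `PA` rests on `QQ⁻¹` and `AQ` on `P⁻¹P`.
  record Equivalent {m n : ℕ} (A B : Mat m n) : Set (c ⊔ ℓ) where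
    field
      P P⁻¹ : Mat m m
      Q Q⁻¹ : Mat n n
      PP⁻¹  : P *ₘ P⁻¹ ≋ 1ₘ
      P⁻¹P  : P⁻¹ *ₘ P ≋ 1ₘ
      QQ⁻¹  : Q *ₘ Q⁻¹ ≋ 1ₘ
      Q⁻¹Q  : Q⁻¹ *ₘ Q ≋ 1ₘ
      PAQ   : P *ₘ (A *ₘ Q) ≋ B

    PA : P *ₘ A ≋ B *ₘ Q⁻¹
    PA = ≋-trans (≋-sym (*ₘ-cancelʳ Q Q⁻¹ QQ⁻¹ (P *ₘ A)))
                 (*ₘ-congʳ Q⁻¹ (≋-trans (*ₘ-assoc P A Q) PAQ))

    AQ : A *ₘ Q ≋ P⁻¹ *ₘ B
    AQ = ≋-trans (≋-sym (*ₘ-cancel P⁻¹ P P⁻¹P (A *ₘ Q))) (*ₘ-congˡ P⁻¹ PAQ)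

  product-inverse : ∀ {n} (U U′ V V′ : Mat n n) → U *ₘ U′ ≋ 1ₘ → V *ₘ V′ ≋ 1ₘ →
                    (U *ₘ V) *ₘ (V′ *ₘ U′) ≋ 1ₘ
  product-inverse U U′ V V′ UU′ VV′ =
    ≋-trans (*ₘ-assoc U V (V′ *ₘ U′)) (≋-trans (*ₘ-congˡ U (*ₘ-cancel V V′ VV′ U′)) UU′)

  module _ {m n : ℕ} {A B : Mat m n} where

    -- Operations are listed in the order of execution, so the first one stands nearest to `A`: its
    -- matrix goes to the right of the `P` collected from the later ones. For columns it goes to the
    -- left of `Q`.
    stepRow : {f g : ∀ {n} → Mat m n → Mat m n} → RowOperation f → RowOperation g →
              (∀ {n} (A : Mat m n) → f (g A) ≋ A) → (∀ {n} (A : Mat m n) → g (f A) ≋ A) →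
              Equivalent (f A) B → Equivalent A B
    stepRow {f} {g} F G fg gf e = record
      { P = P *ₘ f 1ₘ ; P⁻¹ = g 1ₘ *ₘ P⁻¹ ; Q = Q ; Q⁻¹ = Q⁻¹
      ; PP⁻¹ = product-inverse P P⁻¹ (f 1ₘ) (g 1ₘ) PP⁻¹ (inverse F fg) ; P⁻¹P = product-inverse (g 1ₘ) (f 1ₘ) P⁻¹ P (inverse G gf) P⁻¹P
      ; QQ⁻¹ = QQ⁻¹ ; Q⁻¹Q = Q⁻¹Q
      ; PAQ = ≋-trans (*ₘ-assoc P (f 1ₘ) (A *ₘ Q))
                (≋-trans (*ₘ-congˡ P (≋-trans (≋-sym (*ₘ-assoc (f 1ₘ) A Q)) (*ₘ-congʳ Q (≋-sym (matrix F A))))) PAQ)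
      }
      where
      open Equivalent e

      matrix : {f : ∀ {n} → Mat m n → Mat m n} → RowOperation f →
               ∀ {n} (A : Mat m n) → f A ≋ f 1ₘ *ₘ A
      matrix F A = ≋-trans (RowOperation.cong F (≋-sym (*ₘ-identityˡ A))) (RowOperation.act F 1ₘ A)

      inverse : {f g : ∀ {n} → Mat m n → Mat m n} → RowOperation f →
                (∀ {n} (A : Mat m n) → f (g A) ≋ A) → f 1ₘ *ₘ g 1ₘ ≋ 1ₘ
      inverse {g = g} F fg = ≋-trans (≋-sym (matrix F (g 1ₘ))) (fg 1ₘ)

    stepColumn : {f g : ∀ {m} → Mat m n → Mat m n} → ColumnOperation f → ColumnOperation g →
                 (∀ {m} (A : Mat m n) → f (g A) ≋ A) → (∀ {m} (A : Mat m n) → g (f A) ≋ A) →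
                 Equivalent (f A) B → Equivalent A B
    stepColumn {f} {g} F G fg gf e = record
      { P = P ; P⁻¹ = P⁻¹ ; Q = f 1ₘ *ₘ Q ; Q⁻¹ = Q⁻¹ *ₘ g 1ₘ
      ; PP⁻¹ = PP⁻¹ ; P⁻¹P = P⁻¹P
      ; QQ⁻¹ = product-inverse (f 1ₘ) (g 1ₘ) Q Q⁻¹ (inverse G gf) QQ⁻¹ ; Q⁻¹Q = product-inverse Q⁻¹ Q (g 1ₘ) (f 1ₘ) Q⁻¹Q (inverse F fg)
      ; PAQ = ≋-trans (*ₘ-congˡ P (≋-trans (≋-sym (*ₘ-assoc A (f 1ₘ) Q)) (*ₘ-congʳ Q (≋-sym (matrix F A))))) PAQ
      }
      where
      open Equivalent e

      matrix : {f : ∀ {m} → Mat m n → Mat m n} → ColumnOperation f →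
               ∀ {m} (A : Mat m n) → f A ≋ A *ₘ f 1ₘ
      matrix F A = ≋-trans (ColumnOperation.cong F (≋-sym (*ₘ-identityʳ A))) (ColumnOperation.act F A 1ₘ)

      inverse : {f g : ∀ {m} → Mat m n → Mat m n} → ColumnOperation f →
                (∀ {m} (A : Mat m n) → f (g A) ≋ A) → g 1ₘ *ₘ f 1ₘ ≋ 1ₘ
      inverse {g = g} F fg = ≋-trans (≋-sym (matrix F (g 1ₘ))) (fg 1ₘ)

  ⇝⇒equivalent : ∀ {m n} {A B : Mat m n} → A ⇝ B → Equivalent A B
  ⇝⇒equivalent {A = A} (done A≋B) = record
    { P = 1ₘ ; P⁻¹ = 1ₘ ; Q = 1ₘ ; Q⁻¹ = 1ₘ
    ; PP⁻¹ = *ₘ-identityˡ 1ₘ ; P⁻¹P = *ₘ-identityˡ 1ₘ ; QQ⁻¹ = *ₘ-identityˡ 1ₘ ; Q⁻¹Q = *ₘ-identityˡ 1ₘ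
    ; PAQ = ≋-trans (*ₘ-identityˡ (A *ₘ 1ₘ)) (≋-trans (*ₘ-identityʳ A) A≋B) }
  ⇝⇒equivalent (row+ {i} {j} c i≢j r) =
    stepRow (addRow-operation i j c) (addRow-operation i j (- c))
      (addRow-inverse i≢j (-‿inverseˡ c)) (addRow-inverse i≢j (-‿inverseʳ c)) (⇝⇒equivalent r)
  ⇝⇒equivalent (column+ {i} {j} c i≢j r) =
    stepColumn (addColumn-operation i j c) (addColumn-operation i j (- c))
      (addColumn-inverse i≢j (-‿inverseˡ c)) (addColumn-inverse i≢j (-‿inverseʳ c)) (⇝⇒equivalent r)
  ⇝⇒equivalent (row* {i} {u} (u′ , u′u , uu′) r) =
    stepRow (scaleRow-operation i u) (scaleRow-operation i u′)
      (scaleRow-inverse uu′) (scaleRow-inverse u′u) (⇝⇒equivalent r)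
  ⇝⇒equivalent (column* {i} {u} (u′ , u′u , uu′) r) =
    stepColumn (scaleColumn-operation i u) (scaleColumn-operation i u′)
      (scaleColumn-inverse u′u) (scaleColumn-inverse uu′) (⇝⇒equivalent r)
  ⇝⇒equivalent (row↔ i j r) =
    stepRow (swapRows-operation i j) (swapRows-operation j i)
      (swapRows-inverse j i) (swapRows-inverse i j) (⇝⇒equivalent r)
  ⇝⇒equivalent (column↔ i j r) =
    stepColumn (swapColumns-operation i j) (swapColumns-operation j i)
      (swapColumns-inverse j i) (swapColumns-inverse i j) (⇝⇒equivalent r)

  -- Entrywise equality enters a derivation only at its end, in `done`; to start from an equal
  -- matrix, the equality has to be pushed through every operation.
  ⇝-resp : ∀ {m n} {A A′ B : Mat m n} → A ≋ A′ → A′ ⇝ B → A ⇝ B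
  ⇝-resp A≋A′ (done A′≋B)         = done (≋-trans A≋A′ A′≋B)
  ⇝-resp A≋A′ (row+ c i≢j r)      = row+ c i≢j (⇝-resp (RowOperation.cong (addRow-operation _ _ c) A≋A′) r)
  ⇝-resp A≋A′ (column+ c i≢j r)   = column+ c i≢j (⇝-resp (ColumnOperation.cong (addColumn-operation _ _ c) A≋A′) r)
  ⇝-resp A≋A′ (row* inv r)        = row* inv (⇝-resp (RowOperation.cong (scaleRow-operation _ _) A≋A′) r)
  ⇝-resp A≋A′ (column* inv r)     = column* inv (⇝-resp (ColumnOperation.cong (scaleColumn-operation _ _) A≋A′) r)
  ⇝-resp A≋A′ (row↔ i j r)        = row↔ i j (⇝-resp (RowOperation.cong (swapRows-operation i j) A≋A′) r)
  ⇝-resp A≋A′ (column↔ i j r)     = column↔ i j (⇝-resp (ColumnOperation.cong (swapColumns-operation i j) A≋A′) r)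

  ⇝-trans : ∀ {m n} {A B C : Mat m n} → A ⇝ B → B ⇝ C → A ⇝ C
  ⇝-trans (done A≋B)        r = ⇝-resp A≋B r
  ⇝-trans (row+ c i≢j q)    r = row+ c i≢j (⇝-trans q r)
  ⇝-trans (column+ c i≢j q) r = column+ c i≢j (⇝-trans q r)
  ⇝-trans (row* inv q)      r = row* inv (⇝-trans q r)
  ⇝-trans (column* inv q)   r = column* inv (⇝-trans q r)
  ⇝-trans (row↔ i j q)      r = row↔ i j (⇝-trans q r)
  ⇝-trans (column↔ i j q)   r = column↔ i j (⇝-trans q r)

-- Reduces a linear inequality to a ring identity: the known and the wanted inequality have the same
-- difference of sides, which the ring solver can check.
≤-via : ∀ {i j k l} → i ℤ.≤ j → l ℤ.- k ≡ j ℤ.- i → k ℤ.≤ l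
≤-via i≤j eq = ℤ.0≤i-j⇒j≤i (≡.subst (+ 0 ℤ.≤_) (≡.sym eq) (ℤ.i≤j⇒0≤j-i i≤j))

≡-via : ∀ {i j k l} → i ≡ j → l ℤ.- k ≡ j ℤ.- i → k ≡ l
≡-via {i} {j} {k} {l} i≡j eq =
  ≡.sym (ℤ.i-j≡0⇒i≡j l k (≡.trans eq (ℤ.i≡j⇒i-j≡0 (≡.sym i≡j))))

-- Valuation estimates and the valuation ring.

module ValuationProperties {c ℓ : Level} (𝓛 : CompleteDiscretelyValuedSkewField c ℓ) where

  open CompleteDiscretelyValuedSkewField 𝓛 hiding (zero)
  open Valuation 𝓛 using (≤∞-trans; +∞-mono; ⊓∞-glb; integral-1; integral-neg; 𝓞; σ𝓞)
  open Exponentiation (RawRing.rawSemiring 𝓞) using () renaming (_^_ to _^𝓞_)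
  open RingProperties ring using (-1*x≈-x)
  open import Relation.Binary.Reasoning.Setoid setoid

  infix 4 _≤v_ _≤v?_

  -- Estimates are phrased as lower bounds, which pass through sums and products and hold for zero
  -- without exception. Exact values `v x ≡ [ a ]` are kept for elements that have to be cancelled.
  _≤v_ : ℤ → Carrier → Set
  a ≤v x = [ a ] ≤∞ v x

  _≤v?_ : ∀ a x → Dec (a ≤v x)
  a ≤v? x = ≤⁺-dec ℤ._≤?_ [ a ] (v x)

  []-injective : ∀ {a b} → _≡_ {A = ℤ∞} [ a ] [ b ] → a ≡ b
  []-injective ≡.refl = ≡.refl

  [≤]-injective : ∀ {a b} → [ a ] ≤∞ [ b ] → a ℤ.≤ b
  [≤]-injective [ a≤b ] = a≤b

  ≤v-cong : ∀ {a x y} → x ≈ y → a ≤v x → a ≤v y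
  ≤v-cong {a} x≈y = ≡.subst ([ a ] ≤∞_) (v-cong x≈y)

  ≤v-weaken : ∀ {a b x} → b ℤ.≤ a → a ≤v x → b ≤v x
  ≤v-weaken b≤a = ≤∞-trans [ b≤a ]

  ≤v-≡ : ∀ {a b x} → a ≡ b → a ≤v x → b ≤v x
  ≤v-≡ ≡.refl a≤x = a≤x

  ≡⇒≤v : ∀ {a x} → v x ≡ [ a ] → a ≤v x
  ≡⇒≤v {a} vx≡a = ≡.subst ([ a ] ≤∞_) (≡.sym vx≡a) [ ℤ.≤-refl ]

  v≡∧≤v⇒≤ : ∀ {a b x} → v x ≡ [ a ] → b ≤v x → b ℤ.≤ a
  v≡∧≤v⇒≤ {b = b} vx≡a b≤vx = [≤]-injective (≡.subst ([ b ] ≤∞_) vx≡a b≤vx)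

  ≤v-0 : ∀ {a} → a ≤v 0#
  ≤v-0 {a} = ≡.subst ([ a ] ≤∞_) (≡.sym (Equivalence.from (v-∞ 0#) refl)) (_ ≤⊤⁺)

  ≤v-≈0 : ∀ {a x} → x ≈ 0# → a ≤v x
  ≤v-≈0 x≈0 = ≤v-cong (sym x≈0) ≤v-0

  ≤v-+ : ∀ {a x y} → a ≤v x → a ≤v y → a ≤v (x + y)
  ≤v-+ p q = ≤∞-trans (⊓∞-glb p q) (v-+ _ _)

  ≤v-* : ∀ {a b x y} → a ≤v x → b ≤v y → a ℤ.+ b ≤v (x * y)
  ≤v-* {a} {b} {x} {y} p q = ≡.subst ([ a ℤ.+ b ] ≤∞_) (≡.sym (v-* x y)) (+∞-mono p q)

  ≤v-sum : ∀ {a n} {f : Fin n → Carrier} → (∀ i → a ≤v f i) → a ≤v sum f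
  ≤v-sum {n = zero}  f≥ = ≤v-0
  ≤v-sum {n = suc n} f≥ = ≤v-+ (f≥ zero) (≤v-sum (f≥ ∘ suc))

  ≤v-neg : ∀ {a x} → a ≤v x → a ≤v (- x)
  ≤v-neg {a} {x} a≤x = ≤v-≡ (ℤ.+-identityˡ a)
    (≤v-cong (-1*x≈-x x) (≤v-* (integral-neg integral-1) a≤x))

  -- The equality of 𝓛 is not assumed decidable, but a value in `ℤ∞` is visibly finite or infinite.
  ≈0? : ∀ x → Dec (x ≈ 0#)
  ≈0? x with v x in eq
  ... | [ _ ] = no λ x≈0 → contradiction (≡.trans (≡.sym eq) (Equivalence.from (v-∞ x) x≈0)) λ ()
  ... | ∞     = yes (Equivalence.to (v-∞ x) eq)

  v-finite : ∀ {x} → ¬ (x ≈ 0#) → ∃[ a ] v x ≡ [ a ]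
  v-finite {x} x≉0 with v x in eq
  ... | [ a ] = a , ≡.refl
  ... | ∞     = contradiction (Equivalence.to (v-∞ x) eq) x≉0

  v≡⇒≉0 : ∀ {a x} → v x ≡ [ a ] → ¬ (x ≈ 0#)
  v≡⇒≉0 {x = x} vx≡a x≈0 = contradiction (≡.trans (≡.sym vx≡a) (Equivalence.from (v-∞ x) x≈0)) λ ()

  v-*≡ : ∀ {a b x y} → v x ≡ [ a ] → v y ≡ [ b ] → v (x * y) ≡ [ a ℤ.+ b ]
  v-*≡ {x = x} {y} vx vy = ≡.trans (v-* x y) (≡.cong₂ _+∞_ vx vy)

  v-1 : v 1# ≡ [ + 0 ]
  v-1 with v-finite 1≉0
  ... | a , v1≡a = ≡.trans v1≡a (≡.cong [_] (a≡a+a⇒a≡0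
          ([]-injective (≡.trans (≡.sym v1≡a) (≡.trans (v-cong (sym (*-identityˡ 1#))) (v-*≡ v1≡a v1≡a))))))
    where
    a≡a+a⇒a≡0 : ∀ {a} → a ≡ a ℤ.+ a → a ≡ + 0
    a≡a+a⇒a≡0 {a} eq = ≡-via (≡.sym eq) (lemma a)
      where
      lemma : ∀ a → + 0 ℤ.- a ≡ a ℤ.- (a ℤ.+ a)
      lemma = solve-∀

  1≰v1 : ¬ (+ 1 ≤v 1#)
  1≰v1 p = contradiction (v≡∧≤v⇒≤ v-1 p) λ { (ℤ.+≤+ ()) }

  v-σ^≡ : ∀ k → v (σ ^ k) ≡ [ + k ]
  v-σ^≡ zero    = v-1
  v-σ^≡ (suc k) = v-*≡ v-σ (v-σ^≡ k)

  v-inverse : ∀ {a x y} → v x ≡ [ a ] → x * y ≈ 1# → v y ≡ [ ℤ.- a ]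
  v-inverse {a} {x} {y} vx xy≈1 with v y in eq
  ... | [ b ] = ≡.cong [_] (≡.trans (lemma a b) (≡.trans (≡.cong (ℤ._+ ℤ.- a)
          ([]-injective (≡.trans (≡.sym (v-*≡ vx eq)) (≡.trans (v-cong xy≈1) v-1)))) (ℤ.+-identityˡ _)))
    where
    lemma : ∀ a b → b ≡ a ℤ.+ b ℤ.+ ℤ.- a
    lemma = solve-∀
  ... | ∞     = contradiction (trans (sym xy≈1) (trans (*-congˡ (Equivalence.to (v-∞ y) eq)) (zeroʳ x))) 1≉0

  ≤v-cancelˡ : ∀ {a b x y} → v x ≡ [ a ] → a ℤ.+ b ≤v (x * y) → b ≤v y
  ≤v-cancelˡ {a} {b} {x} {y} vx p with v y | v-* x y
  ... | [ e ] | eq = [ ≤-via ([≤]-injective (≡.subst ([ a ℤ.+ b ] ≤∞_) (≡.trans eq (≡.cong (_+∞ [ e ]) vx)) p)) (lemma a b e) ]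
    where
    lemma : ∀ a b e → e ℤ.- b ≡ (a ℤ.+ e) ℤ.- (a ℤ.+ b)
    lemma = solve-∀
  ... | ∞     | _ = _ ≤⊤⁺

  ≤v-cancelʳ : ∀ {a b x y} → v y ≡ [ a ] → b ℤ.+ a ≤v (x * y) → b ≤v x
  ≤v-cancelʳ {a} {b} {x} {y} vy p with v x | v-* x y
  ... | [ e ] | eq = [ ≤-via ([≤]-injective (≡.subst ([ b ℤ.+ a ] ≤∞_) (≡.trans eq (≡.cong ([ e ] +∞_) vy)) p)) (lemma a b e) ]
    where
    lemma : ∀ a b e → e ℤ.- b ≡ (e ℤ.+ a) ℤ.- (b ℤ.+ a)
    lemma = solve-∀
  ... | ∞     | _ = _ ≤⊤⁺

  ≤v-lower : ∀ x → ∃[ p ] ℤ.- (+ p) ≤v x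
  ≤v-lower x with v x
  ... | [ + _ ]      = 0 , [ ℤ.+≤+ ℕ.z≤n ]
  ... | [ -[1+ n ] ] = suc n , [ ℤ.≤-refl ]
  ... | ∞            = 0 , (_ ≤⊤⁺)

  𝓞-ring : Ring c ℓ
  𝓞-ring = record
    { RawRing 𝓞
    ; isRing = record
      { +-isAbelianGroup = record
        { isGroup = record
          { isMonoid = record
            { isSemigroup = record
              { isMagma = record
                { isEquivalence = record { refl = refl ; sym = sym ; trans = trans }
                ; ∙-cong = +-cong }
              ; assoc = λ x y z → +-assoc (proj₁ x) (proj₁ y) (proj₁ z) }
            ; identity = (λ x → +-identityˡ (proj₁ x)) , λ x → +-identityʳ (proj₁ x) }
          ; inverse = (λ x → -‿inverseˡ (proj₁ x)) , λ x → -‿inverseʳ (proj₁ x)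
          ; ⁻¹-cong = -‿cong }
        ; comm = λ x y → +-comm (proj₁ x) (proj₁ y) }
      ; *-cong = *-cong
      ; *-assoc = λ x y z → *-assoc (proj₁ x) (proj₁ y) (proj₁ z)
      ; *-identity = (λ x → *-identityˡ (proj₁ x)) , λ x → *-identityʳ (proj₁ x)
      ; distrib = (λ x y z → distribˡ (proj₁ x) (proj₁ y) (proj₁ z))
                , λ x y z → distribʳ (proj₁ x) (proj₁ y) (proj₁ z)
      }
    }

  module 𝓞ₘ = Matrices 𝓞
  open Matrices rawRing

  Mat : ℕ → ℕ → Set c
  Mat = Matrix rawRing

  Mat𝓞 : ℕ → ℕ → Set c
  Mat𝓞 = Matrix 𝓞

  ⟦_⟧ : ∀ {m n} → Mat𝓞 m n → Mat m n
  ⟦ B ⟧ i j = proj₁ (B i j)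

  open import Algebra.Definitions.RawMonoid (RawRing.+-rawMonoid 𝓞) using () renaming (sum to sum𝓞)

  proj₁-sum : ∀ {n} (f : Fin n → Σ Carrier _) → proj₁ (sum𝓞 f) ≡ sum (proj₁ ∘ f)
  proj₁-sum {zero}  f = ≡.refl
  proj₁-sum {suc n} f = ≡.cong (λ z → proj₁ (f zero) + z) (proj₁-sum (f ∘ suc))

  ⟦*ₘ⟧ : ∀ {m n p} (A : Mat𝓞 m n) (B : Mat𝓞 n p) → ⟦ A 𝓞ₘ.*ₘ B ⟧ ≋ ⟦ A ⟧ *ₘ ⟦ B ⟧
  ⟦*ₘ⟧ A B i j = reflexive (proj₁-sum (λ k → RawRing._*_ 𝓞 (A i k) (B k j)))

  ⟦1ₘ⟧ : ∀ {n} → ⟦ 𝓞ₘ.1ₘ {n} ⟧ ≋ 1ₘ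
  ⟦1ₘ⟧ i j with i Fin.≟ j
  ... | yes _ = refl
  ... | no  _ = refl

  ⟦σ^⟧ : ∀ k → proj₁ (σ𝓞 ^𝓞 k) ≡ σ ^ k
  ⟦σ^⟧ zero    = ≡.refl
  ⟦σ^⟧ (suc k) = ≡.cong (σ *_) (⟦σ^⟧ k)

  -- An equivalence over 𝓞 seen over 𝓛, with integrality as a separate property: the vectors on
  -- which rank is tested have entries in 𝓛, so the matrices acting on them must live there too.
  record IntegralEquivalence {m n : ℕ} (A B : Mat m n) : Set (c ⊔ ℓ) where
    open MatrixProperties ring using (Equivalent)
    field
      equivalent : Equivalent A B
    open Equivalent equivalent public
    field
      P-integral   : ∀ i j → + 0 ≤v P i j
      P⁻¹-integral : ∀ i j → + 0 ≤v P⁻¹ i j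
      Q-integral   : ∀ i j → + 0 ≤v Q i j
      Q⁻¹-integral : ∀ i j → + 0 ≤v Q⁻¹ i j

  ⇝⇒integralEquivalence : ∀ {m n} {A B : Mat𝓞 m n} → A 𝓞ₘ.⇝ B → IntegralEquivalence ⟦ A ⟧ ⟦ B ⟧
  ⇝⇒integralEquivalence {A = A} A⇝B = record
    { equivalent = record
      { P = ⟦ P ⟧ ; P⁻¹ = ⟦ P⁻¹ ⟧ ; Q = ⟦ Q ⟧ ; Q⁻¹ = ⟦ Q⁻¹ ⟧
      ; PP⁻¹ = unit P P⁻¹ PP⁻¹ ; P⁻¹P = unit P⁻¹ P P⁻¹P
      ; QQ⁻¹ = unit Q Q⁻¹ QQ⁻¹ ; Q⁻¹Q = unit Q⁻¹ Q Q⁻¹Q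
      ; PAQ = ≋-trans (*ₘ-congˡ ⟦ P ⟧ (≋-sym (⟦*ₘ⟧ A Q))) (≋-trans (≋-sym (⟦*ₘ⟧ P (A 𝓞ₘ.*ₘ Q))) PAQ)
      }
    ; P-integral   = λ i j → proj₂ (P i j)
    ; P⁻¹-integral = λ i j → proj₂ (P⁻¹ i j)
    ; Q-integral   = λ i j → proj₂ (Q i j)
    ; Q⁻¹-integral = λ i j → proj₂ (Q⁻¹ i j)
    }
    where
    open MatrixProperties ring using (≋-trans; ≋-sym; *ₘ-congˡ)
    open MatrixProperties.Equivalent (MatrixProperties.⇝⇒equivalent 𝓞-ring A⇝B)

    unit : ∀ {n} (U U′ : Mat𝓞 n n) → (U 𝓞ₘ.*ₘ U′) 𝓞ₘ.≋ 𝓞ₘ.1ₘ → ⟦ U ⟧ *ₘ ⟦ U′ ⟧ ≋ 1ₘ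
    unit U U′ UU′ = ≋-trans (≋-sym (⟦*ₘ⟧ U U′)) (≋-trans UU′ ⟦1ₘ⟧)

-- Elementary operations inside a diagonal block.

module BlockMatrices {c ℓ : Level} (R : Ring c ℓ) where

  open Ring R hiding (zero)
  open Matrices rawRing
  open MatrixProperties R
  open import Relation.Binary.Reasoning.Setoid setoid

  block : ∀ {m n} → Carrier → Mat m n → Mat (suc m) (suc n)
  block a A zero    zero    = a
  block a A zero    (suc _) = 0#
  block a A (suc _) zero    = 0#
  block a A (suc i) (suc j) = A i j

  block-cong : ∀ {m n} a {A B : Mat m n} → A ≋ B → block a A ≋ block a B
  block-cong a A≋B zero    zero    = refl
  block-cong a A≋B zero    (suc _) = refl
  block-cong a A≋B (suc _) zero    = refl
  block-cong a A≋B (suc i) (suc j) = A≋B i j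

  transpose-suc : ∀ {n} (i j k : Fin n) → transpose (suc i) (suc j) (suc k) ≡ suc (transpose i j k)
  transpose-suc i j k with does (k Fin.≟ i)
  ... | true  = ≡.refl
  ... | false with does (k Fin.≟ j)
  ...   | true  = ≡.refl
  ...   | false = ≡.refl

  addRow-block : ∀ {m n} i j c a (A : Mat m n) →
                 addRow (suc i) (suc j) c (block a A) ≋ block a (addRow i j c A)
  addRow-block i j c a A zero    zero    = refl
  addRow-block i j c a A zero    (suc l) = refl
  addRow-block i j c a A (suc k) l with k Fin.≟ i
  addRow-block i j c a A (suc k) zero    | yes ≡.refl = trans
    (reflexive (addRow-at (suc i) (suc j) c (block a A) zero)) (trans (+-identityˡ _) (zeroʳ c))
  addRow-block i j c a A (suc k) (suc l) | yes ≡.refl = reflexive (≡.trans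
    (addRow-at (suc i) (suc j) c (block a A) (suc l)) (≡.sym (addRow-at i j c A l)))
  addRow-block i j c a A (suc k) zero    | no k≢i = reflexive
    (addRow-off (suc i) (suc j) c (block a A) (k≢i ∘ Fin.suc-injective) zero)
  addRow-block i j c a A (suc k) (suc l) | no k≢i = reflexive (≡.trans
    (addRow-off (suc i) (suc j) c (block a A) (k≢i ∘ Fin.suc-injective) (suc l)) (≡.sym (addRow-off i j c A k≢i l)))

  scaleRow-block : ∀ {m n} i u a (A : Mat m n) →
                   scaleRow (suc i) u (block a A) ≋ block a (scaleRow i u A)
  scaleRow-block i u a A zero    zero    = refl
  scaleRow-block i u a A zero    (suc l) = refl
  scaleRow-block i u a A (suc k) l with k Fin.≟ i
  scaleRow-block i u a A (suc k) zero    | yes ≡.refl = trans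
    (reflexive (scaleRow-at (suc i) u (block a A) zero)) (zeroʳ u)
  scaleRow-block i u a A (suc k) (suc l) | yes ≡.refl = reflexive (≡.trans
    (scaleRow-at (suc i) u (block a A) (suc l)) (≡.sym (scaleRow-at i u A l)))
  scaleRow-block i u a A (suc k) zero    | no k≢i = reflexive
    (scaleRow-off (suc i) u (block a A) (k≢i ∘ Fin.suc-injective) zero)
  scaleRow-block i u a A (suc k) (suc l) | no k≢i = reflexive (≡.trans
    (scaleRow-off (suc i) u (block a A) (k≢i ∘ Fin.suc-injective) (suc l)) (≡.sym (scaleRow-off i u A k≢i l)))

  addColumn-block : ∀ {m n} i j c a (A : Mat m n) →
                    addColumn (suc i) (suc j) c (block a A) ≋ block a (addColumn i j c A)
  addColumn-block i j c a A zero    zero    = refl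
  addColumn-block i j c a A (suc k) zero    = refl
  addColumn-block i j c a A k (suc l) with l Fin.≟ i
  addColumn-block i j c a A zero    (suc l) | yes ≡.refl = trans
    (reflexive (addColumn-at (suc i) (suc j) c (block a A) zero)) (trans (+-identityˡ _) (zeroˡ c))
  addColumn-block i j c a A (suc k) (suc l) | yes ≡.refl = reflexive (≡.trans
    (addColumn-at (suc i) (suc j) c (block a A) (suc k)) (≡.sym (addColumn-at i j c A k)))
  addColumn-block i j c a A zero    (suc l) | no l≢i = reflexive
    (addColumn-off (suc i) (suc j) c (block a A) zero (l≢i ∘ Fin.suc-injective))
  addColumn-block i j c a A (suc k) (suc l) | no l≢i = reflexive (≡.trans
    (addColumn-off (suc i) (suc j) c (block a A) (suc k) (l≢i ∘ Fin.suc-injective)) (≡.sym (addColumn-off i j c A k l≢i)))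

  scaleColumn-block : ∀ {m n} i u a (A : Mat m n) →
                      scaleColumn (suc i) u (block a A) ≋ block a (scaleColumn i u A)
  scaleColumn-block i u a A zero    zero    = refl
  scaleColumn-block i u a A (suc k) zero    = refl
  scaleColumn-block i u a A k (suc l) with l Fin.≟ i
  scaleColumn-block i u a A zero    (suc l) | yes ≡.refl = trans
    (reflexive (scaleColumn-at (suc i) u (block a A) zero)) (zeroˡ u)
  scaleColumn-block i u a A (suc k) (suc l) | yes ≡.refl = reflexive (≡.trans
    (scaleColumn-at (suc i) u (block a A) (suc k)) (≡.sym (scaleColumn-at i u A k)))
  scaleColumn-block i u a A zero    (suc l) | no l≢i = reflexive
    (scaleColumn-off (suc i) u (block a A) zero (l≢i ∘ Fin.suc-injective))
  scaleColumn-block i u a A (suc k) (suc l) | no l≢i = reflexive (≡.trans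
    (scaleColumn-off (suc i) u (block a A) (suc k) (l≢i ∘ Fin.suc-injective)) (≡.sym (scaleColumn-off i u A k l≢i)))

  swapRows-block : ∀ {m n} i j a (A : Mat m n) →
                   swapRows (suc i) (suc j) (block a A) ≋ block a (swapRows i j A)
  swapRows-block i j a A zero    zero    = refl
  swapRows-block i j a A zero    (suc _) = refl
  swapRows-block i j a A (suc k) zero    rewrite transpose-suc i j k = refl
  swapRows-block i j a A (suc k) (suc l) rewrite transpose-suc i j k = refl

  swapColumns-block : ∀ {m n} i j a (A : Mat m n) →
                      swapColumns (suc i) (suc j) (block a A) ≋ block a (swapColumns i j A)
  swapColumns-block i j a A zero    zero    = refl
  swapColumns-block i j a A (suc _) zero    = refl
  swapColumns-block i j a A zero    (suc l) rewrite transpose-suc i j l = refl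
  swapColumns-block i j a A (suc k) (suc l) rewrite transpose-suc i j l = refl

  -- Operations on later rows and columns combine only zeros in the first column and the first row,
  -- so the border survives. This carries a reduction of the remaining block over to the whole
  -- matrix.
  block-⇝ : ∀ {m n} a {A B : Mat m n} → A ⇝ B → block a A ⇝ block a B
  block-⇝ a (done A≋B)                = done (block-cong a A≋B)
  block-⇝ a (row+ c i≢j r)            = row+ c (i≢j ∘ Fin.suc-injective) (⇝-resp (addRow-block _ _ c a _) (block-⇝ a r))
  block-⇝ a (column+ c i≢j r)         = column+ c (i≢j ∘ Fin.suc-injective) (⇝-resp (addColumn-block _ _ c a _) (block-⇝ a r))
  block-⇝ a (row* {i} inv r)          = row* {i = suc i} inv (⇝-resp (scaleRow-block i _ a _) (block-⇝ a r))
  block-⇝ a (column* {i} inv r)       = column* {i = suc i} inv (⇝-resp (scaleColumn-block i _ a _) (block-⇝ a r))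
  block-⇝ a (row↔ i j r)              = row↔ (suc i) (suc j) (⇝-resp (swapRows-block i j a _) (block-⇝ a r))
  block-⇝ a (column↔ i j r)           = column↔ (suc i) (suc j) (⇝-resp (swapColumns-block i j a _) (block-⇝ a r))

≤∞-refl : ∀ {x} → x ≤∞ x
≤∞-refl {[ _ ]} = [ ℤ.≤-refl ]
≤∞-refl {∞}     = ∞ ≤⊤⁺

argmin : ∀ {n} (f : Fin (suc n) → ℤ∞) → ∃[ i ] ∀ j → f i ≤∞ f j
argmin {zero}  f = zero , λ { zero → ≤∞-refl }
argmin {suc n} f with argmin (f ∘ suc)
... | i , fi≤ with ≤⁺-total ℤ.≤-total (f zero) (f (suc i))
...   | inj₁ f0≤fi = zero , λ { zero → ≤∞-refl ; (suc j) → ≤⁺-trans ℤ.≤-trans f0≤fi (fi≤ j) }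
...   | inj₂ fi≤f0 = suc i , λ { zero → fi≤f0 ; (suc j) → fi≤ j }

-- Smith normal form over the valuation ring.

module SmithForm {c ℓ : Level} (𝓛 : CompleteDiscretelyValuedSkewField c ℓ) where

  open CompleteDiscretelyValuedSkewField 𝓛 hiding (zero)
  open Valuation 𝓛 using (≤∞-trans; 𝓞; σ𝓞)
  open Exponentiation (RawRing.rawSemiring 𝓞) using () renaming (_^_ to _^𝓞_)
  open ValuationProperties 𝓛
  open Matrices 𝓞
  open MatrixProperties 𝓞-ring using (⇝-trans; addRow-at; addRow-off; addColumn-at; addColumn-off)
  open BlockMatrices 𝓞-ring
  open RingProperties ring using (-‿distribˡ-*; -‿distribʳ-*)
  open import Relation.Binary.Reasoning.Setoid setoid

  -- The bound makes every entry divisible by the pivot inside 𝓞 from either side. Elimination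
  -- preserves it, so the remaining block keeps valuations of at least `e`, and this is what orders
  -- the divisors.
  record Pivot {m n : ℕ} (e : ℕ) (B : Mat𝓞 (suc m) (suc n)) : Set ℓ where
    field
      pivot  : ⟦ B ⟧ zero zero ≈ σ ^ e
      bounds : ∀ i j → + e ≤v ⟦ B ⟧ i j

  module _ (e : ℕ) where

    σ^e-inverse : Invertible _≈_ 1# _*_ (σ ^ e)
    σ^e-inverse = inverse (σ ^ e) (v≡⇒≉0 (v-σ^≡ e))

    τ : Carrier
    τ = proj₁ σ^e-inverse

    v-τ : v τ ≡ [ ℤ.- (+ e) ]
    v-τ = v-inverse (v-σ^≡ e) (proj₂ (proj₂ σ^e-inverse))

    -- Row operations multiply on the left, so clearing an entry `y` below the pivot takes the
    -- multiplier `- (y * τ)`; column operations multiply on the right and take `- (τ * y)`.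
    rightQuotient : ∀ {y} → + e ≤v y → + 0 ≤v - (y * τ)
    rightQuotient e≤y = ≤v-neg (≤v-≡ (ℤ.+-inverseʳ (+ e)) (≤v-* e≤y (≡⇒≤v v-τ)))

    leftQuotient : ∀ {y} → + e ≤v y → + 0 ≤v - (τ * y)
    leftQuotient e≤y = ≤v-neg (≤v-≡ (ℤ.+-inverseˡ (+ e)) (≤v-* (≡⇒≤v v-τ) e≤y))

    -- The list holds the rows still to be cleared; a row outside it is already done. Only multiples
    -- of the pivot row are added, and that row itself never changes, so one pass suffices.
    clearColumn : ∀ {m n} (xs : List (Fin m)) (B : Mat𝓞 (suc m) (suc n)) → Pivot e B →
                  (∀ i → i ∈ xs ⊎ ⟦ B ⟧ (suc i) zero ≈ 0#) →
                  ∃[ C ] (B ⇝ C × Pivot e C × (∀ i → ⟦ C ⟧ (suc i) zero ≈ 0#))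
    clearColumn [] B piv cleared = B , done (λ _ _ → refl) , piv , λ i → zero-entry (cleared i)
      where
      zero-entry : ∀ {i} → i ∈ [] ⊎ ⟦ B ⟧ (suc i) zero ≈ 0# → ⟦ B ⟧ (suc i) zero ≈ 0#
      zero-entry (inj₂ eq) = eq
    clearColumn {m} {n} (x ∷ xs) B piv cleared
      with clearColumn xs B′ piv′ cleared′
      where
      open Pivot piv

      q : Carrier
      q = - (⟦ B ⟧ (suc x) zero * τ)

      q𝓞 : RawRing.Carrier 𝓞
      q𝓞 = q , rightQuotient (bounds (suc x) zero)

      B′ : Mat𝓞 (suc m) (suc n)
      B′ = addRow (suc x) zero q𝓞 B

      bounds′ : ∀ i j → + e ≤v ⟦ B′ ⟧ i j
      bounds′ i j with i Fin.≟ suc x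
      ... | yes ≡.refl rewrite addRow-at (suc x) zero q𝓞 B j =
        ≤v-+ (bounds (suc x) j) (≤v-≡ (ℤ.+-identityˡ (+ e)) (≤v-* (proj₂ q𝓞) (bounds zero j)))
      ... | no i≢ rewrite addRow-off (suc x) zero q𝓞 B i≢ j = bounds i j

      piv′ : Pivot e B′
      piv′ = record { pivot = pivot ; bounds = bounds′ }

      cleared′ : ∀ i → i ∈ xs ⊎ ⟦ B′ ⟧ (suc i) zero ≈ 0#
      cleared′ i with i Fin.≟ x
      ... | yes ≡.refl = inj₂ (begin
        ⟦ B′ ⟧ (suc x) zero                        ≡⟨ ≡.cong proj₁ (addRow-at (suc x) zero q𝓞 B zero) ⟩
        y + - (y * τ) * ⟦ B ⟧ zero zero            ≈⟨ +-congˡ (sym (-‿distribˡ-* (y * τ) _)) ⟩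
        y + - (y * τ * ⟦ B ⟧ zero zero)            ≈⟨ +-congˡ (-‿cong (*-congˡ pivot)) ⟩
        y + - (y * τ * σ ^ e)                      ≈⟨ +-congˡ (-‿cong (trans (*-assoc y τ _) (*-congˡ (proj₁ (proj₂ σ^e-inverse))))) ⟩
        y + - (y * 1#)                             ≈⟨ +-congˡ (-‿cong (*-identityʳ y)) ⟩
        y + - y                                    ≈⟨ -‿inverseʳ y ⟩
        0#                                         ∎)
        where
        y : Carrier
        y = ⟦ B ⟧ (suc x) zero
      ... | no i≢x with cleared i
      ...   | inj₁ (here i≡x)   = contradiction i≡x i≢x
      ...   | inj₁ (there i∈xs) = inj₁ i∈xs
      ...   | inj₂ Bi≈0         = inj₂ (trans
        (reflexive (≡.cong proj₁ (addRow-off (suc x) zero q𝓞 B (i≢x ∘ Fin.suc-injective) zero))) Bi≈0)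
    ... | C , B′⇝C , rest = C , row+ {i = suc x} {j = zero} _ (λ ()) B′⇝C , rest

    -- Adding multiples of the first column to later columns leaves the first column as it is, so
    -- the zeros already produced there are handed on unchanged.
    clearRow : ∀ {m n} (xs : List (Fin n)) (B : Mat𝓞 (suc m) (suc n)) → Pivot e B →
               (∀ i → ⟦ B ⟧ (suc i) zero ≈ 0#) →
               (∀ i → i ∈ xs ⊎ ⟦ B ⟧ zero (suc i) ≈ 0#) →
               ∃[ C ] (B ⇝ C × Pivot e C × (∀ i → ⟦ C ⟧ (suc i) zero ≈ 0#) × (∀ i → ⟦ C ⟧ zero (suc i) ≈ 0#))
    clearRow [] B piv column cleared = B , done (λ _ _ → refl) , piv , column , λ i → zero-entry (cleared i)
      where
      zero-entry : ∀ {i} → i ∈ [] ⊎ ⟦ B ⟧ zero (suc i) ≈ 0# → ⟦ B ⟧ zero (suc i) ≈ 0#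
      zero-entry (inj₂ eq) = eq
    clearRow {m} {n} (x ∷ xs) B piv column cleared
      with clearRow xs B′ piv′ column cleared′
      where
      open Pivot piv

      q𝓞 : RawRing.Carrier 𝓞
      q𝓞 = - (τ * ⟦ B ⟧ zero (suc x)) , leftQuotient (bounds zero (suc x))

      B′ : Mat𝓞 (suc m) (suc n)
      B′ = addColumn (suc x) zero q𝓞 B

      bounds′ : ∀ i j → + e ≤v ⟦ B′ ⟧ i j
      bounds′ i j with j Fin.≟ suc x
      ... | yes ≡.refl rewrite addColumn-at (suc x) zero q𝓞 B i =
        ≤v-+ (bounds i (suc x)) (≤v-≡ (ℤ.+-identityʳ (+ e)) (≤v-* (bounds i zero) (proj₂ q𝓞)))
      ... | no j≢ rewrite addColumn-off (suc x) zero q𝓞 B i j≢ = bounds i j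

      piv′ : Pivot e B′
      piv′ = record { pivot = pivot ; bounds = bounds′ }

      cleared′ : ∀ i → i ∈ xs ⊎ ⟦ B′ ⟧ zero (suc i) ≈ 0#
      cleared′ i with i Fin.≟ x
      ... | yes ≡.refl = inj₂ (begin
        ⟦ B′ ⟧ zero (suc x)                        ≡⟨ ≡.cong proj₁ (addColumn-at (suc x) zero q𝓞 B zero) ⟩
        y + ⟦ B ⟧ zero zero * - (τ * y)            ≈⟨ +-congˡ (sym (-‿distribʳ-* _ (τ * y))) ⟩
        y + - (⟦ B ⟧ zero zero * (τ * y))          ≈⟨ +-congˡ (-‿cong (*-congʳ pivot)) ⟩
        y + - (σ ^ e * (τ * y))                    ≈⟨ +-congˡ (-‿cong (trans (sym (*-assoc _ τ y)) (*-congʳ (proj₂ (proj₂ σ^e-inverse))))) ⟩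
        y + - (1# * y)                             ≈⟨ +-congˡ (-‿cong (*-identityˡ y)) ⟩
        y + - y                                    ≈⟨ -‿inverseʳ y ⟩
        0#                                         ∎)
        where
        y : Carrier
        y = ⟦ B ⟧ zero (suc x)
      ... | no i≢x with cleared i
      ...   | inj₁ (here i≡x)   = contradiction i≡x i≢x
      ...   | inj₁ (there i∈xs) = inj₁ i∈xs
      ...   | inj₂ Bi≈0         = inj₂ (trans
        (reflexive (≡.cong proj₁ (addColumn-off (suc x) zero q𝓞 B zero (i≢x ∘ Fin.suc-injective)))) Bi≈0)
    ... | C , B′⇝C , rest = C , column+ {i = suc x} {j = zero} _ (λ ()) B′⇝C , rest

    split : ∀ {m n} (B : Mat𝓞 (suc m) (suc n)) → Pivot e B →
            ∃[ C ] (B ⇝ block (σ𝓞 ^𝓞 e) C × (∀ i j → + e ≤v ⟦ C ⟧ i j))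
    split {m} {n} B piv
      with clearColumn (allFin m) B piv (λ i → inj₁ (∈-allFin i))
    ... | B₁ , B⇝B₁ , piv₁ , column₁
      with clearRow (allFin n) B₁ piv₁ column₁ (λ i → inj₁ (∈-allFin i))
    ... | B₂ , B₁⇝B₂ , piv₂ , column₂ , row₂ =
      (λ i j → B₂ (suc i) (suc j)) , ⇝-trans B⇝B₁ (⇝-trans B₁⇝B₂ (done blocks)) , λ i j → Pivot.bounds piv₂ (suc i) (suc j)
      where
      blocks : B₂ ≋ block (σ𝓞 ^𝓞 e) (λ i j → B₂ (suc i) (suc j))
      blocks zero    zero    = trans (Pivot.pivot piv₂) (reflexive (≡.sym (⟦σ^⟧ e)))
      blocks zero    (suc j) = row₂ j
      blocks (suc i) zero    = column₂ i
      blocks (suc i) (suc j) = refl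

    normalizePivot : ∀ {m n} (B : Mat𝓞 (suc m) (suc n)) → v (⟦ B ⟧ zero zero) ≡ [ + e ] →
                     (∀ i j → + e ≤v ⟦ B ⟧ i j) → ∃[ C ] (B ⇝ C × Pivot e C)
    normalizePivot {m} {n} B vx≡e bounds = scaleRow zero u𝓞 B ,
      row* {i = zero} {u = u𝓞} (u⁻¹𝓞 , u⁻¹u , uu⁻¹) (done (λ _ _ → refl)) ,
      record { pivot = trans (*-assoc _ y x) (trans (*-congˡ yx≈1) (*-identityʳ _)) ; bounds = bounds′ }
      where
      x y : Carrier
      x = ⟦ B ⟧ zero zero
      y = proj₁ (inverse x (v≡⇒≉0 vx≡e))

      yx≈1 : y * x ≈ 1#
      yx≈1 = proj₁ (proj₂ (inverse x (v≡⇒≉0 vx≡e)))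

      xy≈1 : x * y ≈ 1#
      xy≈1 = proj₂ (proj₂ (inverse x (v≡⇒≉0 vx≡e)))

      u𝓞 u⁻¹𝓞 : RawRing.Carrier 𝓞
      -- `σ ^ e` and `y` have opposite valuations, so this is a unit of 𝓞, and left multiplication
      -- by it turns `x` into `σ ^ e`.
      u𝓞   = σ ^ e * y , ≡⇒≤v (≡.trans (v-*≡ (v-σ^≡ e) (v-inverse vx≡e xy≈1)) (≡.cong [_] (ℤ.+-inverseʳ (+ e))))
      u⁻¹𝓞 = x * τ , ≡⇒≤v (≡.trans (v-*≡ vx≡e v-τ) (≡.cong [_] (ℤ.+-inverseʳ (+ e))))

      cancel : ∀ {a b a′ b′} → b * b′ ≈ 1# → a * a′ ≈ 1# → (a * b) * (b′ * a′) ≈ 1#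
      cancel {a} {b} {a′} {b′} bb′ aa′ = begin
        a * b * (b′ * a′)    ≈⟨ *-assoc a b _ ⟩
        a * (b * (b′ * a′))  ≈⟨ *-congˡ (*-assoc b b′ a′) ⟨
        a * (b * b′ * a′)    ≈⟨ *-congˡ (trans (*-congʳ bb′) (*-identityˡ a′)) ⟩
        a * a′               ≈⟨ aa′ ⟩
        1#                   ∎

      u⁻¹u : (x * τ) * (σ ^ e * y) ≈ 1#
      u⁻¹u = cancel (proj₁ (proj₂ σ^e-inverse)) xy≈1

      uu⁻¹ : (σ ^ e * y) * (x * τ) ≈ 1#
      uu⁻¹ = cancel yx≈1 (proj₂ (proj₂ σ^e-inverse))

      bounds′ : ∀ i j → + e ≤v ⟦ scaleRow zero u𝓞 B ⟧ i j
      bounds′ zero    j = ≤v-≡ (ℤ.+-identityˡ (+ e)) (≤v-* (proj₂ u𝓞) (bounds zero j))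
      bounds′ (suc i) j = bounds (suc i) j

  minimalEntry : ∀ {m n} (B : Mat𝓞 (suc m) (suc n)) →
                 (∀ i j → ⟦ B ⟧ i j ≈ 0#) ⊎
                 ∃[ i ] ∃[ j ] ∃[ e ] (v (⟦ B ⟧ i j) ≡ [ + e ] × ∀ k l → + e ≤v ⟦ B ⟧ k l)
  minimalEntry B = minimal (v (⟦ B ⟧ i₀ j₀)) ≡.refl
    where
    j : ∀ i → _
    j i = argmin (λ j → v (⟦ B ⟧ i j))

    i₀ = proj₁ (argmin (λ i → v (⟦ B ⟧ i (proj₁ (j i)))))
    j₀ = proj₁ (j i₀)

    ≤B : ∀ k l → v (⟦ B ⟧ i₀ j₀) ≤∞ v (⟦ B ⟧ k l)
    ≤B k l = ≤∞-trans (proj₂ (argmin (λ i → v (⟦ B ⟧ i (proj₁ (j i))))) k) (proj₂ (j k) l)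

    ∞-≤ : ∀ {x y} → x ≡ ∞ → x ≤∞ y → y ≡ ∞
    ∞-≤ ≡.refl (_ ≤⊤⁺) = ≡.refl

    minimal : ∀ x → v (⟦ B ⟧ i₀ j₀) ≡ x →
              (∀ i j → ⟦ B ⟧ i j ≈ 0#) ⊎
              ∃[ i ] ∃[ j ] ∃[ e ] (v (⟦ B ⟧ i j) ≡ [ + e ] × ∀ k l → + e ≤v ⟦ B ⟧ k l)
    minimal ∞            eq = inj₁ λ k l → Equivalence.to (v-∞ _) (∞-≤ eq (≤B k l))
    minimal [ + e ]      eq = inj₂ (i₀ , j₀ , e , eq , λ k l → ≡.subst (_≤∞ v (⟦ B ⟧ k l)) eq (≤B k l))
    minimal [ -[1+ e ] ] eq = contradiction (v≡∧≤v⇒≤ eq (proj₂ (B i₀ j₀))) λ ()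

  diagonal-[] : ∀ {m n} (i : Fin m) (j : Fin n) → ⟦ diagonal {m} {n} [] ⟧ i j ≈ 0#
  diagonal-[] i j with toℕ i ℕ.≡ᵇ toℕ j
  ... | true  = refl
  ... | false = refl

  block-diagonal : ∀ {m n} x xs → block x (diagonal {m} {n} xs) ≋ diagonal (x ∷ xs)
  block-diagonal x xs zero    zero    = refl
  block-diagonal x xs zero    (suc _) = refl
  block-diagonal x xs (suc _) zero    = refl
  block-diagonal x xs (suc i) (suc j) = refl

  -- The lower bound `k` is the exponent of the previous pivot; carrying it along yields the
  -- sortedness of the exponents. Each round moves an entry of least valuation to the corner, splits
  -- it off and recurses on the rest.
  smithForm : ∀ {m n} k (B : Mat𝓞 m n) → (∀ i j → + k ≤v ⟦ B ⟧ i j) →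
              ∃[ ν ] (length ν ℕ.≤ m × length ν ℕ.≤ n × Linked ℕ._≤_ (k ∷ ν) ×
                      B ⇝ diagonal (List.map (σ𝓞 ^𝓞_) ν))
  smithForm {zero}          k B bounds = [] , z≤n , z≤n , [-] , done (λ ())
  smithForm {suc m} {zero}  k B bounds = [] , z≤n , z≤n , [-] , done (λ _ ())
  smithForm {suc m} {suc n} k B bounds with minimalEntry B
  ... | inj₁ B≈0 = [] , z≤n , z≤n , [-] , done (λ i j → trans (B≈0 i j) (sym (diagonal-[] i j)))
  ... | inj₂ (i , j , e , vB≡e , e≤B)
    with normalizePivot e (swapRows zero i (swapColumns zero j B)) vB≡e (λ _ _ → e≤B _ _)
  ... | B₁ , B⇝B₁ , piv with split e B₁ piv
  ... | C , B₁⇝C , e≤C with smithForm e C e≤C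
  ... | ν , ν≤m , ν≤n , sorted , C⇝ν =
    e ∷ ν , s≤s ν≤m , s≤s ν≤n , ℤ.drop‿+≤+ (v≡∧≤v⇒≤ vB≡e (bounds i j)) ∷ sorted ,
    column↔ zero j (row↔ zero i (⇝-trans B⇝B₁ (⇝-trans B₁⇝C
      (⇝-trans (block-⇝ (σ𝓞 ^𝓞 e) C⇝ν) (done (block-diagonal (σ𝓞 ^𝓞 e) (List.map (σ𝓞 ^𝓞_) ν)))))))

module _ {c ℓ : Level} (R : RawRing c ℓ) where

  open Matrices R using (diagonal)

  diagonal-at : ∀ {m n} xs {i : Fin m} {j : Fin n} → toℕ i ≡ toℕ j → diagonal xs i j ≡ nth R xs (toℕ i)
  diagonal-at xs {i} {j} i≡j with toℕ i ℕ.≡ᵇ toℕ j in eq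
  ... | true  = ≡.refl
  ... | false with () ← ≡.subst Bool.T eq (ℕ.≡⇒≡ᵇ (toℕ i) (toℕ j) i≡j)

  diagonal-off : ∀ {m n} xs {i : Fin m} {j : Fin n} → toℕ i ≢ toℕ j → diagonal xs i j ≡ RawRing.0# R
  diagonal-off xs {i} {j} i≢j with toℕ i ℕ.≡ᵇ toℕ j in eq
  ... | true  = contradiction (ℕ.≡ᵇ⇒≡ (toℕ i) (toℕ j) (≡.subst Bool.T (≡.sym eq) _)) i≢j
  ... | false = ≡.refl

-- Rank modulo a power of the uniformizer as a condition on vectors.

module Rank {c ℓ : Level} (𝓛 : CompleteDiscretelyValuedSkewField c ℓ) where

  open CompleteDiscretelyValuedSkewField 𝓛 hiding (zero)
  open Valuation 𝓛 using (𝓞; σ𝓞; HasRank; BoundedBelow; scale)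
  open Exponentiation (RawRing.rawSemiring 𝓞) using () renaming (_^_ to _^𝓞_)
  open ValuationProperties 𝓛
  open SmithForm 𝓛 using (smithForm)
  open Matrices rawRing
  open MatrixProperties ring using (sum-single; ≋-sym; ≋-trans; *ₘ-congˡ; *ₘ-congʳ; *ₘ-assoc; *ₘ-cancel; *ₘ-cancelʳ; 1ₘ-diagonal; *ₘ-identityˡ; *ₘ-identityʳ)
  open SumProperties semiring using (sum-cong-≋; *-distribˡ-sum; *-distribʳ-sum)
  open import Relation.Binary.Reasoning.Setoid setoid

  infix 4 _≤ₘ_

  _≤ₘ_ : ∀ {m n} → ℤ → Mat m n → Set
  a ≤ₘ A = ∀ i j → a ≤v A i j

  ≤ₘ-cong : ∀ {a m n} {A B : Mat m n} → A ≋ B → a ≤ₘ A → a ≤ₘ B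
  ≤ₘ-cong A≋B a≤A i j = ≤v-cong (A≋B i j) (a≤A i j)

  ≤ₘ-* : ∀ {a b m n p} {A : Mat m n} {B : Mat n p} → a ≤ₘ A → b ≤ₘ B → a ℤ.+ b ≤ₘ A *ₘ B
  ≤ₘ-* a≤A b≤B i j = ≤v-sum (λ k → ≤v-* (a≤A i k) (b≤B k j))

  integral-*ₘ : ∀ {b m n p} {A : Mat m n} {B : Mat n p} → + 0 ≤ₘ A → b ≤ₘ B → b ≤ₘ A *ₘ B
  integral-*ₘ {b} {A = A} {B} 0≤A b≤B i j = ≤v-≡ (ℤ.+-identityˡ b) (≤ₘ-* {A = A} {B} 0≤A b≤B i j)

  *ₘ-integral : ∀ {a m n p} {A : Mat m n} {B : Mat n p} → a ≤ₘ A → + 0 ≤ₘ B → a ≤ₘ A *ₘ B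
  *ₘ-integral {a} {A = A} {B} a≤A 0≤B i j = ≤v-≡ (ℤ.+-identityʳ a) (≤ₘ-* {A = A} {B} a≤A 0≤B i j)

  integralEquivalence-sym : ∀ {m n} {A B : Mat m n} → IntegralEquivalence A B → IntegralEquivalence B A
  integralEquivalence-sym {A = A} {B} A~B = record
    { equivalent = record
      { P = P⁻¹ ; P⁻¹ = P ; Q = Q⁻¹ ; Q⁻¹ = Q ; PP⁻¹ = P⁻¹P ; P⁻¹P = PP⁻¹ ; QQ⁻¹ = Q⁻¹Q ; Q⁻¹Q = QQ⁻¹
      ; PAQ = ≋-trans (*ₘ-congˡ P⁻¹ (≋-sym PA)) (*ₘ-cancel P⁻¹ P P⁻¹P A) }
    ; P-integral = P⁻¹-integral ; P⁻¹-integral = P-integral ; Q-integral = Q⁻¹-integral ; Q⁻¹-integral = Q-integral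
    }
    where open IntegralEquivalence A~B

  -- Column vectors that B maps into σ^{a+s} 𝓞 lie in σ^{a+1} 𝓞: over L this says that
  -- all elementary divisors σ^ν of B, one for each column, have ν < s.
  ColumnRegular : ∀ {m n} → ℤ → Mat m n → Set c
  ColumnRegular {m} {n} s B = ∀ a (X : Mat n 1) → a ℤ.+ s ≤ₘ B *ₘ X → a ℤ.+ + 1 ≤ₘ X

  RowRegular : ∀ {m n} → ℤ → Mat m n → Set c
  RowRegular {m} {n} s B = ∀ a (Y : Mat 1 m) → a ℤ.+ s ≤ₘ Y *ₘ B → a ℤ.+ + 1 ≤ₘ Y

  -- `A (Q X) = P⁻¹ (B X)`, and integral matrices preserve lower bounds, so the test of `B` on `X`
  -- becomes the test of `A` on `Q X`.
  columnRegular-transfer : ∀ {s m n} {A B : Mat m n} → IntegralEquivalence A B → ColumnRegular s A → ColumnRegular s B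
  columnRegular-transfer {A = A} {B} A~B reg a X BX = ≤ₘ-cong (*ₘ-cancel Q⁻¹ Q Q⁻¹Q X)
    (integral-*ₘ {A = Q⁻¹} {Q *ₘ X} Q⁻¹-integral (reg a (Q *ₘ X) (≤ₘ-cong AQX (integral-*ₘ {A = P⁻¹} {B *ₘ X} P⁻¹-integral BX))))
    where
    open IntegralEquivalence A~B
    AQX : P⁻¹ *ₘ (B *ₘ X) ≋ A *ₘ (Q *ₘ X)
    AQX = ≋-trans (≋-sym (*ₘ-assoc P⁻¹ B X)) (≋-trans (*ₘ-congʳ X (≋-sym AQ)) (*ₘ-assoc A Q X))

  rowRegular-transfer : ∀ {s m n} {A B : Mat m n} → IntegralEquivalence A B → RowRegular s A → RowRegular s B
  rowRegular-transfer {A = A} {B} A~B reg a Y YB = ≤ₘ-cong (*ₘ-cancelʳ P P⁻¹ PP⁻¹ Y)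
    (*ₘ-integral {A = Y *ₘ P} {P⁻¹} (reg a (Y *ₘ P) (≤ₘ-cong YPA (*ₘ-integral {A = Y *ₘ B} {Q⁻¹} YB Q⁻¹-integral))) P⁻¹-integral)
    where
    open IntegralEquivalence A~B
    YPA : (Y *ₘ B) *ₘ Q⁻¹ ≋ (Y *ₘ P) *ₘ A
    YPA = ≋-trans (*ₘ-assoc Y B Q⁻¹) (≋-trans (*ₘ-congˡ Y (≋-sym PA)) (≋-sym (*ₘ-assoc Y P A)))

  divisor : List ℕ → ℕ → Carrier
  divisor ν k = proj₁ (nth 𝓞 (List.map (σ𝓞 ^𝓞_) ν) k)

  Δ : ∀ {m n} → List ℕ → Mat m n
  Δ ν = ⟦ 𝓞ₘ.diagonal (List.map (σ𝓞 ^𝓞_) ν) ⟧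

  Δ-at : ∀ {m n} ν {i : Fin m} {j : Fin n} → toℕ i ≡ toℕ j → Δ ν i j ≡ divisor ν (toℕ i)
  Δ-at ν i≡j = ≡.cong proj₁ (diagonal-at 𝓞 (List.map (σ𝓞 ^𝓞_) ν) i≡j)

  Δ-off : ∀ {m n} ν {i : Fin m} {j : Fin n} → toℕ i ≢ toℕ j → Δ ν i j ≡ 0#
  Δ-off ν i≢j = ≡.cong proj₁ (diagonal-off 𝓞 (List.map (σ𝓞 ^𝓞_) ν) i≢j)

  Δ-*ₘ : ∀ {m n p} ν (X : Mat n p) {i : Fin m} {k : Fin n} → toℕ i ≡ toℕ k → ∀ j →
         (Δ ν *ₘ X) i j ≈ divisor ν (toℕ k) * X k j
  Δ-*ₘ ν X {i} {k} i≡k j = begin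
    sum (λ l → Δ ν i l * X l j)   ≈⟨ sum-single k (λ l l≢k → trans (*-congʳ (reflexive (Δ-off ν (λ i≡l → l≢k (Fin.toℕ-injective (≡.trans (≡.sym i≡l) i≡k)))))) (zeroˡ _)) ⟩
    Δ ν i k * X k j               ≡⟨ ≡.cong (_* X k j) (≡.trans (Δ-at ν i≡k) (≡.cong (divisor ν) i≡k)) ⟩
    divisor ν (toℕ k) * X k j     ∎

  *ₘ-Δ : ∀ {m n p} ν (Y : Mat p m) {k : Fin m} {j : Fin n} → toℕ k ≡ toℕ j → ∀ i →
         (Y *ₘ Δ ν) i j ≈ Y i k * divisor ν (toℕ k)
  *ₘ-Δ ν Y {k} {j} k≡j i = begin
    sum (λ l → Y i l * Δ ν l j)   ≈⟨ sum-single k (λ l l≢k → trans (*-congˡ (reflexive (Δ-off ν (λ l≡j → l≢k (Fin.toℕ-injective (≡.trans l≡j (≡.sym k≡j))))))) (zeroʳ _)) ⟩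
    Y i k * Δ ν k j               ≡⟨ ≡.cong (Y i k *_) (Δ-at ν k≡j) ⟩
    Y i k * divisor ν (toℕ k)     ∎

  module _ {s : ℕ} where

    -- A counting argument: the filtered list is never longer than `ν`, and strictly shorter as soon
    -- as one exponent fails.
    fullRank : ∀ {r} ν → length ν ℕ.≤ r → length (filter (ℕ._<? s) ν) ≡ r → length ν ≡ r × All (ℕ._< s) ν
    fullRank {r} ν ν≤r count = ℕ.≤-antisym ν≤r r≤ν , all-small
      where
      r≤ν : r ℕ.≤ length ν
      r≤ν = ≡.subst (ℕ._≤ length ν) count (length-filter (ℕ._<? s) ν)

      all-small : All (ℕ._< s) ν
      all-small with All.all? (ℕ._<? s) ν
      ... | yes all  = all
      ... | no  ¬all = contradiction
        (≡.subst (ℕ._< length ν) count (filter-notAll (ℕ._<? s) ν (¬All⇒Any¬ (ℕ._<? s) ν ¬all)))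
        (ℕ.≤⇒≯ ν≤r)

    small-divisor : ∀ ν → All (ℕ._< s) ν → ∀ k → k ℕ.< length ν → ∃[ e ] (v (divisor ν k) ≡ [ + e ] × e ℕ.< s)
    small-divisor (e ∷ ν) (e<s ∷ small) zero    _         = e , ≡.trans (≡.cong v (⟦σ^⟧ e)) (v-σ^≡ e) , e<s
    small-divisor (e ∷ ν) (e<s ∷ small) (suc k) (s≤s k<ν) = small-divisor ν small k k<ν

    -- Past the end of the list a divisor reads as zero, of valuation ∞, which the hypothesis
    -- excludes at indices below `r`. It therefore controls the length of `ν` as well as the
    -- exponents.
    fullRank⇐ : ∀ r ν → length ν ℕ.≤ r → (∀ k → k ℕ.< r → ¬ (+ s ≤v divisor ν k)) →
                length (filter (ℕ._<? s) ν) ≡ r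
    fullRank⇐ r ν ν≤r small = ≡.trans (≡.cong length (filter-all (ℕ._<? s) (all-small ν λ k k<ν → small k (ℕ.<-≤-trans k<ν ν≤r)))) ν≡r
      where
      all-small : ∀ ν → (∀ k → k ℕ.< length ν → ¬ (+ s ≤v divisor ν k)) → All (ℕ._< s) ν
      all-small []      _     = []
      all-small (e ∷ ν) small =
        ℕ.≰⇒> (λ s≤e → small 0 (s≤s z≤n) (≤v-weaken (ℤ.+≤+ s≤e) (≡⇒≤v (≡.trans (≡.cong v (⟦σ^⟧ e)) (v-σ^≡ e)))))
        ∷ all-small ν (λ k k<ν → small (suc k) (s≤s k<ν))

      beyond : ∀ ν → divisor ν (length ν) ≡ 0#
      beyond []      = ≡.refl
      beyond (_ ∷ ν) = beyond ν

      ν≡r : length ν ≡ r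
      ν≡r with ℕ.m≤n⇒m<n∨m≡n ν≤r
      ... | inj₁ ν<r = contradiction (≤v-cong (reflexive (≡.sym (beyond ν))) ≤v-0) (small (length ν) ν<r)
      ... | inj₂ eq  = eq

  -- On the diagonal form, cancelling a divisor of valuation `e < s` from a product of valuation at
  -- least `a + s` leaves at least `a + 1`.
  rank⇒columnRegular : ∀ {m n s} {B : Mat𝓞 m n} → HasRank B s n → ColumnRegular (+ s) ⟦ B ⟧
  rank⇒columnRegular {m} {n} {s} {B} rank = columnRegular-transfer
    (integralEquivalence-sym (⇝⇒integralEquivalence reduces)) regular
    where
    open HasRank rank

    full = fullRank ν columns count

    n≤m : n ℕ.≤ m
    n≤m = ≡.subst (ℕ._≤ m) (proj₁ full) rows

    regular : ColumnRegular (+ s) (Δ {m} {n} ν)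
    regular a X ΔX k j with small-divisor ν (proj₂ full) (toℕ k) (≡.subst (toℕ k ℕ.<_) (≡.sym (proj₁ full)) (Fin.toℕ<n k))
    ... | e , vδ , e<s = ≤v-cancelˡ vδ (≤v-weaken (≤-via (ℤ.+≤+ e<s) (lemma a (+ s) (+ e)))
          (≤v-cong (Δ-*ₘ ν X (Fin.toℕ-inject≤ k n≤m) j) (ΔX (inject≤ k n≤m) j)))
      where
      lemma : ∀ a s e → (a ℤ.+ s) ℤ.- (e ℤ.+ (a ℤ.+ + 1)) ≡ s ℤ.- (+ 1 ℤ.+ e)
      lemma = solve-∀

  rank⇒rowRegular : ∀ {m n s} {B : Mat𝓞 m n} → HasRank B s m → RowRegular (+ s) ⟦ B ⟧
  rank⇒rowRegular {m} {n} {s} {B} rank = rowRegular-transfer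
    (integralEquivalence-sym (⇝⇒integralEquivalence reduces)) regular
    where
    open HasRank rank

    full = fullRank ν rows count

    m≤n : m ℕ.≤ n
    m≤n = ≡.subst (ℕ._≤ n) (proj₁ full) columns

    regular : RowRegular (+ s) (Δ {m} {n} ν)
    regular a Y YΔ i k with small-divisor ν (proj₂ full) (toℕ k) (≡.subst (toℕ k ℕ.<_) (≡.sym (proj₁ full)) (Fin.toℕ<n k))
    ... | e , vδ , e<s = ≤v-cancelʳ vδ (≤v-weaken (≤-via (ℤ.+≤+ e<s) (lemma a (+ s) (+ e)))
          (≤v-cong (*ₘ-Δ ν Y (≡.sym (Fin.toℕ-inject≤ k m≤n)) i) (YΔ i (inject≤ k m≤n))))
      where
      lemma : ∀ a s e → (a ℤ.+ s) ℤ.- ((a ℤ.+ + 1) ℤ.+ e) ≡ s ℤ.- (+ 1 ℤ.+ e)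
      lemma = solve-∀

  columnRegular⇒rank : ∀ {m n s} {B : Mat𝓞 m n} → ColumnRegular (+ s) ⟦ B ⟧ → HasRank B s n
  columnRegular⇒rank {m} {n} {s} {B} reg with smithForm 0 B (λ i j → proj₂ (B i j))
  ... | ν , ν≤m , ν≤n , sorted , B⇝Δ = record
    { ν = ν ; rows = ν≤m ; columns = ν≤n ; sorted = Linked.tail sorted ; reduces = B⇝Δ
    ; count = fullRank⇐ n ν ν≤n small }
    where
    Δ-regular : ColumnRegular (+ s) (Δ {m} {n} ν)
    Δ-regular = columnRegular-transfer (⇝⇒integralEquivalence B⇝Δ) reg

    small : ∀ k → k ℕ.< n → ¬ (+ s ≤v divisor ν k)
    -- A divisor of valuation at least `s` would send the unit vector at `κ` into `σ ^ s` 𝓞, and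
    -- regularity with `a = 0` would then force `v 1# ≥ 1`.
    small k k<n s≤δ = 1≰v1 (≤v-cong (1ₘ-diagonal κ) (Δ-regular (+ 0) (λ i _ → 1ₘ i κ) (λ i _ → ≤v-cong (sym (*ₘ-identityʳ (Δ ν) i κ)) (Δiκ i)) κ zero))
      where
      κ : Fin n
      κ = fromℕ< k<n

      Δiκ : ∀ i → + s ≤v Δ {m} {n} ν i κ
      Δiκ i with toℕ i ℕ.≟ toℕ κ
      ... | yes i≡κ = ≤v-cong (reflexive (≡.sym (≡.trans (Δ-at ν i≡κ) (≡.cong (divisor ν) (≡.trans i≡κ (Fin.toℕ-fromℕ< k<n)))))) s≤δ
      ... | no  i≢κ = ≤v-≈0 (reflexive (Δ-off ν i≢κ))

  rowRegular⇒rank : ∀ {m n s} {B : Mat𝓞 m n} → RowRegular (+ s) ⟦ B ⟧ → HasRank B s m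
  rowRegular⇒rank {m} {n} {s} {B} reg with smithForm 0 B (λ i j → proj₂ (B i j))
  ... | ν , ν≤m , ν≤n , sorted , B⇝Δ = record
    { ν = ν ; rows = ν≤m ; columns = ν≤n ; sorted = Linked.tail sorted ; reduces = B⇝Δ
    ; count = fullRank⇐ m ν ν≤m small }
    where
    Δ-regular : RowRegular (+ s) (Δ {m} {n} ν)
    Δ-regular = rowRegular-transfer (⇝⇒integralEquivalence B⇝Δ) reg

    small : ∀ k → k ℕ.< m → ¬ (+ s ≤v divisor ν k)
    small k k<m s≤δ = 1≰v1 (≤v-cong (1ₘ-diagonal κ) (Δ-regular (+ 0) (λ _ i → 1ₘ κ i) (λ _ j → ≤v-cong (sym (*ₘ-identityˡ (Δ ν) κ j)) (Δκj j)) zero κ))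
      where
      κ : Fin m
      κ = fromℕ< k<m

      Δκj : ∀ j → + s ≤v Δ {m} {n} ν κ j
      Δκj j with toℕ κ ℕ.≟ toℕ j
      ... | yes κ≡j = ≤v-cong (reflexive (≡.sym (≡.trans (Δ-at ν κ≡j) (≡.cong (divisor ν) (Fin.toℕ-fromℕ< k<m))))) s≤δ
      ... | no  κ≢j = ≤v-≈0 (reflexive (Δ-off ν κ≢j))

  -- From P B Q = Δ the inverse of B is Q Δ⁻¹ P.
  rank⇒rightInverse : ∀ {d s} {B : Mat𝓞 d d} → HasRank B s d →
                      ∃[ F ] (+ 1 ≤ₘ F × ⟦ B ⟧ *ₘ F ≋ λ i j → 1ₘ i j * σ ^ s)
  rank⇒rightInverse {d} {s} {B} rank =
    Q *ₘ G , integral-*ₘ {A = Q} {G} Q-integral 1≤G , BQG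
    where
    open HasRank rank
    open IntegralEquivalence (⇝⇒integralEquivalence reduces)

    full = fullRank ν columns count

    δ : Fin d → Carrier
    δ k = divisor ν (toℕ k)

    small : ∀ k → ∃[ e ] (v (δ k) ≡ [ + e ] × e ℕ.< s)
    small k = small-divisor ν (proj₂ full) (toℕ k) (≡.subst (toℕ k ℕ.<_) (≡.sym (proj₁ full)) (Fin.toℕ<n k))

    δ-inverse : ∀ k → Invertible _≈_ 1# _*_ (δ k)
    δ-inverse k = inverse (δ k) (v≡⇒≉0 (proj₁ (proj₂ (small k))))

    -- The scalar `σ ^ s` stands on the right, where it stays untouched by the later multiplications
    -- by `Δ ν` and `P⁻¹` from the left.
    G : Mat d d
    G i j = proj₁ (δ-inverse i) * (P i j * σ ^ s)

    -- Here rank modulo `σ ^ s`, and not mere invertibility, enters: `e < s` leaves valuation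
    -- `s - e ≥ 1`.
    1≤G : + 1 ≤ₘ G
    1≤G i j with small i | δ-inverse i
    ... | e , vδ , e<s | δ⁻¹ , _ , δδ⁻¹ = ≤v-weaken (≤-via (ℤ.+≤+ e<s) (lemma (+ s) (+ e)))
      (≤v-* (≡⇒≤v (v-inverse vδ δδ⁻¹)) (≤v-* (P-integral i j) (≡⇒≤v (v-σ^≡ s))))
      where
      lemma : ∀ s e → (ℤ.- e ℤ.+ (+ 0 ℤ.+ s)) ℤ.- + 1 ≡ s ℤ.- (+ 1 ℤ.+ e)
      lemma = solve-∀

    ΔG : Δ ν *ₘ G ≋ λ i j → P i j * σ ^ s
    ΔG i j = begin
      (Δ ν *ₘ G) i j                                ≈⟨ Δ-*ₘ ν G ≡.refl j ⟩
      δ i * (proj₁ (δ-inverse i) * (P i j * σ ^ s)) ≈⟨ *-assoc _ _ _ ⟨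
      δ i * proj₁ (δ-inverse i) * (P i j * σ ^ s)   ≈⟨ *-congʳ (proj₂ (proj₂ (δ-inverse i))) ⟩
      1# * (P i j * σ ^ s)                          ≈⟨ *-identityˡ _ ⟩
      P i j * σ ^ s                                 ∎

    BQG : ⟦ B ⟧ *ₘ (Q *ₘ G) ≋ λ i j → 1ₘ i j * σ ^ s
    BQG i j = begin
      (⟦ B ⟧ *ₘ (Q *ₘ G)) i j                        ≈⟨ *ₘ-assoc ⟦ B ⟧ Q G i j ⟨
      ((⟦ B ⟧ *ₘ Q) *ₘ G) i j                        ≈⟨ *ₘ-congʳ G AQ i j ⟩
      ((P⁻¹ *ₘ Δ ν) *ₘ G) i j                        ≈⟨ *ₘ-assoc P⁻¹ (Δ ν) G i j ⟩
      (P⁻¹ *ₘ (Δ ν *ₘ G)) i j                        ≈⟨ *ₘ-congˡ P⁻¹ ΔG i j ⟩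
      sum (λ k → P⁻¹ i k * (P k j * σ ^ s))          ≈⟨ sum-cong-≋ (λ k → *-assoc (P⁻¹ i k) (P k j) (σ ^ s)) ⟨
      sum (λ k → P⁻¹ i k * P k j * σ ^ s)            ≈⟨ *-distribʳ-sum (σ ^ s) (λ k → P⁻¹ i k * P k j) ⟨
      (P⁻¹ *ₘ P) i j * σ ^ s                         ≈⟨ *-congʳ (P⁻¹P i j) ⟩
      1ₘ i j * σ ^ s                                 ∎

  module _ (s : ℕ) where

    scale-*ₘ : ∀ {m n p} (M : Mat m n) b (X : Mat n p) i j →
               (⟦ scale s M b ⟧ *ₘ X) i j ≈ σ ^ s * (M *ₘ X) i j
    scale-*ₘ M b X i j = trans (sum-cong-≋ (λ k → *-assoc (σ ^ s) (M i k) (X k j)))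
                               (sym (*-distribˡ-sum (σ ^ s) (λ k → M i k * X k j)))

    *ₘ-scale : ∀ {m n p} (M : Mat m n) b (Y : Mat p m) i j →
               (Y *ₘ ⟦ scale s M b ⟧) i j ≈ ((λ i k → Y i k * σ ^ s) *ₘ M) i j
    *ₘ-scale M b Y i j = sum-cong-≋ (λ k → sym (*-assoc (Y i k) (σ ^ s) (M k j)))

    -- Cancelling `σ ^ s` from both sides is legitimate although `σ` need not be central, since the
    -- entries 0 and 1 of `1ₘ` commute with it.
    rank⇒smallRightInverse : ∀ {d} (M : Mat d d) b → HasRank (scale s M b) s d → ∃[ F ] (+ 1 ≤ₘ F × M *ₘ F ≋ 1ₘ)
    rank⇒smallRightInverse M b rank = let F , 1≤F , BF = rank⇒rightInverse rank in F , 1≤F , λ i j → begin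
      (M *ₘ F) i j                      ≈⟨ *-identityˡ _ ⟨
      1# * (M *ₘ F) i j                 ≈⟨ *-congʳ τσ ⟨
      τ * σ ^ s * (M *ₘ F) i j          ≈⟨ *-assoc τ (σ ^ s) _ ⟩
      τ * (σ ^ s * (M *ₘ F) i j)        ≈⟨ *-congˡ (trans (sym (scale-*ₘ M b F i j)) (BF i j)) ⟩
      τ * (1ₘ i j * σ ^ s)              ≈⟨ *-congˡ (1ₘ-central i j) ⟩
      τ * (σ ^ s * 1ₘ i j)              ≈⟨ *-assoc τ (σ ^ s) _ ⟨
      τ * σ ^ s * 1ₘ i j                ≈⟨ *-congʳ τσ ⟩
      1# * 1ₘ i j                       ≈⟨ *-identityˡ _ ⟩
      1ₘ i j                            ∎
      where
      τ : Carrier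
      τ = proj₁ (inverse (σ ^ s) (v≡⇒≉0 (v-σ^≡ s)))

      τσ : τ * σ ^ s ≈ 1#
      τσ = proj₁ (proj₂ (inverse (σ ^ s) (v≡⇒≉0 (v-σ^≡ s))))

      1ₘ-central : ∀ i j → 1ₘ i j * σ ^ s ≈ σ ^ s * 1ₘ i j
      1ₘ-central i j with i Fin.≟ j
      ... | yes _ = trans (*-identityˡ _) (sym (*-identityʳ _))
      ... | no  _ = trans (zeroˡ _) (sym (zeroʳ _))

    module _ {m n r : ℕ} (M : Fin r → Mat m n) (b : ∀ k → BoundedBelow s (M k)) where

      -- The scaling stands to the left of every block, so on column vectors it merely shifts the
      -- valuations of the image by `s`.
      columnRegular-blocks : ColumnRegular (+ s) ⟦ 𝓞ₘ.column (λ k → scale s (M k) (b k)) ⟧ →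
                             ∀ a X → (∀ k → a ≤ₘ M k *ₘ X) → a ℤ.+ + 1 ≤ₘ X
      columnRegular-blocks reg a X MX = reg a X λ i j →
        let q = proj₁ (remQuot {r} m i) ; ρ = proj₂ (remQuot {r} m i) in
        ≤v-≡ (ℤ.+-comm (+ s) a) (≤v-cong (sym (scale-*ₘ (M q) (b q) X ρ j)) (≤v-* (≡⇒≤v (v-σ^≡ s)) (MX q ρ j)))

      blocks-columnRegular : (∀ a X → (∀ k → a ≤ₘ M k *ₘ X) → a ℤ.+ + 1 ≤ₘ X) →
                             ColumnRegular (+ s) ⟦ 𝓞ₘ.column (λ k → scale s (M k) (b k)) ⟧
      blocks-columnRegular reg a X BX = reg a X λ k i j →
        ≤v-cancelˡ (v-σ^≡ s) (≤v-≡ (ℤ.+-comm a (+ s)) (≤v-cong (trans (block k i j) (scale-*ₘ (M k) (b k) X i j)) (BX (combine k i) j)))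
        where
        block : ∀ k i j → (⟦ 𝓞ₘ.column (λ k → scale s (M k) (b k)) ⟧ *ₘ X) (combine k i) j ≈ (⟦ scale s (M k) (b k) ⟧ *ₘ X) i j
        block k i j = reflexive (≡.cong (λ qρ → (⟦ scale s (M (proj₁ qρ)) (b (proj₁ qρ)) ⟧ *ₘ X) (proj₂ qρ) j) (Fin.remQuot-combine k i))

      -- For row vectors the scaling stands between `Y` and `M k` and need not commute with either.
      -- It is absorbed into the vector: regularity is applied to `Yτ`, with bounds lowered by `s`,
      -- and the result is multiplied back by `σ ^ s`.
      rowRegular-blocks : RowRegular (+ s) ⟦ 𝓞ₘ.row (λ k → scale s (M k) (b k)) ⟧ →
                          ∀ a Y → (∀ k → a ≤ₘ Y *ₘ M k) → a ℤ.+ + 1 ≤ₘ Y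
      rowRegular-blocks reg a Y YM i k =
        ≤v-≡ (lemma a (+ s)) (≤v-cong (Yτσ i k) (≤v-* (reg (a ℤ.- + s) Yτ bound i k) (≡⇒≤v (v-σ^≡ s))))
        where
        τ : Carrier
        τ = proj₁ (inverse (σ ^ s) (v≡⇒≉0 (v-σ^≡ s)))

        Yτ : Mat 1 m
        Yτ i k = Y i k * τ

        Yτσ : (λ i k → Yτ i k * σ ^ s) ≋ Y
        Yτσ i k = trans (*-assoc _ τ _) (trans (*-congˡ (proj₁ (proj₂ (inverse (σ ^ s) (v≡⇒≉0 (v-σ^≡ s)))))) (*-identityʳ _))

        lemma : ∀ a s → (a ℤ.- s ℤ.+ + 1) ℤ.+ s ≡ a ℤ.+ + 1
        lemma = solve-∀

        lemma′ : ∀ a s → a ≡ a ℤ.- s ℤ.+ s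
        lemma′ = solve-∀

        bound : (a ℤ.- + s) ℤ.+ + s ≤ₘ Yτ *ₘ ⟦ 𝓞ₘ.row (λ k → scale s (M k) (b k)) ⟧
        bound i j =
          let q = proj₁ (remQuot {r} n j) ; ρ = proj₂ (remQuot {r} n j) in
          ≤v-≡ (lemma′ a (+ s)) (≤v-cong (sym (trans (*ₘ-scale (M q) (b q) Yτ i ρ) (*ₘ-congʳ (M q) Yτσ i ρ))) (YM q i ρ))

      blocks-rowRegular : (∀ a Y → (∀ k → a ≤ₘ Y *ₘ M k) → a ℤ.+ + 1 ≤ₘ Y) →
                          RowRegular (+ s) ⟦ 𝓞ₘ.row (λ k → scale s (M k) (b k)) ⟧
      blocks-rowRegular reg a Y YB i k = ≤v-cancelʳ (v-σ^≡ s) (≤v-≡ (lemma a (+ s))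
        (reg (a ℤ.+ + s) (λ i k → Y i k * σ ^ s)
             (λ k i j → ≤v-cong (trans (block k i j) (*ₘ-scale (M k) (b k) Y i j)) (YB i (combine k j))) i k))
        where
        lemma : ∀ a s → (a ℤ.+ s) ℤ.+ + 1 ≡ (a ℤ.+ + 1) ℤ.+ s
        lemma = solve-∀

        block : ∀ k i j → (Y *ₘ ⟦ 𝓞ₘ.row (λ k → scale s (M k) (b k)) ⟧) i (combine k j) ≈ (Y *ₘ ⟦ scale s (M k) (b k) ⟧) i j
        block k i j = reflexive (≡.cong (λ qρ → (Y *ₘ ⟦ scale s (M (proj₁ qρ)) (b (proj₁ qρ)) ⟧) i (proj₂ qρ)) (Fin.remQuot-combine k j))

-- Descent: bounds that improve towards smaller indices.

module Descent (P : ℤ → ℕ → Set) (weaken : ∀ {a b j} → b ℤ.≤ a → P a j → P b j)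
               (n : ℕ) (contract : ∀ a j → (∀ (k : Fin n) → P a (j ℕ.+ suc (toℕ k))) → P (a ℤ.+ + 1) j)
               where

  module _ (a : ℤ) (N : ℕ) (start : ∀ j → j < n → P a (N ℕ.+ j)) where

    private

      -- Before anything can be gained, the bound `a` itself must be carried from the window down to
      -- every smaller index; here the unit gained by `contract` is given away again. `m` bounds the
      -- distance from `j` up to `N` and drives the recursion.
      below : ∀ m j → N ≤ j ℕ.+ m → j < N ℕ.+ n → P a j
      below m j N≤j+m j<N+n with N ℕ.≤? j
      ... | yes N≤j = ≡.subst (P a) (ℕ.m+[n∸m]≡n N≤j)
        (start (j ℕ.∸ N) (ℕ.+-cancelˡ-< N _ _ (≡.subst (_< N ℕ.+ n) (≡.sym (ℕ.m+[n∸m]≡n N≤j)) j<N+n)))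
      below zero    j N≤j+m j<N+n | no N≰j = contradiction (≡.subst (N ≤_) (ℕ.+-identityʳ j) N≤j+m) N≰j
      below (suc m) j N≤j+m j<N+n | no N≰j = weaken (ℤ.i≤i+j a (+ 1)) (contract a j λ k →
        below m (j ℕ.+ suc (toℕ k))
          (ℕ.≤-trans N≤j+m (ℕ.≤-trans (ℕ.≤-reflexive (ℕ.+-suc j m)) (ℕ.+-monoˡ-≤ m (ℕ.≤-trans (ℕ.≤-reflexive (ℕ.+-comm 1 j)) (ℕ.+-monoʳ-≤ j (s≤s z≤n))))))
          (ℕ.+-mono-<-≤ (ℕ.≰⇒> N≰j) (Fin.toℕ<n k)))

    -- Each use of `contract` gains one unit and looks at most `n` indices ahead, so `i` units at
    -- `j` cost `n * i` indices. All indices below `N + n`, the end of the starting window, may be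
    -- consulted.
    descend : ∀ i j → j ℕ.+ n ℕ.* i < N ℕ.+ n → P (a ℤ.+ + i) j
    descend zero    j j<N+n = ≡.subst (λ a → P a j) (≡.sym (ℤ.+-identityʳ a))
      (below N j (ℕ.m≤n+m N j) (≡.subst (_< N ℕ.+ n) (≡.trans (≡.cong (j ℕ.+_) (ℕ.*-zeroʳ n)) (ℕ.+-identityʳ j)) j<N+n))
    descend (suc i) j j<N+n = ≡.subst (λ a → P a j) (lemma a (+ i)) (contract (a ℤ.+ + i) j λ k →
      descend i (j ℕ.+ suc (toℕ k)) (ℕ.≤-<-trans (step k) j<N+n))
      where
      lemma : ∀ a i → a ℤ.+ i ℤ.+ + 1 ≡ a ℤ.+ (+ 1 ℤ.+ i)
      lemma = solve-∀

      step : ∀ (k : Fin n) → j ℕ.+ suc (toℕ k) ℕ.+ n ℕ.* i ≤ j ℕ.+ n ℕ.* suc i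
      step k = ℕ.≤-trans (ℕ.≤-reflexive (ℕ.+-assoc j (suc (toℕ k)) (n ℕ.* i)))
        (ℕ.+-monoʳ-≤ j (ℕ.≤-trans (ℕ.+-monoˡ-≤ (n ℕ.* i) (Fin.toℕ<n k)) (ℕ.≤-reflexive (≡.sym (ℕ.*-suc n i)))))

-- Rank conditions on single powers of `D` and on stacked powers.

module PowerRanks {c ℓ : Level} (𝓛 : CompleteDiscretelyValuedSkewField c ℓ) where

  open CompleteDiscretelyValuedSkewField 𝓛 hiding (zero)
  open Valuation 𝓛 hiding (s)
  open ValuationProperties 𝓛
  open Rank 𝓛
  open Matrices rawRing
  open MatrixProperties ring using (≋-sym; ≋-trans; *ₘ-congˡ; *ₘ-congʳ; *ₘ-assoc; *ₘ-identityˡ; *ₘ-identityʳ; ^ₘ-+)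

  module _ {d : ℕ} (M : Mat d d) where

    -- Regularity of the scaled matrix with the scaling removed. As `s` no longer occurs, it can be
    -- used for exponents whose scalings differ.
    ColumnContraction : Set c
    ColumnContraction = ∀ a (X : Mat d 1) → a ≤ₘ M *ₘ X → a ℤ.+ + 1 ≤ₘ X

    RowContraction : Set c
    RowContraction = ∀ a (Y : Mat 1 d) → a ≤ₘ Y *ₘ M → a ℤ.+ + 1 ≤ₘ Y

    module _ (s : ℕ) (b : BoundedBelow s M) where

      rank⇒columnContraction : HasRank (scale s M b) s d → ColumnContraction
      rank⇒columnContraction rank a X MX = rank⇒columnRegular rank a X λ i j →
        ≤v-≡ (ℤ.+-comm (+ s) a) (≤v-cong (sym (scale-*ₘ s M b X i j)) (≤v-* (≡⇒≤v (v-σ^≡ s)) (MX i j)))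

      columnContraction⇒rank : ColumnContraction → HasRank (scale s M b) s d
      columnContraction⇒rank contr = columnRegular⇒rank λ a X BX → contr a X λ i j →
        ≤v-cancelˡ (v-σ^≡ s) (≤v-≡ (ℤ.+-comm a (+ s)) (≤v-cong (scale-*ₘ s M b X i j) (BX i j)))

      -- `Y = (Y M) F`, and the right inverse `F` raises every lower bound by one.
      rank⇒rowContraction : HasRank (scale s M b) s d → RowContraction
      rank⇒rowContraction rank a Y YM = let F , 1≤F , MF = rank⇒smallRightInverse s M b rank in ≤ₘ-cong
        (≋-trans (*ₘ-assoc Y M F) (≋-trans (*ₘ-congˡ Y MF) (*ₘ-identityʳ Y)))
        (≤ₘ-* {A = Y *ₘ M} {F} YM 1≤F)

      rowContraction⇒rank : RowContraction → HasRank (scale s M b) s d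
      rowContraction⇒rank contr = rowRegular⇒rank λ a Y YB i j →
        ≤v-cancelʳ (v-σ^≡ s) (≤v-≡ (lemma a (+ s))
          (contr (a ℤ.+ + s) (λ i k → Y i k * σ ^ s)
            (λ i j → ≤v-cong (*ₘ-scale s M b Y i j) (YB i j)) i j))
        where
        lemma : ∀ a s → (a ℤ.+ s) ℤ.+ + 1 ≡ (a ℤ.+ + 1) ℤ.+ s
        lemma = solve-∀

  module _ {d : ℕ} (D : Mat d d) {n : ℕ} (1≤n : 1 ≤ n) (s : ℕ) (bounded : PowersBoundedBelow D n s) where

    blocks : Fin n → Mat𝓞 d d
    blocks k = scale s (D ^ₘ suc (toℕ k)) (bounded (suc (toℕ k)) (s≤s z≤n) (Fin.toℕ<n k))

    -- Within the window of `n` powers starting at this exponent at most `s` is lost. So `s + 1`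
    -- rounds of descent, each costing `n` indices, lead from `a - s` to `a + 1` at index 0.
    contractionExponent : ℕ
    contractionExponent = n ℕ.* suc s

    1≤contractionExponent : 1 ≤ contractionExponent
    1≤contractionExponent = ℕ.*-mono-≤ 1≤n (s≤s z≤n)

    private
      enough : n ℕ.* suc s < contractionExponent ℕ.+ n
      enough = ℕ.m<m+n contractionExponent 1≤n

      a-s≤a : ∀ a → a ℤ.- + s ℤ.≤ a
      a-s≤a a = ℤ.i≤j⇒i-k≤j (+ s) ℤ.≤-refl

      gain : ∀ a s → a ℤ.- s ℤ.+ (+ 1 ℤ.+ s) ≡ a ℤ.+ + 1
      gain = solve-∀

    columnRank⇒columnContraction : HasRank (𝓞ₘ.column blocks) s d → ColumnContraction (D ^ₘ contractionExponent)
    columnRank⇒columnContraction rank a X DX = ≤ₘ-cong (*ₘ-identityˡ X) λ i j →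
      ≤v-≡ (gain a (+ s)) (descend (a ℤ.- + s) contractionExponent start (suc s) 0 enough i j)
      where
      contract : ∀ a j → (∀ (k : Fin n) → a ≤ₘ D ^ₘ (j ℕ.+ suc (toℕ k)) *ₘ X) → a ℤ.+ + 1 ≤ₘ D ^ₘ j *ₘ X
      contract a j bounds = columnRegular-blocks s (λ k → D ^ₘ suc (toℕ k)) (λ k → bounded (suc (toℕ k)) (s≤s z≤n) (Fin.toℕ<n k))
        (rank⇒columnRegular rank) a (D ^ₘ j *ₘ X)
        λ k → ≤ₘ-cong (≋-trans (*ₘ-congʳ X (power k)) (*ₘ-assoc (D ^ₘ suc (toℕ k)) (D ^ₘ j) X)) (bounds k)
        where
        power : ∀ k → D ^ₘ (j ℕ.+ suc (toℕ k)) ≋ D ^ₘ suc (toℕ k) *ₘ D ^ₘ j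
        power k = ≡.subst (λ l → D ^ₘ l ≋ D ^ₘ suc (toℕ k) *ₘ D ^ₘ j) (ℕ.+-comm (suc (toℕ k)) j) (^ₘ-+ D (suc (toℕ k)) j)

      open Descent (λ a j → a ≤ₘ D ^ₘ j *ₘ X) (λ b≤a p i j → ≤v-weaken b≤a (p i j)) n contract

      start : ∀ j → j < n → a ℤ.- + s ≤ₘ D ^ₘ (contractionExponent ℕ.+ j) *ₘ X
      -- `bounded` speaks of positive powers only, so the first term of the window, which loses
      -- nothing, is treated on its own.
      start zero    _   = ≡.subst (λ N → a ℤ.- + s ≤ₘ D ^ₘ N *ₘ X) (≡.sym (ℕ.+-identityʳ contractionExponent))
        λ i k → ≤v-weaken (a-s≤a a) (DX i k)
      start (suc j) j<n = ≡.subst (λ N → a ℤ.- + s ≤ₘ D ^ₘ N *ₘ X) (ℕ.+-comm (suc j) contractionExponent) (≤ₘ-cong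
        (≋-trans (≋-sym (*ₘ-assoc (D ^ₘ suc j) (D ^ₘ contractionExponent) X)) (*ₘ-congʳ X (≋-sym (^ₘ-+ D (suc j) contractionExponent))))
        λ i k → ≤v-≡ (ℤ.+-comm (ℤ.- + s) a)
          (≤ₘ-* {A = D ^ₘ suc j} {D ^ₘ contractionExponent *ₘ X} (bounded (suc j) (s≤s z≤n) (ℕ.<⇒≤ j<n)) DX i k))

    rowRank⇒rowContraction : HasRank (𝓞ₘ.row blocks) s d → RowContraction (D ^ₘ contractionExponent)
    rowRank⇒rowContraction rank a Y YD = ≤ₘ-cong (*ₘ-identityʳ Y) λ i j →
      ≤v-≡ (gain a (+ s)) (descend (a ℤ.- + s) contractionExponent start (suc s) 0 enough i j)
      where
      contract : ∀ a j → (∀ (k : Fin n) → a ≤ₘ Y *ₘ D ^ₘ (j ℕ.+ suc (toℕ k))) → a ℤ.+ + 1 ≤ₘ Y *ₘ D ^ₘ j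
      contract a j bounds = rowRegular-blocks s (λ k → D ^ₘ suc (toℕ k)) (λ k → bounded (suc (toℕ k)) (s≤s z≤n) (Fin.toℕ<n k))
        (rank⇒rowRegular rank) a (Y *ₘ D ^ₘ j)
        λ k → ≤ₘ-cong (≋-trans (*ₘ-congˡ Y (^ₘ-+ D j (suc (toℕ k)))) (≋-sym (*ₘ-assoc Y (D ^ₘ j) (D ^ₘ suc (toℕ k))))) (bounds k)

      open Descent (λ a j → a ≤ₘ Y *ₘ D ^ₘ j) (λ b≤a p i j → ≤v-weaken b≤a (p i j)) n contract

      start : ∀ j → j < n → a ℤ.- + s ≤ₘ Y *ₘ D ^ₘ (contractionExponent ℕ.+ j)
      start zero    _   = ≡.subst (λ N → a ℤ.- + s ≤ₘ Y *ₘ D ^ₘ N) (≡.sym (ℕ.+-identityʳ contractionExponent))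
        λ i k → ≤v-weaken (a-s≤a a) (YD i k)
      start (suc j) j<n = ≤ₘ-cong
        (≋-trans (*ₘ-assoc Y (D ^ₘ contractionExponent) (D ^ₘ suc j)) (*ₘ-congˡ Y (≋-sym (^ₘ-+ D contractionExponent (suc j)))))
        (≤ₘ-* {A = Y *ₘ D ^ₘ contractionExponent} {D ^ₘ suc j} YD (bounded (suc j) (s≤s z≤n) (ℕ.<⇒≤ j<n)))

  module _ {d : ℕ} (D : Mat d d) {n : ℕ} (1≤n : 1 ≤ n) (s : ℕ) (bounded : PowersBoundedBelow D n s) where

    private
      lastBlock : Fin n
      lastBlock = fromℕ< (ℕ.≤-reflexive (ℕ.suc-pred n {{ℕ.>-nonZero 1≤n}}))

      suc-lastBlock : suc (toℕ lastBlock) ≡ n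
      suc-lastBlock = ≡.trans (≡.cong suc (Fin.toℕ-fromℕ< _)) (ℕ.suc-pred n {{ℕ.>-nonZero 1≤n}})

    -- If all blocks send `X` into `σᵃ` 𝓞, then so does the last one, and that is `D ^ₘ n`.
    columnContraction⇒columnRank : ColumnContraction (D ^ₘ n) → HasRank (𝓞ₘ.column (blocks D 1≤n s bounded)) s d
    columnContraction⇒columnRank contr = columnRegular⇒rank
      (blocks-columnRegular s (λ k → D ^ₘ suc (toℕ k)) (λ k → bounded (suc (toℕ k)) (s≤s z≤n) (Fin.toℕ<n k)) λ a X DX →
        contr a X (≡.subst (λ k → a ≤ₘ D ^ₘ k *ₘ X) suc-lastBlock (DX lastBlock)))

    rowContraction⇒rowRank : RowContraction (D ^ₘ n) → HasRank (𝓞ₘ.row (blocks D 1≤n s bounded)) s d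
    rowContraction⇒rowRank contr = rowRegular⇒rank
      (blocks-rowRegular s (λ k → D ^ₘ suc (toℕ k)) (λ k → bounded (suc (toℕ k)) (s≤s z≤n) (Fin.toℕ<n k)) λ a Y YD →
        contr a Y (≡.subst (λ k → a ≤ₘ Y *ₘ D ^ₘ k) suc-lastBlock (YD lastBlock)))

-- The ring of polynomials in a central indeterminate.

module PolynomialRing {c ℓ : Level} (R : Ring c ℓ) where

  open Ring R hiding (zero)
  open Polynomials rawRing using (coefficient; constant; _≈ₚ_; _+ₚ_; _*ₚ_; t) renaming (rawRing to polynomialRawRing)
  open RingProperties R using (-0#≈0#)
  open import Relation.Binary.Reasoning.Setoid setoid

  private
    interchange : ∀ w x y z → (w + x) + (y + z) ≈ (w + y) + (x + z)
    interchange = CommutativeSemigroupProperties.interchange +-commutativeSemigroup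

  -- The laws of multiplication are proved for coefficient functions, where trailing zeros of lists
  -- cause no case distinctions. Peeling off the lowest coefficient of `f` follows the recursion of
  -- `_*ₚ_`.
  convolution : (ℕ → Carrier) → (ℕ → Carrier) → ℕ → Carrier
  convolution f g zero    = f 0 * g 0
  convolution f g (suc n) = f 0 * g (suc n) + convolution (f ∘ suc) g n

  convolution-cong : ∀ {f f′ g g′} → (∀ i → f i ≈ f′ i) → (∀ i → g i ≈ g′ i) →
                     ∀ n → convolution f g n ≈ convolution f′ g′ n
  convolution-cong f≈ g≈ zero    = *-cong (f≈ 0) (g≈ 0)
  convolution-cong f≈ g≈ (suc n) = +-cong (*-cong (f≈ 0) (g≈ (suc n))) (convolution-cong (f≈ ∘ suc) g≈ n)

  convolution-zeroˡ : ∀ {f} g → (∀ i → f i ≈ 0#) → ∀ n → convolution f g n ≈ 0#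
  convolution-zeroˡ g f≈0 zero    = trans (*-congʳ (f≈0 0)) (zeroˡ _)
  convolution-zeroˡ g f≈0 (suc n) =
    trans (+-cong (trans (*-congʳ (f≈0 0)) (zeroˡ _)) (convolution-zeroˡ g (f≈0 ∘ suc) n)) (+-identityˡ 0#)

  convolution-distribʳ : ∀ f f′ g n → convolution (λ i → f i + f′ i) g n ≈ convolution f g n + convolution f′ g n
  convolution-distribʳ f f′ g zero    = distribʳ (g 0) (f 0) (f′ 0)
  convolution-distribʳ f f′ g (suc n) =
    trans (+-cong (distribʳ _ _ _) (convolution-distribʳ (f ∘ suc) (f′ ∘ suc) g n)) (interchange _ _ _ _)

  convolution-distribˡ : ∀ f g g′ n → convolution f (λ i → g i + g′ i) n ≈ convolution f g n + convolution f g′ n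
  convolution-distribˡ f g g′ zero    = distribˡ (f 0) (g 0) (g′ 0)
  convolution-distribˡ f g g′ (suc n) =
    trans (+-cong (distribˡ _ _ _) (convolution-distribˡ (f ∘ suc) g g′ n)) (interchange _ _ _ _)

  convolution-scale : ∀ a f g n → convolution (λ i → a * f i) g n ≈ a * convolution f g n
  convolution-scale a f g zero    = *-assoc _ _ _
  convolution-scale a f g (suc n) =
    trans (+-cong (*-assoc _ _ _) (convolution-scale a (f ∘ suc) g n)) (sym (distribˡ _ _ _))

  convolution-assoc : ∀ f g h n → convolution (convolution f g) h n ≈ convolution f (convolution g h) n
  convolution-assoc f g h zero    = *-assoc _ _ _
  convolution-assoc f g h (suc n) = begin
    f 0 * g 0 * h (suc n) + convolution (λ i → f 0 * g (suc i) + convolution (f ∘ suc) g i) h n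
      ≈⟨ +-cong (*-assoc _ _ _) (convolution-distribʳ (λ i → f 0 * g (suc i)) (convolution (f ∘ suc) g) h n) ⟩
    f 0 * (g 0 * h (suc n)) + (convolution (λ i → f 0 * g (suc i)) h n + convolution (convolution (f ∘ suc) g) h n)
      ≈⟨ +-congˡ (+-cong (convolution-scale (f 0) (g ∘ suc) h n) (convolution-assoc (f ∘ suc) g h n)) ⟩
    f 0 * (g 0 * h (suc n)) + (f 0 * convolution (g ∘ suc) h n + convolution (f ∘ suc) (convolution g h) n)
      ≈⟨ +-assoc _ _ _ ⟨
    f 0 * (g 0 * h (suc n)) + f 0 * convolution (g ∘ suc) h n + convolution (f ∘ suc) (convolution g h) n
      ≈⟨ +-congʳ (distribˡ _ _ _) ⟨
    f 0 * (g 0 * h (suc n) + convolution (g ∘ suc) h n) + convolution (f ∘ suc) (convolution g h) n ∎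

  coefficient-+ : ∀ f g i → coefficient (f +ₚ g) i ≈ coefficient f i + coefficient g i
  coefficient-+ []      g       i       = sym (+-identityˡ _)
  coefficient-+ (a ∷ f) []      i       = sym (+-identityʳ _)
  coefficient-+ (a ∷ f) (b ∷ g) zero    = refl
  coefficient-+ (a ∷ f) (b ∷ g) (suc i) = coefficient-+ f g i

  coefficient-scale : ∀ a f i → coefficient (List.map (a *_) f) i ≈ a * coefficient f i
  coefficient-scale a []      i       = sym (zeroʳ a)
  coefficient-scale a (b ∷ f) zero    = refl
  coefficient-scale a (b ∷ f) (suc i) = coefficient-scale a f i

  coefficient-neg : ∀ f i → coefficient (List.map -_ f) i ≈ - coefficient f i
  coefficient-neg []      i       = sym -0#≈0#
  coefficient-neg (b ∷ f) zero    = refl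
  coefficient-neg (b ∷ f) (suc i) = coefficient-neg f i

  coefficient-* : ∀ f g i → coefficient (f *ₚ g) i ≈ convolution (coefficient f) (coefficient g) i
  coefficient-* []      g i       = sym (convolution-zeroˡ (coefficient g) (λ _ → refl) i)
  coefficient-* (a ∷ f) g zero    = begin
    coefficient (List.map (a *_) g +ₚ (0# ∷ (f *ₚ g))) 0  ≈⟨ coefficient-+ (List.map (a *_) g) _ 0 ⟩
    coefficient (List.map (a *_) g) 0 + 0#                ≈⟨ +-identityʳ _ ⟩
    coefficient (List.map (a *_) g) 0                     ≈⟨ coefficient-scale a g 0 ⟩
    a * coefficient g 0                                   ∎
  coefficient-* (a ∷ f) g (suc i) =
    trans (coefficient-+ (List.map (a *_) g) _ (suc i)) (+-cong (coefficient-scale a g (suc i)) (coefficient-* f g i))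

  private
    *-assocₚ : ∀ f g h → (f *ₚ g) *ₚ h ≈ₚ f *ₚ (g *ₚ h)
    *-assocₚ f g h i = begin
      coefficient ((f *ₚ g) *ₚ h) i                                              ≈⟨ coefficient-* (f *ₚ g) h i ⟩
      convolution (coefficient (f *ₚ g)) (coefficient h) i                       ≈⟨ convolution-cong (coefficient-* f g) (λ _ → refl) i ⟩
      convolution (convolution (coefficient f) (coefficient g)) (coefficient h) i ≈⟨ convolution-assoc (coefficient f) (coefficient g) (coefficient h) i ⟩
      convolution (coefficient f) (convolution (coefficient g) (coefficient h)) i ≈⟨ convolution-cong (λ _ → refl) (coefficient-* g h) i ⟨
      convolution (coefficient f) (coefficient (g *ₚ h)) i                       ≈⟨ coefficient-* f (g *ₚ h) i ⟨
      coefficient (f *ₚ (g *ₚ h)) i                                              ∎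

    *-identityˡₚ : ∀ f → constant 1# *ₚ f ≈ₚ f
    *-identityˡₚ f i = trans (coefficient-* (constant 1#) f i) (unit (coefficient f) i)
      where
      unit : ∀ f i → convolution (coefficient (constant 1#)) f i ≈ f i
      unit f zero    = *-identityˡ _
      unit f (suc i) = trans (+-cong (*-identityˡ _) (convolution-zeroˡ f (λ _ → refl) i)) (+-identityʳ _)

    *-identityʳₚ : ∀ f → f *ₚ constant 1# ≈ₚ f
    *-identityʳₚ f i = trans (coefficient-* f (constant 1#) i) (unit (coefficient f) i)
      where
      unit : ∀ f i → convolution f (coefficient (constant 1#)) i ≈ f i
      unit f zero    = *-identityʳ _
      unit f (suc i) = trans (+-cong (zeroʳ _) (unit (f ∘ suc) i)) (+-identityˡ _)

    distribˡₚ : ∀ f g h → f *ₚ (g +ₚ h) ≈ₚ f *ₚ g +ₚ f *ₚ h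
    distribˡₚ f g h i = begin
      coefficient (f *ₚ (g +ₚ h)) i                                             ≈⟨ coefficient-* f (g +ₚ h) i ⟩
      convolution (coefficient f) (coefficient (g +ₚ h)) i                      ≈⟨ convolution-cong (λ _ → refl) (coefficient-+ g h) i ⟩
      convolution (coefficient f) (λ i → coefficient g i + coefficient h i) i   ≈⟨ convolution-distribˡ (coefficient f) (coefficient g) (coefficient h) i ⟩
      convolution (coefficient f) (coefficient g) i + convolution (coefficient f) (coefficient h) i
                                                                                ≈⟨ +-cong (coefficient-* f g i) (coefficient-* f h i) ⟨
      coefficient (f *ₚ g) i + coefficient (f *ₚ h) i                           ≈⟨ coefficient-+ (f *ₚ g) (f *ₚ h) i ⟨
      coefficient (f *ₚ g +ₚ f *ₚ h) i                                          ∎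

    distribʳₚ : ∀ h f g → (f +ₚ g) *ₚ h ≈ₚ f *ₚ h +ₚ g *ₚ h
    distribʳₚ h f g i = begin
      coefficient ((f +ₚ g) *ₚ h) i                                             ≈⟨ coefficient-* (f +ₚ g) h i ⟩
      convolution (coefficient (f +ₚ g)) (coefficient h) i                      ≈⟨ convolution-cong (coefficient-+ f g) (λ _ → refl) i ⟩
      convolution (λ i → coefficient f i + coefficient g i) (coefficient h) i   ≈⟨ convolution-distribʳ (coefficient f) (coefficient g) (coefficient h) i ⟩
      convolution (coefficient f) (coefficient h) i + convolution (coefficient g) (coefficient h) i
                                                                                ≈⟨ +-cong (coefficient-* f h i) (coefficient-* g h i) ⟨
      coefficient (f *ₚ h) i + coefficient (g *ₚ h) i                           ≈⟨ coefficient-+ (f *ₚ h) (g *ₚ h) i ⟨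
      coefficient (f *ₚ h +ₚ g *ₚ h) i                                          ∎

    sum-law : ∀ f g f′ g′ → (∀ i → coefficient f i + coefficient g i ≈ coefficient f′ i + coefficient g′ i) →
              f +ₚ g ≈ₚ f′ +ₚ g′
    sum-law f g f′ g′ eq i = trans (coefficient-+ f g i) (trans (eq i) (sym (coefficient-+ f′ g′ i)))

  polynomialRing : Ring c ℓ
  polynomialRing = record
    { RawRing polynomialRawRing
    ; isRing = record
      { +-isAbelianGroup = record
        { isGroup = record
          { isMonoid = record
            { isSemigroup = record
              { isMagma = record
                { isEquivalence = record
                  { refl = λ _ → refl ; sym = λ f≈g i → sym (f≈g i) ; trans = λ f≈g g≈h i → trans (f≈g i) (g≈h i) }
                ; ∙-cong = λ {f} {f′} {g} {g′} f≈f′ g≈g′ → sum-law f g f′ g′ λ i → +-cong (f≈f′ i) (g≈g′ i) }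
              ; assoc = λ f g h → sum-law (f +ₚ g) h f (g +ₚ h) λ i →
                  trans (+-congʳ (coefficient-+ f g i)) (trans (+-assoc _ _ _) (+-congˡ (sym (coefficient-+ g h i)))) }
            ; identity = (λ f i → refl) , λ f i → trans (coefficient-+ f [] i) (+-identityʳ _) }
          ; inverse = (λ f i → trans (coefficient-+ (List.map -_ f) f i) (trans (+-congʳ (coefficient-neg f i)) (-‿inverseˡ _)))
                    , λ f i → trans (coefficient-+ f (List.map -_ f) i) (trans (+-congˡ (coefficient-neg f i)) (-‿inverseʳ _))
          ; ⁻¹-cong = λ {f} {g} f≈g i → trans (coefficient-neg f i) (trans (-‿cong (f≈g i)) (sym (coefficient-neg g i))) }
        ; comm = λ f g → sum-law f g g f λ i → +-comm _ _ }
      ; *-cong = λ {f} {f′} {g} {g′} f≈f′ g≈g′ i →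
          trans (coefficient-* f g i) (trans (convolution-cong f≈f′ g≈g′ i) (sym (coefficient-* f′ g′ i)))
      ; *-assoc = *-assocₚ
      ; *-identity = *-identityˡₚ , *-identityʳₚ
      ; distrib = distribˡₚ , distribʳₚ
      }
    }

  t-* : ∀ f → t *ₚ f ≈ₚ 0# ∷ f
  t-* f i = trans (coefficient-* t f i) (shift i)
    where
    shift : ∀ i → convolution (coefficient t) (coefficient f) i ≈ coefficient (0# ∷ f) i
    shift zero          = zeroˡ _
    shift (suc zero)    = trans (+-cong (zeroˡ _) (*-identityˡ _)) (+-identityˡ _)
    shift (suc (suc i)) = trans (+-cong (zeroˡ _) (trans (+-cong (*-identityˡ _) (convolution-zeroˡ (coefficient f) (λ _ → refl) i)) (+-identityʳ _))) (+-identityˡ _)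

  *-t : ∀ f → f *ₚ t ≈ₚ 0# ∷ f
  *-t f zero    = trans (coefficient-* f t 0) (zeroʳ _)
  *-t f (suc i) = trans (coefficient-* f t (suc i)) (shift (coefficient f) i)
    where
    shift : ∀ f i → convolution f (coefficient t) (suc i) ≈ f i
    shift f zero    = trans (+-cong (*-identityʳ _) (zeroʳ _)) (+-identityʳ _)
    shift f (suc i) = trans (+-cong (zeroʳ _) (shift (f ∘ suc) i)) (+-identityˡ _)

  t-central : ∀ f → t *ₚ f ≈ₚ f *ₚ t
  t-central f i = trans (t-* f i) (sym (*-t f i))

  coefficient-zero : ∀ f g → coefficient (f *ₚ g) 0 ≈ coefficient f 0 * coefficient g 0
  coefficient-zero f g = coefficient-* f g 0

-- `ℚ._/_` normalises its fraction and so hides the numerator; the comparison is made on the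
-- equivalent unnormalised fraction.
0</⇒0< : ∀ n d .{{_ : ℕ.NonZero d}} → ℚ.0ℚ ℚ.< n ℚ./ d → + 0 ℤ.< n
0</⇒0< n (suc d) 0<n/d with ℚᵘ.<-respʳ-≃ (ℚ.toℚᵘ-fromℚᵘ (mkℚᵘ n d)) (ℚ.toℚᵘ-mono-< 0<n/d)
... | ℚᵘ.*<* 0<n*1 = ≡.subst (+ 0 ℤ.<_) (ℤ.*-identityʳ n) 0<n*1

0<⇒0</ : ∀ n d .{{_ : ℕ.NonZero d}} → + 0 ℤ.< n → ℚ.0ℚ ℚ.< n ℚ./ d
0<⇒0</ n (suc d) 0<n = ℚ.toℚᵘ-cancel-< (ℚᵘ.<-respʳ-≃ (ℚᵘ.≃-sym (ℚ.toℚᵘ-fromℚᵘ (mkℚᵘ n d)))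
  (ℚᵘ.*<* (≡.subst (+ 0 ℤ.<_) (≡.sym (ℤ.*-identityʳ n)) 0<n)))

<-via : ∀ {i j k l} → i ℤ.< j → l ℤ.- k ≡ j ℤ.- i → k ℤ.< l
<-via {i} {j} {k} {l} i<j eq = ℤ.suc[i]≤j⇒i<j (≤-via (ℤ.i<j⇒suc[i]≤j i<j)
  (≡.trans (lemma k l) (≡.trans (≡.cong (ℤ._- + 1) eq) (≡.sym (lemma i j)))))
  where
  lemma : ∀ i j → j ℤ.- (+ 1 ℤ.+ i) ≡ j ℤ.- i ℤ.- + 1
  lemma = solve-∀

-- Newton polygons and Gauss' lemma.

module Newton {c ℓ : Level} (𝓛 : CompleteDiscretelyValuedSkewField c ℓ) where

  open CompleteDiscretelyValuedSkewField 𝓛 hiding (zero)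
  open Valuation 𝓛 using (Edge; AllSlopesPositive)
  open ValuationProperties 𝓛
  open Polynomials rawRing using (Polynomial; coefficient; _*ₚ_)
  open PolynomialRing ring using (convolution; coefficient-*)
  open import Relation.Binary.Reasoning.Setoid setoid

  -- By convexity all slopes are positive as soon as the first edge rises, which only involves v a₀.
  Dominant : Polynomial → Set
  Dominant f = ∃[ μ ] (v (coefficient f 0) ≡ [ μ ] × ∀ k → μ ℤ.+ + 1 ≤v coefficient f (suc k))

  -- Once the minimum is scaled to 0, `k` is the degree of the reduction modulo `σ`, and `f k` lifts
  -- its leading coefficient.
  record LastMinimum (f : ℕ → Carrier) (μ : ℤ) (k : ℕ) : Set where
    field
      attained : v (f k) ≡ [ μ ]
      minimal  : ∀ i → μ ≤v f i
      beyond   : ∀ i → k < i → μ ℤ.+ + 1 ≤v f i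

  -- The scan starts from the highest coefficient. On a tie the later index is kept, so a new
  -- constant coefficient wins only with strictly smaller valuation.
  lastMinimum : ∀ f → (∀ i → coefficient f i ≈ 0#) ⊎ ∃[ μ ] ∃[ k ] LastMinimum (coefficient f) μ k
  lastMinimum [] = inj₁ λ _ → refl
  lastMinimum (a ∷ f) with lastMinimum f
  ... | inj₁ f≈0 with ≈0? a
  ...   | yes a≈0 = inj₁ λ { zero → a≈0 ; (suc i) → f≈0 i }
  ...   | no  a≉0 with v-finite a≉0
  ...     | α , va = inj₂ (α , 0 , record
    { attained = va
    ; minimal = λ { zero → ≡⇒≤v va ; (suc i) → ≤v-≈0 (f≈0 i) }
    ; beyond = λ { (suc i) _ → ≤v-≈0 (f≈0 i) } })
  lastMinimum (a ∷ f) | inj₂ (μ , k , fμ) with μ ≤v? a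
  ... | yes μ≤a = inj₂ (μ , suc k , record
    { attained = attained
    ; minimal = λ { zero → μ≤a ; (suc i) → minimal i }
    ; beyond = λ { (suc i) (s≤s k<i) → beyond i k<i } })
    where open LastMinimum fμ
  ... | no  μ≰a with v-finite (λ a≈0 → μ≰a (≤v-≈0 a≈0))
  ...   | α , va = inj₂ (α , 0 , record
    { attained = va
    ; minimal = λ { zero → ≡⇒≤v va ; (suc i) → ≤v-weaken (ℤ.<⇒≤ α<μ) (minimal i) }
    ; beyond = λ { (suc i) _ → ≤v-weaken (ℤ.≤-trans (ℤ.≤-reflexive (ℤ.+-comm α (+ 1))) (ℤ.i<j⇒suc[i]≤j α<μ)) (minimal i) } })
    where
    open LastMinimum fμ
    α<μ : α ℤ.< μ
    α<μ = ℤ.≰⇒> λ μ≤α → μ≰a (≤v-weaken μ≤α (≡⇒≤v va))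

  ≤v-convolution : ∀ {a b f g} → (∀ i → a ≤v f i) → (∀ i → b ≤v g i) → ∀ n → a ℤ.+ b ≤v convolution f g n
  ≤v-convolution a≤f b≤g zero    = ≤v-* (a≤f 0) (b≤g 0)
  ≤v-convolution a≤f b≤g (suc n) = ≤v-+ (≤v-* (a≤f 0) (b≤g (suc n))) (≤v-convolution (a≤f ∘ suc) b≤g n)

  -- Leading terms modulo `σ` multiply without cancellation: in any other product `f i * g j` with
  -- `i + j = k + l`, either `i > k` or `j > l`, and that factor exceeds its minimum. The recursion
  -- removes the terms with `i < k` one at a time; at `k = 0` all remaining ones have `i > k`.
  gauss : ∀ {f g μ ω} k l → LastMinimum f μ k → LastMinimum g ω l →
          ∃[ z ] (convolution f g (k ℕ.+ l) ≈ f k * g l + z × μ ℤ.+ ω ℤ.+ + 1 ≤v z)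
  gauss zero zero fμ gω = 0# , sym (+-identityʳ _) , ≤v-0
  gauss {f} {g} {μ} {ω} zero (suc l) fμ gω = convolution (f ∘ suc) g l , refl ,
    ≤v-≡ (lemma μ ω) (≤v-convolution (λ i → LastMinimum.beyond fμ (suc i) (s≤s z≤n)) (LastMinimum.minimal gω) l)
    where
    lemma : ∀ μ ω → (μ ℤ.+ + 1) ℤ.+ ω ≡ μ ℤ.+ ω ℤ.+ + 1
    lemma = solve-∀
  gauss {f} {g} {μ} {ω} (suc k) l fμ gω =
    let z , eq , bound = gauss {f ∘ suc} {g} k l f∘sucμ gω in
    f 0 * g (suc (k ℕ.+ l)) + z , swap eq ,
    ≤v-+ (≤v-≡ (≡.sym (ℤ.+-assoc μ ω (+ 1))) (≤v-* (LastMinimum.minimal fμ 0) (LastMinimum.beyond gω (suc (k ℕ.+ l)) (s≤s (ℕ.m≤n+m l k))))) bound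
    where
    f∘sucμ : LastMinimum (f ∘ suc) μ k
    f∘sucμ = record
      { attained = LastMinimum.attained fμ ; minimal = LastMinimum.minimal fμ ∘ suc
      ; beyond = λ i k<i → LastMinimum.beyond fμ (suc i) (s≤s k<i) }

    swap : ∀ {w x y z} → x ≈ y + z → w + x ≈ y + (w + z)
    swap {w} {x} {y} {z} eq = begin
      w + x        ≈⟨ +-congˡ eq ⟩
      w + (y + z)  ≈⟨ +-assoc w y z ⟨
      w + y + z    ≈⟨ +-congʳ (+-comm w y) ⟩
      y + w + z    ≈⟨ +-assoc y w z ⟩
      y + (w + z)  ∎

  -- Gauss' lemma: scaled to minimal valuation 0, f and g have a product that is constant modulo σ,
  -- so over the residue skew field their degrees are zero.
  dominant-factor : ∀ f g → v (coefficient (f *ₚ g) 0) ≡ [ + 0 ] → (∀ k → + 1 ≤v coefficient (f *ₚ g) (suc k)) →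
                    Dominant f
  dominant-factor f g vfg≡0 1≤fg with lastMinimum f | lastMinimum g
  ... | inj₁ f≈0 | _ = contradiction (trans (coefficient-* f g 0) (trans (*-congʳ (f≈0 0)) (zeroˡ _))) (v≡⇒≉0 vfg≡0)
  ... | inj₂ _ | inj₁ g≈0 = contradiction (trans (coefficient-* f g 0) (trans (*-congˡ (g≈0 0)) (zeroʳ _))) (v≡⇒≉0 vfg≡0)
  ... | inj₂ (μ , k , fμ) | inj₂ (ω , l , gω) = constant-case k (ℕ.m+n≡0⇒m≡0 k k+l≡0) fμ
    where
    -- The constant coefficient of the product has valuation exactly 0, which bounds the sum of the
    -- two minima from above.
    μ+ω≤0 : μ ℤ.+ ω ℤ.≤ + 0
    μ+ω≤0 = v≡∧≤v⇒≤ vfg≡0 (≤v-cong (sym (coefficient-* f g 0))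
      (≤v-convolution {f = coefficient f} {coefficient g} (LastMinimum.minimal fμ) (LastMinimum.minimal gω) 0))

    -- By `gauss` the coefficient at `k + l` is a term of valuation `μ + ω ≤ 0` plus something
    -- strictly smaller in size. Since every coefficient except the constant one has valuation at
    -- least 1, this forces `k + l = 0`.
    low : ¬ (+ 1 ≤v coefficient (f *ₚ g) (k ℕ.+ l))
    low 1≤fg with gauss {coefficient f} {coefficient g} k l fμ gω
    ... | z , eq , bound = contradiction
      (v≡∧≤v⇒≤ (v-*≡ (LastMinimum.attained fμ) (LastMinimum.attained gω)) (≤v-cong product (≤v-+ (≤v-weaken μ+ω+1≤1 1≤fg) (≤v-neg bound))))
      (ℤ.<⇒≱ (ℤ.suc[i]≤j⇒i<j (ℤ.≤-reflexive (ℤ.+-comm (+ 1) (μ ℤ.+ ω)))))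
      where
      μ+ω+1≤1 : μ ℤ.+ ω ℤ.+ + 1 ℤ.≤ + 1
      μ+ω+1≤1 = ℤ.+-monoˡ-≤ (+ 1) μ+ω≤0

      product : coefficient (f *ₚ g) (k ℕ.+ l) - z ≈ coefficient f k * coefficient g l
      product = begin
        coefficient (f *ₚ g) (k ℕ.+ l) - z              ≈⟨ +-congʳ (trans (coefficient-* f g (k ℕ.+ l)) eq) ⟩
        coefficient f k * coefficient g l + z - z       ≈⟨ +-assoc _ z (- z) ⟩
        coefficient f k * coefficient g l + (z - z)     ≈⟨ +-congˡ (-‿inverseʳ z) ⟩
        coefficient f k * coefficient g l + 0#          ≈⟨ +-identityʳ _ ⟩
        coefficient f k * coefficient g l               ∎

    k+l≡0 : k ℕ.+ l ≡ 0
    k+l≡0 with k ℕ.+ l in eq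
    ... | zero  = ≡.refl
    ... | suc m = contradiction (≡.subst (λ i → + 1 ≤v coefficient (f *ₚ g) i) (≡.sym eq) (1≤fg m)) low

    constant-case : ∀ k → k ≡ 0 → LastMinimum (coefficient f) μ k → Dominant f
    constant-case .0 ≡.refl fμ = μ , LastMinimum.attained fμ , λ k → LastMinimum.beyond fμ (suc k) (s≤s z≤n)

  dominant⇒slopesPositive : ∀ {f} → Dominant f → AllSlopesPositive f
  dominant⇒slopesPositive {f} (μ , vf₀ , later) = v≡⇒≉0 vf₀ , positive
    where
    rising : ∀ {i j wᵢ wⱼ} → Edge f i j wᵢ wⱼ → wᵢ ℤ.< wⱼ
    rising {zero}  {suc j} {wᵢ} {wⱼ} e = ℤ.suc[i]≤j⇒i<j (≡.subst (ℤ._≤ wⱼ)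
      (≡.trans (ℤ.+-comm μ (+ 1)) (≡.cong (λ w → + 1 ℤ.+ w) ([]-injective (≡.trans (≡.sym vf₀) (Edge.left e)))))
      (v≡∧≤v⇒≤ (Edge.right e) (later j)))
    -- The line of an edge that starts at a positive index and does not rise has height at least
    -- `wᵢ ≥ μ + 1` over 0, so the point there would lie below it. With the denominator `p + 1`
    -- cleared, the sum of the three inequalities reads `p + 1 ≤ 0`.
    rising {suc i} {j} {wᵢ} {wⱼ} e = ℤ.≰⇒> λ wⱼ≤wᵢ → contradiction (drop wⱼ≤wᵢ) λ { (ℤ.+≤+ ()) }
      where
      p : ℕ
      p = j ℕ.∸ suc (suc i)

      j≡ : + j ≡ + suc i ℤ.+ (+ 1 ℤ.+ + p)
      j≡ = ≡.cong +_ (≡.sym (≡.trans (ℕ.+-suc (suc i) p) (ℕ.m+[n∸m]≡n (Edge.i<j e))))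

      μ+1≤wᵢ : μ ℤ.+ + 1 ℤ.≤ wᵢ
      μ+1≤wᵢ = v≡∧≤v⇒≤ (Edge.left e) (later i)

      below₀ : wᵢ ℤ.* (+ j ℤ.- + 0) ℤ.+ wⱼ ℤ.* (+ 0 ℤ.- + suc i) ℤ.≤ μ ℤ.* (+ j ℤ.- + suc i)
      below₀ = Edge.below e 0 μ vf₀

      0≤[wᵢ-μ-1][j-i] : + 0 ℤ.≤ (wᵢ ℤ.- (μ ℤ.+ + 1)) ℤ.* (+ suc p)
      0≤[wᵢ-μ-1][j-i] = ℤ.*-monoʳ-≤-nonNeg (+ suc p) (ℤ.i≤j⇒0≤j-i μ+1≤wᵢ)

      0≤[wᵢ-wⱼ]i : wⱼ ℤ.≤ wᵢ → + 0 ℤ.≤ (wᵢ ℤ.- wⱼ) ℤ.* (+ suc i)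
      0≤[wᵢ-wⱼ]i wⱼ≤wᵢ = ℤ.*-monoʳ-≤-nonNeg (+ suc i) (ℤ.i≤j⇒0≤j-i wⱼ≤wᵢ)

      lemma : ∀ wᵢ wⱼ μ i p j → j ≡ i ℤ.+ (+ 1 ℤ.+ p) →
              + 0 ℤ.- (+ 1 ℤ.+ p) ≡
              (μ ℤ.* (j ℤ.- i) ℤ.+ ((wᵢ ℤ.- (μ ℤ.+ + 1)) ℤ.* (+ 1 ℤ.+ p) ℤ.+ (wᵢ ℤ.- wⱼ) ℤ.* i)) ℤ.-
              ((wᵢ ℤ.* (j ℤ.- + 0) ℤ.+ wⱼ ℤ.* (+ 0 ℤ.- i)) ℤ.+ (+ 0 ℤ.+ + 0))
      lemma wᵢ wⱼ μ i p _ ≡.refl = identity wᵢ wⱼ μ i p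
        where
        identity : ∀ wᵢ wⱼ μ i p →
                   + 0 ℤ.- (+ 1 ℤ.+ p) ≡
                   (μ ℤ.* (i ℤ.+ (+ 1 ℤ.+ p) ℤ.- i) ℤ.+ ((wᵢ ℤ.- (μ ℤ.+ + 1)) ℤ.* (+ 1 ℤ.+ p) ℤ.+ (wᵢ ℤ.- wⱼ) ℤ.* i)) ℤ.-
                   ((wᵢ ℤ.* (i ℤ.+ (+ 1 ℤ.+ p) ℤ.- + 0) ℤ.+ wⱼ ℤ.* (+ 0 ℤ.- i)) ℤ.+ (+ 0 ℤ.+ + 0))
        identity = solve-∀

      drop : wⱼ ℤ.≤ wᵢ → + suc p ℤ.≤ + 0
      drop wⱼ≤wᵢ = ≤-via (ℤ.+-mono-≤ below₀ (ℤ.+-mono-≤ 0≤[wᵢ-μ-1][j-i] (0≤[wᵢ-wⱼ]i wⱼ≤wᵢ)))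
        (lemma wᵢ wⱼ μ (+ suc i) (+ p) (+ j) j≡)

    positive : ∀ {i j wᵢ wⱼ} (e : Edge f i j wᵢ wⱼ) → ℚ.0ℚ ℚ.< Edge.slope e
    positive {i} {j} {wᵢ} {wⱼ} e = 0<⇒0</ (wⱼ ℤ.- wᵢ) (j ℕ.∸ i) {{ℕ.>-nonZero (ℕ.m<n⇒0<n∸m (Edge.i<j e))}}
      (<-via (rising e) (lemma wᵢ wⱼ))
      where
      lemma : ∀ wᵢ wⱼ → wⱼ ℤ.- wᵢ ℤ.- + 0 ≡ wⱼ ℤ.- wᵢ
      lemma = solve-∀

  -- `S` scores a point by its index and valuation; it is left arbitrary so that the recursion can
  -- shift the index. When it is the slope seen from the point over 0, the last least point is the
  -- right end of the first edge.
  record LastLeast (S : ℕ → ℤ → ℚᵘ) (g : Polynomial) (j : ℕ) (w : ℤ) : Set where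
    field
      attained : v (coefficient g j) ≡ [ w ]
      least    : ∀ i u → v (coefficient g i) ≡ [ u ] → S j w ℚᵘ.≤ S i u
      beyond   : ∀ i u → v (coefficient g i) ≡ [ u ] → j < i → S j w ℚᵘ.< S i u

  lastLeast : ∀ S g → (∀ i → coefficient g i ≈ 0#) ⊎ ∃[ j ] ∃[ w ] LastLeast S g j w
  lastLeast S []      = inj₁ λ _ → refl
  lastLeast S (a ∷ g) with lastLeast (S ∘ suc) g | ≈0? a
  ... | inj₁ g≈0 | yes a≈0 = inj₁ λ { zero → a≈0 ; (suc i) → g≈0 i }
  ... | inj₁ g≈0 | no  a≉0 with v-finite a≉0
  ...   | α , va = inj₂ (0 , α , record
    { attained = va
    ; least = λ { zero u vu → ℚᵘ.≤-reflexive (ℚᵘ.≃-reflexive (≡.cong (S 0) ([]-injective (≡.trans (≡.sym va) vu))))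
                ; (suc i) u vu → contradiction (g≈0 i) (v≡⇒≉0 vu) }
    ; beyond = λ { (suc i) u vu _ → contradiction (g≈0 i) (v≡⇒≉0 vu) } })
  lastLeast S (a ∷ g) | inj₂ (j , w , gw) | yes a≈0 = inj₂ (suc j , w , record
    { attained = LastLeast.attained gw
    ; least = λ { zero u vu → contradiction a≈0 (v≡⇒≉0 vu) ; (suc i) u vu → LastLeast.least gw i u vu }
    ; beyond = λ { (suc i) u vu (s≤s j<i) → LastLeast.beyond gw i u vu j<i } })
  lastLeast S (a ∷ g) | inj₂ (j , w , gw) | no a≉0 with v-finite a≉0
  ... | α , va with S 0 α ℚᵘ.<? S (suc j) w
  ...   | yes lt = inj₂ (0 , α , record
    { attained = va
    ; least = λ { zero u vu → ℚᵘ.≤-reflexive (ℚᵘ.≃-reflexive (≡.cong (S 0) ([]-injective (≡.trans (≡.sym va) vu))))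
                ; (suc i) u vu → ℚᵘ.<⇒≤ (ℚᵘ.<-≤-trans lt (LastLeast.least gw i u vu)) }
    ; beyond = λ { (suc i) u vu _ → ℚᵘ.<-≤-trans lt (LastLeast.least gw i u vu) } })
  ...   | no ≮ = inj₂ (suc j , w , record
    { attained = LastLeast.attained gw
    ; least = λ { zero u vu → ≡.subst (λ u → S (suc j) w ℚᵘ.≤ S 0 u) ([]-injective (≡.trans (≡.sym va) vu)) (ℚᵘ.≮⇒≥ ≮)
                ; (suc i) u vu → LastLeast.least gw i u vu }
    ; beyond = λ { (suc i) u vu (s≤s j<i) → LastLeast.beyond gw i u vu j<i } })

  slopesPositive⇒dominant : ∀ f → AllSlopesPositive f → Dominant f
  slopesPositive⇒dominant []       (f₀≉0 , _) = contradiction refl f₀≉0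
  slopesPositive⇒dominant (a₀ ∷ g) (a₀≉0 , positive) with v-finite a₀≉0
  -- `g` has lost the constant coefficient, so its index `i` stands for the abscissa `i + 1`, which
  -- is also the denominator that `mkℚᵘ _ i` encodes.
  ... | w₀ , va₀ with lastLeast (λ i w → mkℚᵘ (w ℤ.- w₀) i) g
  ...   | inj₁ g≈0 = w₀ , va₀ , λ k → ≤v-≈0 (g≈0 k)
  ...   | inj₂ (j , wⱼ , gw) = w₀ , va₀ , later
    where
    J : ℤ
    J = + suc j

    least : ∀ k w → v (coefficient g k) ≡ [ w ] → (wⱼ ℤ.- w₀) ℤ.* + suc k ℤ.≤ (w ℤ.- w₀) ℤ.* J
    least k w vw = ℚᵘ.drop-*≤* (LastLeast.least gw k w vw)

    below : ∀ k w → v (coefficient (a₀ ∷ g) k) ≡ [ w ] →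
            w₀ ℤ.* (J ℤ.- + k) ℤ.+ wⱼ ℤ.* (+ k ℤ.- + 0) ℤ.≤ w ℤ.* (J ℤ.- + 0)
    below zero    w vw = ℤ.≤-reflexive (≡.trans (lemma w₀ wⱼ J) (≡.cong (ℤ._* (J ℤ.- + 0)) ([]-injective (≡.trans (≡.sym va₀) vw))))
      where
      lemma : ∀ w₀ wⱼ J → w₀ ℤ.* (J ℤ.- + 0) ℤ.+ wⱼ ℤ.* (+ 0 ℤ.- + 0) ≡ w₀ ℤ.* (J ℤ.- + 0)
      lemma = solve-∀
    below (suc k) w vw = ≤-via (least k w vw) (lemma w₀ wⱼ w J (+ suc k))
      where
      lemma : ∀ w₀ wⱼ w J K → w ℤ.* (J ℤ.- + 0) ℤ.- (w₀ ℤ.* (J ℤ.- K) ℤ.+ wⱼ ℤ.* (K ℤ.- + 0)) ≡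
                              (w ℤ.- w₀) ℤ.* J ℤ.- (wⱼ ℤ.- w₀) ℤ.* K
      lemma = solve-∀

    maximal : ∀ k w → v (coefficient (a₀ ∷ g) k) ≡ [ w ] →
              w₀ ℤ.* (J ℤ.- + k) ℤ.+ wⱼ ℤ.* (+ k ℤ.- + 0) ≡ w ℤ.* (J ℤ.- + 0) → 0 ≤ k × k ≤ suc j
    maximal zero    w vw _  = z≤n , z≤n
    maximal (suc k) w vw eq = z≤n , ℕ.≮⇒≥ λ { (s≤s j<k) →
      ℤ.<⇒≢ (ℚᵘ.drop-*<* (LastLeast.beyond gw k w vw j<k)) (≡-via eq (lemma w₀ wⱼ w J (+ suc k))) }
      where
      lemma : ∀ w₀ wⱼ w J K → (w ℤ.- w₀) ℤ.* J ℤ.- (wⱼ ℤ.- w₀) ℤ.* K ≡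
                              w ℤ.* (J ℤ.- + 0) ℤ.- (w₀ ℤ.* (J ℤ.- K) ℤ.+ wⱼ ℤ.* (K ℤ.- + 0))
      lemma = solve-∀

    -- Leastness of the slope leaves no point below the line; choosing the last among the ties makes
    -- the edge maximal, as `Edge` demands.
    edge : Edge (a₀ ∷ g) 0 (suc j) w₀ wⱼ
    edge = record { i<j = s≤s z≤n ; left = va₀ ; right = LastLeast.attained gw ; below = below ; maximal = maximal }

    0<wⱼ-w₀ : + 0 ℤ.< wⱼ ℤ.- w₀
    0<wⱼ-w₀ = 0</⇒0< (wⱼ ℤ.- w₀) (suc j) (positive edge)

    later : ∀ k → w₀ ℤ.+ + 1 ≤v coefficient g k
    later k with ≈0? (coefficient g k)
    ... | yes gk≈0 = ≤v-≈0 gk≈0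
    ... | no  gk≉0 with v-finite gk≉0
    ...   | w , vw = ≤v-weaken (≤-via (ℤ.i<j⇒suc[i]≤j 0<w-w₀) (lemma w₀ w)) (≡⇒≤v vw)
      where
      lemma : ∀ w₀ w → w ℤ.- (w₀ ℤ.+ + 1) ≡ (w ℤ.- w₀) ℤ.- (+ 1 ℤ.+ + 0)
      lemma = solve-∀

      -- The slope from the point over 0 to any other point is at least that of the first edge,
      -- hence positive.
      0<w-w₀ : + 0 ℤ.< w ℤ.- w₀
      0<w-w₀ = ℤ.*-cancelʳ-<-nonNeg J (ℤ.<-≤-trans (ℤ.*-monoʳ-<-pos (+ suc k) 0<wⱼ-w₀) (least k w vw))

-- Sequences form a right module over R[t], with t acting as the shift.

module SequenceModule {c ℓ : Level} (R : Ring c ℓ) where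

  open Ring R hiding (zero)
  open Polynomials rawRing using (Polynomial; constant; t; _≈ₚ_; _+ₚ_; _*ₚ_) renaming (rawRing to polynomialRawRing)
  open PolynomialRing R using (polynomialRing)
  open SumProperties semiring using (sum; sum-cong-≋; ∑-comm)
  open MatrixProperties R using (sum-single)
  open Summation (RawRing.+-rawMonoid polynomialRawRing) using () renaming (sum to sumₚ)
  open Matrices polynomialRawRing using () renaming (1ₘ to 1ₚ; _*ₘ_ to _*ₚₘ_; _≋_ to _≋ₚ_)
  open MatrixProperties polynomialRing using () renaming (1ₘ-diagonal to 1ₚ-diagonal; 1ₘ-off to 1ₚ-off)
  open import Relation.Binary.Reasoning.Setoid setoid

  private
    interchange : ∀ w x y z → (w + x) + (y + z) ≈ (w + y) + (x + z)
    interchange = CommutativeSemigroupProperties.interchange +-commutativeSemigroup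

  Sequence : Set c
  Sequence = ℕ → Carrier

  infixl 7 _◁_

  -- The entry at `k` is the sum of `w (k + i) * aᵢ`. The shift commutes with multiplication by
  -- scalars on the right, and this makes the formula an action of polynomials in a central
  -- indeterminate.
  _◁_ : Sequence → Polynomial → Sequence
  (w ◁ [])      k = 0#
  (w ◁ (a ∷ f)) k = w k * a + (w ∘ suc ◁ f) k

  ◁-congˡ : ∀ {w w′} f → (∀ k → w k ≈ w′ k) → ∀ k → (w ◁ f) k ≈ (w′ ◁ f) k
  ◁-congˡ []      w≈w′ k = refl
  ◁-congˡ (a ∷ f) w≈w′ k = +-cong (*-congʳ (w≈w′ k)) (◁-congˡ f (w≈w′ ∘ suc) k)

  ◁-zeroʳ : ∀ w f → f ≈ₚ [] → ∀ k → (w ◁ f) k ≈ 0#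
  ◁-zeroʳ w []      f≈0 k = refl
  ◁-zeroʳ w (a ∷ f) f≈0 k =
    trans (+-cong (trans (*-congˡ (f≈0 0)) (zeroʳ _)) (◁-zeroʳ (w ∘ suc) f (f≈0 ∘ suc) k)) (+-identityˡ 0#)

  ◁-zeroˡ : ∀ {w} f → (∀ k → w k ≈ 0#) → ∀ k → (w ◁ f) k ≈ 0#
  ◁-zeroˡ []      w≈0 k = refl
  ◁-zeroˡ (a ∷ f) w≈0 k =
    trans (+-cong (trans (*-congʳ (w≈0 k)) (zeroˡ _)) (◁-zeroˡ f (w≈0 ∘ suc) k)) (+-identityˡ 0#)

  ◁-congʳ : ∀ w f g → f ≈ₚ g → ∀ k → (w ◁ f) k ≈ (w ◁ g) k
  ◁-congʳ w []      g       f≈g k = sym (◁-zeroʳ w g (sym ∘ f≈g) k)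
  ◁-congʳ w (a ∷ f) []      f≈g k = ◁-zeroʳ w (a ∷ f) f≈g k
  ◁-congʳ w (a ∷ f) (b ∷ g) f≈g k = +-cong (*-congˡ (f≈g 0)) (◁-congʳ (w ∘ suc) f g (f≈g ∘ suc) k)

  ◁-distribˡ : ∀ w f g k → (w ◁ (f +ₚ g)) k ≈ (w ◁ f) k + (w ◁ g) k
  ◁-distribˡ w []      g       k = sym (+-identityˡ _)
  ◁-distribˡ w (a ∷ f) []      k = sym (+-identityʳ _)
  ◁-distribˡ w (a ∷ f) (b ∷ g) k =
    trans (+-cong (distribˡ _ _ _) (◁-distribˡ (w ∘ suc) f g k)) (interchange _ _ _ _)

  ◁-distribʳ : ∀ f w w′ k → ((λ k → w k + w′ k) ◁ f) k ≈ (w ◁ f) k + (w′ ◁ f) k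
  ◁-distribʳ []      w w′ k = sym (+-identityˡ _)
  ◁-distribʳ (a ∷ f) w w′ k =
    trans (+-cong (distribʳ _ _ _) (◁-distribʳ f (w ∘ suc) (w′ ∘ suc) k)) (interchange _ _ _ _)

  ◁-scale : ∀ w a f k → ((λ k → w k * a) ◁ f) k ≈ (w ◁ List.map (a *_) f) k
  ◁-scale w a []      k = refl
  ◁-scale w a (b ∷ f) k = +-cong (*-assoc _ _ _) (◁-scale (w ∘ suc) a f k)

  ◁-assoc : ∀ w f g k → (w ◁ f ◁ g) k ≈ (w ◁ (f *ₚ g)) k
  ◁-assoc w []      g k = ◁-zeroˡ g (λ _ → refl) k
  ◁-assoc w (a ∷ f) g k = begin
    ((λ k → w k * a + (w ∘ suc ◁ f) k) ◁ g) k             ≈⟨ ◁-distribʳ g (λ k → w k * a) (w ∘ suc ◁ f) k ⟩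
    ((λ k → w k * a) ◁ g) k + (w ∘ suc ◁ f ◁ g) k         ≈⟨ +-cong (◁-scale w a g k) (◁-assoc (w ∘ suc) f g k) ⟩
    (w ◁ List.map (a *_) g) k + (w ∘ suc ◁ (f *ₚ g)) k    ≈⟨ +-congˡ (trans (+-congʳ (zeroʳ _)) (+-identityˡ _)) ⟨
    (w ◁ List.map (a *_) g) k + (w ◁ (0# ∷ (f *ₚ g))) k   ≈⟨ ◁-distribˡ w (List.map (a *_) g) (0# ∷ (f *ₚ g)) k ⟨
    (w ◁ ((a ∷ f) *ₚ g)) k                                ∎

  ◁-sumʳ : ∀ {n} w (f : Fin n → Polynomial) k → (w ◁ sumₚ f) k ≈ sum (λ i → (w ◁ f i) k)
  ◁-sumʳ {zero}  w f k = refl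
  ◁-sumʳ {suc n} w f k = trans (◁-distribˡ w (f zero) (sumₚ (f ∘ suc)) k) (+-congˡ (◁-sumʳ w (f ∘ suc) k))

  ◁-sumˡ : ∀ {n} (w : Fin n → Sequence) f k → ((λ k → sum (λ i → w i k)) ◁ f) k ≈ sum (λ i → (w i ◁ f) k)
  ◁-sumˡ {zero}  w f k = ◁-zeroˡ f (λ _ → refl) k
  ◁-sumˡ {suc n} w f k =
    trans (◁-distribʳ f (w zero) (λ k → sum (λ i → w (suc i) k)) k) (+-congˡ (◁-sumˡ (w ∘ suc) f k))

  infixl 7 _⊙_

  _⊙_ : ∀ {m n} → (Fin m → Sequence) → Matrix polynomialRawRing m n → Fin n → Sequence
  (w ⊙ A) j k = sum (λ i → (w i ◁ A i j) k)

  ⊙-congʳ : ∀ {m n} (w : Fin m → Sequence) (A B : Matrix polynomialRawRing m n) →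
            A ≋ₚ B → ∀ j k → (w ⊙ A) j k ≈ (w ⊙ B) j k
  ⊙-congʳ w A B A≋B j k = sum-cong-≋ (λ i → ◁-congʳ (w i) (A i j) (B i j) (A≋B i j) k)

  ⊙-assoc : ∀ {m n p} w (A : Matrix polynomialRawRing m n) (B : Matrix polynomialRawRing n p) →
            ∀ l k → (w ⊙ A ⊙ B) l k ≈ (w ⊙ (A *ₚₘ B)) l k
  ⊙-assoc w A B l k = begin
    sum (λ j → ((λ k → sum (λ i → (w i ◁ A i j) k)) ◁ B j l) k)  ≈⟨ sum-cong-≋ (λ j → ◁-sumˡ (λ i → w i ◁ A i j) (B j l) k) ⟩
    sum (λ j → sum (λ i → (w i ◁ A i j ◁ B j l) k))              ≈⟨ ∑-comm (λ j i → (w i ◁ A i j ◁ B j l) k) ⟩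
    sum (λ i → sum (λ j → (w i ◁ A i j ◁ B j l) k))              ≈⟨ sum-cong-≋ (λ i → sum-cong-≋ (λ j → ◁-assoc (w i) (A i j) (B j l) k)) ⟩
    sum (λ i → sum (λ j → (w i ◁ (A i j *ₚ B j l)) k))           ≈⟨ sum-cong-≋ (λ i → ◁-sumʳ (w i) (λ j → A i j *ₚ B j l) k) ⟨
    sum (λ i → (w i ◁ sumₚ (λ j → A i j *ₚ B j l)) k)            ∎

  ⊙-identity : ∀ {m} (w : Fin m → Sequence) j k → (w ⊙ 1ₚ) j k ≈ w j k
  ⊙-identity w j k = begin
    sum (λ i → (w i ◁ 1ₚ i j) k)   ≈⟨ sum-single j (λ i i≢j → ◁-zeroʳ (w i) (1ₚ i j) (1ₚ-off i≢j) k) ⟩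
    (w j ◁ 1ₚ j j) k               ≈⟨ ◁-congʳ (w j) (1ₚ j j) (constant 1#) (1ₚ-diagonal j) k ⟩
    w j k * 1# + 0#                ≈⟨ trans (+-identityʳ _) (*-identityʳ _) ⟩
    w j k                          ∎

  ◁-t : ∀ w k → (w ◁ t) k ≈ w (suc k)
  ◁-t w k = trans (+-cong (zeroʳ _) (trans (+-identityʳ _) (*-identityʳ _))) (+-identityˡ _)

-- The sum of the individual bounds serves in place of their maximum.
uniform : ∀ {p n} (P : Fin n → ℕ → Set p) → (∀ i {k l} → k ≤ l → P i k → P i l) →
          (∀ i → ∃[ k ] P i k) → ∃[ k ] ∀ i → P i k
uniform {n = zero}  P mono bound = 0 , λ ()
uniform {n = suc n} P mono bound =
  let k , P₀k = bound zero
      l , Pl  = uniform (P ∘ suc) (mono ∘ suc) (bound ∘ suc)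
  in k ℕ.+ l , λ { zero → mono zero (ℕ.m≤m+n k l) P₀k ; (suc i) → mono (suc i) (ℕ.m≤n+m l k) (Pl i) }

-- Divisibility of the last invariant factor by the others.

module LastDivisor {c ℓ : Level} (R : Ring c ℓ) where

  open Ring R using (sym; trans)
  open PolynomialRing R using (polynomialRing)
  open Polynomials (Ring.rawRing R) using (Polynomial; _∣ˡ_; _∣ʳ_)
  open Divisibility (RawRing.*-rawMagma (Ring.rawRing polynomialRing)) using (_,_)
  private module P = Ring polynomialRing

  ∣ˡ-refl : ∀ {f} → f ∣ˡ f
  ∣ˡ-refl {f} = P.1# , P.*-identityʳ f

  ∣ˡ-trans : ∀ {f g h} → f ∣ˡ g → g ∣ˡ h → f ∣ˡ h
  ∣ˡ-trans {f} {g} {h} (q , fq≈g) (q′ , gq′≈h) =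
    q P.* q′ , λ i → trans (sym (P.*-assoc f q q′ i)) (trans (P.*-congʳ {q′} {f P.* q} {g} fq≈g i) (gq′≈h i))

  -- Left divisibility, `λᵢ * q = λ`, is the form that suits a right action: a sequence annihilated
  -- by `λᵢ` is annihilated by `λᵢ * q`.
  nth-∣ˡ-last : ∀ {n} (λs : Vec Polynomial (suc n)) → VecLinked.Linked (λ f g → f ∣ˡ g × f ∣ʳ g) λs →
                ∀ (i : Fin (suc n)) → nth (Ring.rawRing polynomialRing) (Vec.toList λs) (toℕ i) ∣ˡ Vec.last λs
  nth-∣ˡ-last (f ∷ [])     linked               zero    = ∣ˡ-refl {f}
  nth-∣ˡ-last (f ∷ g ∷ λs) (f∣g VecLinked.∷ link)  zero    =
    ∣ˡ-trans {f} {g} {Vec.last (g ∷ λs)} (proj₁ f∣g) (nth-∣ˡ-last (g ∷ λs) link zero)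
  nth-∣ˡ-last (f ∷ g ∷ λs) (_ VecLinked.∷ link) (suc i) = nth-∣ˡ-last (g ∷ λs) link i

  nth-last : ∀ {n} (λs : Vec Polynomial (suc n)) → nth (Ring.rawRing polynomialRing) (Vec.toList λs) n ≡ Vec.last λs
  nth-last (f ∷ [])     = ≡.refl
  nth-last (f ∷ g ∷ λs) = nth-last (g ∷ λs)

-- From positive slopes to a contracting power of `D`.

module Slopes {c ℓ : Level} (𝓛 : CompleteDiscretelyValuedSkewField c ℓ) where

  open CompleteDiscretelyValuedSkewField 𝓛 hiding (zero; _^_)
  open Valuation 𝓛 using (PowersBoundedBelow; LeastExponent; leastExponent)
  open ValuationProperties 𝓛
  open Rank 𝓛 using (≤ₘ-cong; ≤ₘ-*)
  open PowerRanks 𝓛 using (RowContraction)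
  open Newton 𝓛
  open Polynomials rawRing using (Polynomial; coefficient; t; _+ₚ_; _*ₚ_; characteristic; InvariantFactors) renaming (rawRing to polynomialRawRing)
  open PolynomialRing ring
  open LastDivisor ring
  open SequenceModule ring
  open Matrices rawRing
  open MatrixProperties ring using (≋-sym; ≋-trans; *ₘ-congˡ; *ₘ-assoc; *ₘ-identityʳ; ^ₘ-+; ^ₘ-sucʳ; sum-single; sum-zero)
  open SumProperties semiring using (sum-cong-≋; ∑-distrib-+; *-distribˡ-sum)
  open RingProperties ring using (-‿distribʳ-*; -1*x≈-x)
  open import Relation.Binary.Reasoning.Setoid setoid

  private
    module P  = Ring polynomialRing
    module Pₘ where
      open Matrices polynomialRawRing public
      open MatrixProperties polynomialRing public

  Matₚ : ℕ → ℕ → Set c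
  Matₚ = Matrix polynomialRawRing

  infix 4 _≤ₚ_

  _≤ₚ_ : ℤ → Polynomial → Set
  a ≤ₚ f = ∀ i → a ≤v coefficient f i

  ≤ₚ-* : ∀ {a b} f g → a ≤ₚ f → b ≤ₚ g → a ℤ.+ b ≤ₚ f *ₚ g
  ≤ₚ-* f g a≤f b≤g i = ≤v-cong (sym (coefficient-* f g i)) (≤v-convolution a≤f b≤g i)

  ≤ₚ-+ : ∀ {a} f g → a ≤ₚ f → a ≤ₚ g → a ≤ₚ f +ₚ g
  ≤ₚ-+ f g a≤f a≤g i = ≤v-cong (sym (coefficient-+ f g i)) (≤v-+ (a≤f i) (a≤g i))

  ≤ₚ-*ₘ : ∀ {a b m n p} (A : Matₚ m n) (B : Matₚ n p) → (∀ i j → a ≤ₚ A i j) → (∀ i j → b ≤ₚ B i j) →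
          ∀ i j → a ℤ.+ b ≤ₚ (A Pₘ.*ₘ B) i j
  ≤ₚ-*ₘ {a} {b} {n = n} A B a≤A b≤B i j = ≤ₚ-sum (λ k → A i k *ₚ B k j) (λ k → ≤ₚ-* (A i k) (B k j) (a≤A i k) (b≤B k j))
    where
    open Summation (RawRing.+-rawMonoid polynomialRawRing) using () renaming (sum to sumₚ)
    ≤ₚ-sum : ∀ {e n} (f : Fin n → Polynomial) → (∀ k → e ≤ₚ f k) → e ≤ₚ sumₚ f
    ≤ₚ-sum {n = zero}  f e≤f _ = ≤v-0
    ≤ₚ-sum {n = suc n} f e≤f   = ≤ₚ-+ (f zero) (sumₚ (f ∘ suc)) (e≤f zero) (≤ₚ-sum (f ∘ suc) (e≤f ∘ suc))

  -- One number controls both effects of acting with `f` on a sequence: fewer than `p` places ahead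
  -- are read, and valuations drop by at most `p`.
  Bounded : Polynomial → ℕ → Set
  Bounded f p = length f ≤ p × ℤ.- (+ p) ≤ₚ f

  bounded-mono : ∀ f {p q} → p ≤ q → Bounded f p → Bounded f q
  bounded-mono f p≤q (len , low) = ℕ.≤-trans len p≤q , λ i → ≤v-weaken (ℤ.neg-mono-≤ (ℤ.+≤+ p≤q)) (low i)

  bounded : ∀ f → ∃[ p ] Bounded f p
  bounded []      = 0 , z≤n , λ _ → ≤v-0
  bounded (a ∷ f) =
    let p , len , low = bounded f
        q , -q≤a      = ≤v-lower a
    in suc (p ℕ.+ q) , s≤s (ℕ.≤-trans len (ℕ.m≤m+n p q)) , λ
      { zero    → ≤v-weaken (ℤ.neg-mono-≤ (ℤ.+≤+ (ℕ.m≤n⇒m≤1+n (ℕ.m≤n+m q p)))) -q≤a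
      ; (suc i) → ≤v-weaken (ℤ.neg-mono-≤ (ℤ.+≤+ (ℕ.m≤n⇒m≤1+n (ℕ.m≤m+n p q)))) (low i) }

  boundedₘ : ∀ {m n} (A : Matₚ m n) → ∃[ p ] ∀ i j → Bounded (A i j) p
  boundedₘ A = uniform (λ i p → ∀ j → Bounded (A i j) p) (λ i p≤q b j → bounded-mono (A i j) p≤q (b j))
    λ i → uniform (λ j → Bounded (A i j)) (λ j → bounded-mono (A i j)) (λ j → bounded (A i j))

  ≤v-◁ : ∀ {a b j} w f → (∀ k → k < length f → a ≤v w (j ℕ.+ k)) → b ≤ₚ f → a ℤ.+ b ≤v (w ◁ f) j
  ≤v-◁ w []      a≤w b≤f = ≤v-0
  ≤v-◁ {a} {j = j} w (x ∷ f) a≤w b≤f = ≤v-+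
    (≤v-* (≡.subst (λ k → a ≤v w k) (ℕ.+-identityʳ j) (a≤w 0 (s≤s z≤n))) (b≤f 0))
    (≤v-◁ (w ∘ suc) f (λ k k<f → ≡.subst (λ k → a ≤v w k) (ℕ.+-suc j k) (a≤w (suc k) (s≤s k<f))) (b≤f ∘ suc))

  -- The relation expresses `u j * x`, where `x` is the constant coefficient of valuation `μ`, by
  -- later entries times coefficients of valuation at least `μ + 1`; cancelling `x` gains one.
  dominant-contracts : ∀ u f → Dominant f → (∀ j → (u ◁ f) j ≈ 0#) → ∀ {a} j →
                       (∀ (k : Fin (length f)) → a ≤v u (j ℕ.+ suc (toℕ k))) → a ℤ.+ + 1 ≤v u j
  dominant-contracts u []      (μ , v0≡μ , _)  _     _     _   = contradiction refl (v≡⇒≉0 v0≡μ)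
  dominant-contracts u (x ∷ f) (μ , vx≡μ , μ<) uf≈0 {a} j a≤u = ≤v-cancelʳ vx≡μ (≤v-≡ (lemma a μ)
    (≤v-cong opposite (≤v-neg (≤v-◁ {a} {μ ℤ.+ + 1} (u ∘ suc) f next μ<))))
    where
    lemma : ∀ a μ → a ℤ.+ (μ ℤ.+ + 1) ≡ a ℤ.+ + 1 ℤ.+ μ
    lemma = solve-∀

    next : ∀ k → k < length f → a ≤v u (suc (j ℕ.+ k))
    next k k<f = ≡.subst (λ k → a ≤v u k)
      (≡.trans (≡.cong (λ k → j ℕ.+ suc k) (Fin.toℕ-fromℕ< (ℕ.m<n⇒m<1+n k<f))) (ℕ.+-suc j k))
      (a≤u (fromℕ< (ℕ.m<n⇒m<1+n k<f)))

    opposite : - (u ∘ suc ◁ f) j ≈ u j * x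
    opposite = begin
      - (u ∘ suc ◁ f) j                                   ≈⟨ +-identityˡ _ ⟨
      0# - (u ∘ suc ◁ f) j                                ≈⟨ +-congʳ (uf≈0 j) ⟨
      u j * x + (u ∘ suc ◁ f) j - (u ∘ suc ◁ f) j         ≈⟨ +-assoc _ _ _ ⟩
      u j * x + ((u ∘ suc ◁ f) j - (u ∘ suc ◁ f) j)       ≈⟨ +-congˡ (-‿inverseʳ _) ⟩
      u j * x + 0#                                        ≈⟨ +-identityʳ _ ⟩
      u j * x                                             ∎

  module _ {d-1 : ℕ} (D : Mat (suc d-1) (suc d-1)) (λs : Vec Polynomial (suc d-1)) (I : InvariantFactors D λs) where

    private
      d = suc d-1

      λ-last : Polynomial
      λ-last = Vec.last λs

      T Λ : Matₚ d d
      T = characteristic D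
      Λ = Pₘ.diagonal (Vec.toList λs)

    open Pₘ.Equivalent (Pₘ.⇝⇒equivalent (InvariantFactors.reduces I))

    module _ (Y : Mat 1 d) where

      powers : Fin d → Sequence
      powers l k = (Y *ₘ D ^ₘ k) zero l

      -- On this row of sequences the shift agrees with right multiplication by `D`, because
      -- `D ^ₘ suc k` is `D ^ₘ k *ₘ D`.
      powers-T : ∀ j k → (powers ⊙ T) j k ≈ 0#
      powers-T j k = begin
        sum (λ i → (powers i ◁ T i j) k)
          ≈⟨ sum-cong-≋ (λ i → ◁-distribˡ (powers i) (t *ₚ Pₘ.1ₘ i j) (- D i j ∷ []) k) ⟩
        sum (λ i → (powers i ◁ (t *ₚ Pₘ.1ₘ i j)) k + (powers i k * - D i j + 0#))
          ≈⟨ ∑-distrib-+ (λ i → (powers i ◁ (t *ₚ Pₘ.1ₘ i j)) k) (λ i → powers i k * - D i j + 0#) ⟩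
        sum (λ i → (powers i ◁ (t *ₚ Pₘ.1ₘ i j)) k) + sum (λ i → powers i k * - D i j + 0#)
          ≈⟨ +-cong shifted (sum-cong-≋ (λ i → trans (+-identityʳ _) (trans (sym (-‿distribʳ-* (powers i k) (D i j))) (sym (-1*x≈-x (powers i k * D i j)))))) ⟩
        powers j (suc k) + sum (λ i → - 1# * (powers i k * D i j))
          ≈⟨ +-congˡ (*-distribˡ-sum (- 1#) (λ i → powers i k * D i j)) ⟨
        powers j (suc k) + - 1# * ((Y *ₘ D ^ₘ k) *ₘ D) zero j
          ≈⟨ +-congˡ (-1*x≈-x _) ⟩
        powers j (suc k) - ((Y *ₘ D ^ₘ k) *ₘ D) zero j
          ≈⟨ +-congʳ (trans (*ₘ-congˡ Y (^ₘ-sucʳ D k) zero j) (sym (*ₘ-assoc Y (D ^ₘ k) D zero j))) ⟩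
        ((Y *ₘ D ^ₘ k) *ₘ D) zero j - ((Y *ₘ D ^ₘ k) *ₘ D) zero j
          ≈⟨ -‿inverseʳ _ ⟩
        0# ∎
        where
        shifted : sum (λ i → (powers i ◁ (t *ₚ Pₘ.1ₘ i j)) k) ≈ powers j (suc k)
        shifted = begin
          sum (λ i → (powers i ◁ (t *ₚ Pₘ.1ₘ i j)) k)
            ≈⟨ sum-single j (λ i i≢j → ◁-zeroʳ (powers i) (t *ₚ Pₘ.1ₘ i j) (λ l → trans (P.*-congˡ {t} {Pₘ.1ₘ i j} {[]} (Pₘ.1ₘ-off i≢j) l) (P.zeroʳ t l)) k) ⟩
          (powers j ◁ (t *ₚ Pₘ.1ₘ j j)) k
            ≈⟨ ◁-congʳ (powers j) (t *ₚ Pₘ.1ₘ j j) t (λ l → trans (P.*-congˡ {t} {Pₘ.1ₘ j j} {P.1#} (Pₘ.1ₘ-diagonal j) l) (P.*-identityʳ t l)) k ⟩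
          (powers j ◁ t) k
            ≈⟨ ◁-t (powers j) k ⟩
          powers j (suc k) ∎

      -- In these coordinates the matrix recurrence splits into one scalar recurrence for each
      -- invariant factor.
      coordinates : Fin d → Sequence
      coordinates = powers ⊙ P⁻¹

      powers≈coordinates⊙P : ∀ l k → powers l k ≈ (coordinates ⊙ P) l k
      powers≈coordinates⊙P l k = begin
        powers l k                       ≈⟨ ⊙-identity powers l k ⟨
        (powers ⊙ Pₘ.1ₘ) l k             ≈⟨ ⊙-congʳ powers (P⁻¹ Pₘ.*ₘ P) Pₘ.1ₘ P⁻¹P l k ⟨
        (powers ⊙ (P⁻¹ Pₘ.*ₘ P)) l k     ≈⟨ ⊙-assoc powers P⁻¹ P l k ⟨
        (coordinates ⊙ P) l k            ∎

      -- `P⁻¹ Λ = T Q`, and `T` already annihilates the row of powers.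
      coordinates-Λ : ∀ j k → (coordinates ⊙ Λ) j k ≈ 0#
      coordinates-Λ j k = begin
        (coordinates ⊙ Λ) j k            ≈⟨ ⊙-assoc powers P⁻¹ Λ j k ⟩
        (powers ⊙ (P⁻¹ Pₘ.*ₘ Λ)) j k     ≈⟨ ⊙-congʳ powers (T Pₘ.*ₘ Q) (P⁻¹ Pₘ.*ₘ Λ) AQ j k ⟨
        (powers ⊙ (T Pₘ.*ₘ Q)) j k       ≈⟨ ⊙-assoc powers T Q j k ⟨
        (powers ⊙ T ⊙ Q) j k             ≈⟨ sum-zero (λ i → ◁-zeroˡ (Q i j) (powers-T i) k) ⟩
        0#                               ∎

      coordinates-nth : ∀ i k → (coordinates i ◁ nth polynomialRawRing (Vec.toList λs) (toℕ i)) k ≈ 0#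
      coordinates-nth i k = begin
        (coordinates i ◁ nth polynomialRawRing (Vec.toList λs) (toℕ i)) k
          ≡⟨ ≡.cong (λ f → (coordinates i ◁ f) k) (diagonal-at polynomialRawRing (Vec.toList λs) {i} {i} ≡.refl) ⟨
        (coordinates i ◁ Λ i i) k
          ≈⟨ sum-single i (λ j j≢i → reflexive (≡.cong (λ f → (coordinates j ◁ f) k) (diagonal-off polynomialRawRing (Vec.toList λs) {j} {i} (j≢i ∘ Fin.toℕ-injective)))) ⟨
        (coordinates ⊙ Λ) i k
          ≈⟨ coordinates-Λ i k ⟩
        0# ∎

      coordinates-last : ∀ i k → (coordinates i ◁ λ-last) k ≈ 0#
      coordinates-last i k with nth-∣ˡ-last λs (InvariantFactors.divides I) i
      ... | q Divisibility., λᵢq≈λ = begin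
        (coordinates i ◁ λ-last) k       ≈⟨ ◁-congʳ (coordinates i) (λᵢ *ₚ q) λ-last λᵢq≈λ k ⟨
        (coordinates i ◁ (λᵢ *ₚ q)) k    ≈⟨ ◁-assoc (coordinates i) λᵢ q k ⟨
        (coordinates i ◁ λᵢ ◁ q) k       ≈⟨ ◁-zeroˡ q (coordinates-nth i) k ⟩
        0#                               ∎
        where
        λᵢ : Polynomial
        λᵢ = nth polynomialRawRing (Vec.toList λs) (toℕ i)

    module _ (dominant : Dominant λ-last) (p p′ : ℕ)
             (P-bounded : ∀ i j → Bounded (P i j) p) (P⁻¹-bounded : ∀ i j → Bounded (P⁻¹ i j) p′)
             (s : ℕ) (s-bounded : PowersBoundedBelow D (length λ-last ℕ.+ p′) s) where

      private
        -- The losses to be made up are `s` from the powers of `D` inside the starting window, `p′`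
        -- from passing to coordinates and `p` from passing back; the final 1 is the net gain.
        n margin : ℕ
        n = length λ-last
        margin = s ℕ.+ p′ ℕ.+ p ℕ.+ 1

      -- The descent costs `n * margin` indices and has to serve all indices below `p`, since `P`
      -- reads these when the entry at 0 is recovered. The extra one makes the exponent positive.
      dominantExponent : ℕ
      dominantExponent = suc p ℕ.+ n ℕ.* margin

      dominant⇒rowContraction : RowContraction (D ^ₘ dominantExponent)
      dominant⇒rowContraction a Y YD zero l = ≤v-≡ (gain a (+ s) (+ p′) (+ p)) (≤v-cong
        (trans (sym (powers≈coordinates⊙P Y l 0)) (*ₘ-identityʳ Y zero l))
        (≤v-sum λ i → ≤v-◁ {j = 0} (coordinates Y i) (P i l)
          (λ k k<P → descend margin k (early k (ℕ.<-≤-trans k<P (proj₁ (P-bounded i l)))) i)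
          (proj₂ (P-bounded i l))))
        where
        gain : ∀ a s p′ p → a ℤ.- s ℤ.- p′ ℤ.+ (s ℤ.+ p′ ℤ.+ p ℤ.+ + 1) ℤ.- p ≡ a ℤ.+ + 1
        gain = solve-∀

        -- The coordinates at the `n` indices of the window read the powers fewer than `p′` places
        -- further on; hence the range `n + p′`, for which `s` was taken.
        powers-bounded : ∀ j → j ≤ n ℕ.+ p′ → ∀ l → a ℤ.- + s ≤v powers Y l (dominantExponent ℕ.+ j)
        powers-bounded zero    _    l = ≡.subst (λ N → a ℤ.- + s ≤v powers Y l N) (≡.sym (ℕ.+-identityʳ dominantExponent))
          (≤v-weaken (ℤ.i≤j⇒i-k≤j (+ s) ℤ.≤-refl) (YD zero l))
        powers-bounded (suc j) j<n+p′ l = ≤ₘ-cong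
          (≋-trans (*ₘ-assoc Y (D ^ₘ dominantExponent) (D ^ₘ suc j)) (*ₘ-congˡ Y (≋-sym (^ₘ-+ D dominantExponent (suc j)))))
          (≤ₘ-* {A = Y *ₘ D ^ₘ dominantExponent} {D ^ₘ suc j} YD (s-bounded (suc j) (s≤s z≤n) j<n+p′)) zero l

        initial : ∀ j → j < n → ∀ i → a ℤ.- + s ℤ.- + p′ ≤v coordinates Y i (dominantExponent ℕ.+ j)
        initial j j<n i = ≤v-sum λ l → ≤v-◁ {j = dominantExponent ℕ.+ j} (powers Y l) (P⁻¹ l i)
          (λ k k<P⁻¹ → ≡.subst (λ N → a ℤ.- + s ≤v powers Y l N) (≡.sym (ℕ.+-assoc dominantExponent j k))
            (powers-bounded (j ℕ.+ k) (ℕ.+-mono-≤ (ℕ.<⇒≤ j<n) (ℕ.<⇒≤ (ℕ.<-≤-trans k<P⁻¹ (proj₁ (P⁻¹-bounded l i))))) l))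
          (proj₂ (P⁻¹-bounded l i))

        contract : ∀ a j → (∀ (k : Fin n) → ∀ i → a ≤v coordinates Y i (j ℕ.+ suc (toℕ k))) → ∀ i → a ℤ.+ + 1 ≤v coordinates Y i j
        contract a j bounds i = dominant-contracts (coordinates Y i) λ-last dominant (coordinates-last Y i) j (λ k → bounds k i)

        open Descent (λ a j → ∀ i → a ≤v coordinates Y i j) (λ b≤a q i → ≤v-weaken b≤a (q i)) n contract using () renaming (descend to descend′)

        descend = descend′ (a ℤ.- + s ℤ.- + p′) dominantExponent initial

        early : ∀ k → k < p → k ℕ.+ n ℕ.* margin < dominantExponent ℕ.+ n
        early k k<p = ℕ.<-≤-trans (ℕ.+-monoˡ-< (n ℕ.* margin) (ℕ.m<n⇒m<1+n k<p)) (ℕ.m≤m+n dominantExponent n)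

    dominant⇒contraction : Dominant λ-last → ∃[ N ] (1 ≤ N × RowContraction (D ^ₘ N))
    dominant⇒contraction dominant =
      let p  , P-bounded   = boundedₘ P
          p′ , P⁻¹-bounded = boundedₘ P⁻¹
          b = leastExponent D (length λ-last ℕ.+ p′)
      in dominantExponent dominant p p′ P-bounded P⁻¹-bounded (LeastExponent.exponent b) (LeastExponent.bounded b)
       , s≤s z≤n
       , dominant⇒rowContraction dominant p p′ P-bounded P⁻¹-bounded (LeastExponent.exponent b) (LeastExponent.bounded b)

-- Central scalars and the remainder theorem for matrices.

module CentralScalars {c ℓ : Level} (R : Ring c ℓ) where

  open Ring R hiding (zero)
  open Exponentiation (RawRing.rawSemiring rawRing) using (_^_)
  open Matrices rawRing
  open MatrixProperties R
  open SumProperties semiring using (sum; sum-cong-≋; ∑-distrib-+; *-distribˡ-sum)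
  open import Relation.Binary.Reasoning.Setoid setoid

  Central : Carrier → Set (c ⊔ ℓ)
  Central a = ∀ x → a * x ≈ x * a

  ^-central : ∀ {a} → Central a → ∀ n → Central (a ^ n)
  ^-central         ca zero    x = trans (*-identityˡ x) (sym (*-identityʳ x))
  ^-central {a}     ca (suc n) x = begin
    a * a ^ n * x    ≈⟨ *-assoc a (a ^ n) x ⟩
    a * (a ^ n * x)  ≈⟨ *-congˡ (^-central ca n x) ⟩
    a * (x * a ^ n)  ≈⟨ *-assoc a x (a ^ n) ⟨
    a * x * a ^ n    ≈⟨ *-congʳ (ca x) ⟩
    x * a * a ^ n    ≈⟨ *-assoc x a (a ^ n) ⟩
    x * (a * a ^ n)  ∎

  infixl 6 _+ₘ_
  infixr 8 _•_

  _+ₘ_ : ∀ {m n} → Mat m n → Mat m n → Mat m n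
  (A +ₘ B) i j = A i j + B i j

  _•_ : ∀ {m n} → Carrier → Mat m n → Mat m n
  (a • A) i j = a * A i j

  *ₘ-distribˡ : ∀ {m n p} (A : Mat m n) (B C : Mat n p) → A *ₘ (B +ₘ C) ≋ A *ₘ B +ₘ A *ₘ C
  *ₘ-distribˡ A B C i j = trans (sum-cong-≋ (λ k → distribˡ (A i k) (B k j) (C k j)))
    (∑-distrib-+ (λ k → A i k * B k j) (λ k → A i k * C k j))

  *ₘ-distribʳ : ∀ {m n p} (A B : Mat m n) (C : Mat n p) → (A +ₘ B) *ₘ C ≋ A *ₘ C +ₘ B *ₘ C
  *ₘ-distribʳ A B C i j = trans (sum-cong-≋ (λ k → distribʳ (C k j) (A i k) (B i k)))
    (∑-distrib-+ (λ k → A i k * C k j) (λ k → B i k * C k j))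

  •-*ₘ : ∀ {m n p} a (A : Mat m n) (B : Mat n p) → (a • A) *ₘ B ≋ a • (A *ₘ B)
  •-*ₘ a A B i j = trans (sum-cong-≋ (λ k → *-assoc a (A i k) (B k j))) (sym (*-distribˡ-sum a (λ k → A i k * B k j)))

  *ₘ-• : ∀ {m n p a} → Central a → (A : Mat m n) (B : Mat n p) → A *ₘ (a • B) ≋ a • (A *ₘ B)
  *ₘ-• {a = a} ca A B i j = begin
    sum (λ k → A i k * (a * B k j))   ≈⟨ sum-cong-≋ (λ k → trans (sym (*-assoc _ _ _)) (trans (*-congʳ (sym (ca (A i k)))) (*-assoc _ _ _))) ⟩
    sum (λ k → a * (A i k * B k j))   ≈⟨ *-distribˡ-sum a (λ k → A i k * B k j) ⟨
    a * sum (λ k → A i k * B k j)     ∎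

  -- Remainder theorem: aᴺ ≡ Dᴺ modulo left multiples of T = a - D.
  remainder : ∀ {d p a} (T D : Mat d d) → Central a → (∀ (X : Mat d p) → a • X ≋ T *ₘ X +ₘ D *ₘ X) →
              ∀ n (X : Mat d p) → ∃[ Z ] (a ^ n) • X ≋ T *ₘ Z +ₘ D ^ₘ n *ₘ X
  remainder T D ca step zero X = 0ₘ , λ i j → begin
    1# * X i j                         ≈⟨ *-identityˡ _ ⟩
    X i j                              ≈⟨ *ₘ-identityˡ X i j ⟨
    (1ₘ *ₘ X) i j                      ≈⟨ +-identityˡ _ ⟨
    0# + (1ₘ *ₘ X) i j                 ≈⟨ +-congʳ (sum-zero (λ k → zeroʳ (T i k))) ⟨
    (T *ₘ 0ₘ) i j + (1ₘ *ₘ X) i j      ∎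
  remainder {a = a} T D ca step (suc n) X =
    let Z , eq = remainder T D ca step n X in
    -- Multiplying `aⁿ X = T Z + Dⁿ X` by `a` and splitting `a (Dⁿ X)` once more by `step` gives the
    -- new quotient, as in Horner's scheme.
    a • Z +ₘ D ^ₘ n *ₘ X , λ i j → begin
      a * a ^ n * X i j                                                                  ≈⟨ *-assoc a (a ^ n) (X i j) ⟩
      a * (a ^ n * X i j)                                                                ≈⟨ *-congˡ (eq i j) ⟩
      a * ((T *ₘ Z) i j + (D ^ₘ n *ₘ X) i j)                                             ≈⟨ distribˡ a _ _ ⟩
      a * (T *ₘ Z) i j + a * (D ^ₘ n *ₘ X) i j                                           ≈⟨ +-cong (sym (*ₘ-• ca T Z i j)) (step (D ^ₘ n *ₘ X) i j) ⟩
      (T *ₘ (a • Z)) i j + ((T *ₘ (D ^ₘ n *ₘ X)) i j + (D *ₘ (D ^ₘ n *ₘ X)) i j)         ≈⟨ +-assoc _ _ _ ⟨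
      (T *ₘ (a • Z)) i j + (T *ₘ (D ^ₘ n *ₘ X)) i j + (D *ₘ (D ^ₘ n *ₘ X)) i j           ≈⟨ +-cong (*ₘ-distribˡ T (a • Z) (D ^ₘ n *ₘ X) i j) (*ₘ-assoc D (D ^ₘ n) X i j) ⟨
      (T *ₘ (a • Z +ₘ D ^ₘ n *ₘ X)) i j + ((D *ₘ D ^ₘ n) *ₘ X) i j                       ∎

  -- Writing `A ^ₘ suc n` as `A ^ₘ n *ₘ A` puts the last `A` next to the first `F` of `F ^ₘ suc n`,
  -- and the product collapses from the inside.
  ^ₘ-inverse : ∀ {d} {A F : Mat d d} → A *ₘ F ≋ 1ₘ → ∀ n → A ^ₘ n *ₘ F ^ₘ n ≋ 1ₘ
  ^ₘ-inverse         AF zero    = *ₘ-identityˡ 1ₘ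
  ^ₘ-inverse {A = A} {F} AF (suc n) = ≋-trans (*ₘ-congʳ (F ^ₘ suc n) (^ₘ-sucʳ A n))
    (product-inverse (A ^ₘ n) (F ^ₘ n) A F (^ₘ-inverse AF n) AF)

  ^ₘ-^ₘ : ∀ {d} (A : Mat d d) n m → (A ^ₘ n) ^ₘ m ≋ A ^ₘ (m ℕ.* n)
  ^ₘ-^ₘ A n zero    = ≋-refl
  ^ₘ-^ₘ A n (suc m) = ≋-trans (*ₘ-congˡ (A ^ₘ n) (^ₘ-^ₘ A n m)) (≋-sym (^ₘ-+ A n (m ℕ.* n)))

-- Constant matrices over the polynomial ring.

module ConstantMatrices {c ℓ : Level} (R : Ring c ℓ) where

  open Ring R hiding (zero)
  open Polynomials rawRing using (Polynomial; constant; t; _≈ₚ_; _*ₚ_; characteristic) renaming (rawRing to polynomialRawRing)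
  open PolynomialRing R
  open SumProperties semiring using (sum)
  open Matrices rawRing
  open Summation (RawRing.+-rawMonoid polynomialRawRing) using () renaming (sum to sumₚ)
  open CentralScalars polynomialRing using (_•_; _+ₘ_; *ₘ-distribʳ; •-*ₘ)
  private
    module P  = Ring polynomialRing
    module Pₘ where
      open Matrices polynomialRawRing public
      open MatrixProperties polynomialRing public

  constantₘ : ∀ {m n} → Matrix rawRing m n → Matrix polynomialRawRing m n
  constantₘ A i j = constant (A i j)

  constant-cong : ∀ {a b} → a ≈ b → constant a ≈ₚ constant b
  constant-cong a≈b zero    = a≈b
  constant-cong a≈b (suc i) = refl

  constant-sum : ∀ {n} (f : Fin n → Carrier) (g : Fin n → Polynomial) → (∀ k → constant (f k) ≈ₚ g k) →
                 constant (sum f) ≈ₚ sumₚ g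
  constant-sum {zero}  f g eq zero    = refl
  constant-sum {zero}  f g eq (suc i) = refl
  constant-sum {suc n} f g eq i       = P.+-cong {constant (f zero)} {g zero} {constant (sum (f ∘ suc))} {sumₚ (g ∘ suc)}
    (eq zero) (constant-sum (f ∘ suc) (g ∘ suc) (eq ∘ suc)) i

  constant-* : ∀ a b → constant (a * b) ≈ₚ constant a *ₚ constant b
  constant-* a b zero    = sym (+-identityʳ _)
  constant-* a b (suc i) = refl

  constantₘ-* : ∀ {m n p} (A : Matrix rawRing m n) (B : Matrix rawRing n p) →
                constantₘ (A *ₘ B) Pₘ.≋ constantₘ A Pₘ.*ₘ constantₘ B
  constantₘ-* A B i j = constant-sum (λ k → A i k * B k j) (λ k → constant (A i k) *ₚ constant (B k j))
    (λ k → constant-* (A i k) (B k j))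

  constantₘ-1 : ∀ {n} → constantₘ (1ₘ {n}) Pₘ.≋ Pₘ.1ₘ
  constantₘ-1 i j k with i Fin.≟ j
  constantₘ-1 i j k       | yes _ = refl
  constantₘ-1 i j zero    | no  _ = refl
  constantₘ-1 i j (suc k) | no  _ = refl

  constantₘ-^ : ∀ {n} (A : Matrix rawRing n n) k → constantₘ (A ^ₘ k) Pₘ.≋ constantₘ A Pₘ.^ₘ k
  constantₘ-^ A zero    = constantₘ-1
  constantₘ-^ A (suc k) = Pₘ.≋-trans {A = constantₘ (A ^ₘ suc k)} {constantₘ A Pₘ.*ₘ constantₘ (A ^ₘ k)} {constantₘ A Pₘ.^ₘ suc k}
    (constantₘ-* A (A ^ₘ k)) (Pₘ.*ₘ-congˡ (constantₘ A) {constantₘ (A ^ₘ k)} {constantₘ A Pₘ.^ₘ k} (constantₘ-^ A k))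

  -- Together with the constant matrix of `D`, the characteristic matrix adds up to `t` times the
  -- identity. This is the single step that `remainder` iterates.
  characteristic-split : ∀ {d p} (D : Matrix rawRing d d) (X : Matrix polynomialRawRing d p) →
                         t • X Pₘ.≋ characteristic D Pₘ.*ₘ X +ₘ constantₘ D Pₘ.*ₘ X
  characteristic-split D X i j k = trans (sym (tX i j k)) (*ₘ-distribʳ (characteristic D) (constantₘ D) X i j k)
    where
    t1 : characteristic D +ₘ constantₘ D Pₘ.≋ t • Pₘ.1ₘ
    t1 i j k = trans (P.+-assoc (t *ₚ Pₘ.1ₘ i j) (P.- constant (D i j)) (constant (D i j)) k)
      (trans (P.+-congˡ {t *ₚ Pₘ.1ₘ i j} {P.- constant (D i j) P.+ constant (D i j)} {[]} (P.-‿inverseˡ (constant (D i j))) k)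
             (P.+-identityʳ (t *ₚ Pₘ.1ₘ i j) k))

    tX : (characteristic D +ₘ constantₘ D) Pₘ.*ₘ X Pₘ.≋ t • X
    tX i j k = trans (Pₘ.*ₘ-congʳ {A = characteristic D +ₘ constantₘ D} {t • Pₘ.1ₘ} X t1 i j k)
      (trans (•-*ₘ t Pₘ.1ₘ X i j k) (P.*-congˡ {t} {(Pₘ.1ₘ Pₘ.*ₘ X) i j} {X i j} (Pₘ.*ₘ-identityˡ X i j) k))

-- From a small right inverse of a power of `D` to positive slopes.

module SmallInverse {c ℓ : Level} (𝓛 : CompleteDiscretelyValuedSkewField c ℓ) where

  open CompleteDiscretelyValuedSkewField 𝓛 hiding (zero; _^_)
  open ValuationProperties 𝓛
  open Rank 𝓛 using (_≤ₘ_; ≤ₘ-*)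
  open Newton 𝓛
  open Slopes 𝓛 using (_≤ₚ_; ≤ₚ-*; ≤ₚ-*ₘ; boundedₘ)
  open Polynomials rawRing using (Polynomial; coefficient; constant; t; _≈ₚ_; _+ₚ_; _*ₚ_; characteristic; InvariantFactors) renaming (rawRing to polynomialRawRing)
  open PolynomialRing ring
  open LastDivisor ring
  open ConstantMatrices ring
  open Matrices rawRing
  open MatrixProperties ring using (≋-sym; ≋-trans; *ₘ-congʳ)
  open CentralScalars ring using (^ₘ-inverse; ^ₘ-^ₘ)
  open CentralScalars polynomialRing using (_•_; _+ₘ_; *ₘ-distribˡ; *ₘ-distribʳ; *ₘ-•; •-*ₘ; ^-central; remainder)
  open Exponentiation (RawRing.rawSemiring polynomialRawRing) using (_^_)
  open RingProperties ring using (-0#≈0#)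
  open import Relation.Binary.Reasoning.Setoid setoid

  private
    module P  = Ring polynomialRing
    module Pₘ where
      open Matrices polynomialRawRing public
      open MatrixProperties polynomialRing public

  ^ₘ-≤ₘ : ∀ {d} {F : Mat d d} → + 1 ≤ₘ F → ∀ n → + n ≤ₘ F ^ₘ n
  ^ₘ-≤ₘ     1≤F zero    i j with i Fin.≟ j
  ... | yes _ = ≡⇒≤v v-1
  ... | no  _ = ≤v-0
  ^ₘ-≤ₘ {F = F} 1≤F (suc n) = ≤ₘ-* {A = F} {F ^ₘ n} 1≤F (^ₘ-≤ₘ 1≤F n)

  t^-integral : ∀ n → + 0 ≤ₚ t ^ n
  t^-integral zero    zero          = ≡⇒≤v v-1
  t^-integral zero    (suc i)       = ≤v-0
  t^-integral (suc n) = ≤ₚ-* t (t ^ n) integral (t^-integral n)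
    where
    integral : + 0 ≤ₚ t
    integral zero          = ≤v-0
    integral (suc zero)    = ≡⇒≤v v-1
    integral (suc (suc i)) = ≤v-0

  module _ {d-1 : ℕ} (D : Mat (suc d-1) (suc d-1)) (λs : Vec Polynomial (suc d-1)) (I : InvariantFactors D λs) where

    private
      d = suc d-1

      λ-last : Polynomial
      λ-last = Vec.last λs

      ι : Fin d
      ι = fromℕ d-1

      T Λ : Matrix polynomialRawRing d d
      T = characteristic D
      Λ = Pₘ.diagonal (Vec.toList λs)

    open Pₘ.Equivalent (Pₘ.⇝⇒equivalent (InvariantFactors.reduces I))

    Λ-last : ∀ (X : Matrix polynomialRawRing d d) j → (Λ Pₘ.*ₘ X) ι j ≈ₚ λ-last *ₚ X ι j
    Λ-last X j k = begin
      coefficient ((Λ Pₘ.*ₘ X) ι j) k     ≈⟨ Pₘ.sum-single {f = λ l → Λ ι l *ₚ X l j} ι off k ⟩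
      coefficient (Λ ι ι *ₚ X ι j) k      ≡⟨ ≡.cong (λ f → coefficient (f *ₚ X ι j) k) at ⟩
      coefficient (λ-last *ₚ X ι j) k     ∎
      where
      off : ∀ l → l ≢ ι → Λ ι l *ₚ X l j ≈ₚ []
      off l l≢ι rewrite diagonal-off polynomialRawRing (Vec.toList λs) {ι} {l} (λ ι≡l → l≢ι (≡.sym (Fin.toℕ-injective ι≡l))) = λ _ → refl

      at : Λ ι ι ≡ λ-last
      at = ≡.trans (diagonal-at polynomialRawRing (Vec.toList λs) {ι} {ι} ≡.refl)
        (≡.trans (≡.cong (nth polynomialRawRing (Vec.toList λs)) (Fin.toℕ-fromℕ d-1)) (nth-last λs))

    module _ (N : ℕ) (F : Mat d d) (DF : D ^ₘ N *ₘ F ≋ 1ₘ) where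

      private
        F̂ R : Matrix polynomialRawRing d d
        F̂ = constantₘ F
        R = P Pₘ.*ₘ (F̂ Pₘ.*ₘ P⁻¹)

        Z : Matrix polynomialRawRing d d
        Z = proj₁ (remainder T (constantₘ D) t-central (characteristic-split D) N F̂)

        W : Matrix polynomialRawRing d d
        W = Q⁻¹ Pₘ.*ₘ (Z Pₘ.*ₘ P⁻¹)

        D̂F̂ : (constantₘ D Pₘ.^ₘ N) Pₘ.*ₘ F̂ Pₘ.≋ Pₘ.1ₘ
        D̂F̂ i j k = begin
          coefficient (((constantₘ D Pₘ.^ₘ N) Pₘ.*ₘ F̂) i j) k  ≈⟨ Pₘ.*ₘ-congʳ {A = constantₘ (D ^ₘ N)} {constantₘ D Pₘ.^ₘ N} F̂ (constantₘ-^ D N) i j k ⟨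
          coefficient ((constantₘ (D ^ₘ N) Pₘ.*ₘ F̂) i j) k     ≈⟨ constantₘ-* (D ^ₘ N) F i j k ⟨
          coefficient (constantₘ (D ^ₘ N *ₘ F) i j) k          ≈⟨ constant-cong (DF i j) k ⟩
          coefficient (constantₘ 1ₘ i j) k                     ≈⟨ constantₘ-1 i j k ⟩
          coefficient (Pₘ.1ₘ i j) k                            ∎

        tF̂ : (t ^ N) • F̂ Pₘ.≋ (T Pₘ.*ₘ Z) +ₘ Pₘ.1ₘ
        tF̂ i j k = trans (proj₂ (remainder T (constantₘ D) t-central (characteristic-split D) N F̂) i j k)
          (P.+-congˡ {(T Pₘ.*ₘ Z) i j} {((constantₘ D Pₘ.^ₘ N) Pₘ.*ₘ F̂) i j} {Pₘ.1ₘ i j} (D̂F̂ i j) k)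

        -- `P (T Z + 1) P⁻¹ = Λ Q⁻¹ Z P⁻¹ + 1`, since `P T = Λ Q⁻¹`. Conjugation fixes the identity
        -- and `t ^ N` is central, so the congruence for `F̂` becomes one for `R` modulo right
        -- multiples of `Λ`.
        tR : (t ^ N) • R Pₘ.≋ (Λ Pₘ.*ₘ W) +ₘ Pₘ.1ₘ
        tR = Pₘ.≋-trans {A = (t ^ N) • R} {P Pₘ.*ₘ (((t ^ N) • F̂) Pₘ.*ₘ P⁻¹)} {(Λ Pₘ.*ₘ W) +ₘ Pₘ.1ₘ}
          (Pₘ.≋-sym {A = P Pₘ.*ₘ (((t ^ N) • F̂) Pₘ.*ₘ P⁻¹)} {(t ^ N) • R}
            (Pₘ.≋-trans {A = P Pₘ.*ₘ (((t ^ N) • F̂) Pₘ.*ₘ P⁻¹)} {P Pₘ.*ₘ ((t ^ N) • (F̂ Pₘ.*ₘ P⁻¹))} {(t ^ N) • R}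
              (Pₘ.*ₘ-congˡ P {((t ^ N) • F̂) Pₘ.*ₘ P⁻¹} {(t ^ N) • (F̂ Pₘ.*ₘ P⁻¹)} (•-*ₘ (t ^ N) F̂ P⁻¹))
              (*ₘ-• (^-central t-central N) P (F̂ Pₘ.*ₘ P⁻¹))))
          (Pₘ.≋-trans {A = P Pₘ.*ₘ (((t ^ N) • F̂) Pₘ.*ₘ P⁻¹)} {P Pₘ.*ₘ ((T Pₘ.*ₘ Z) Pₘ.*ₘ P⁻¹ +ₘ P⁻¹)} {(Λ Pₘ.*ₘ W) +ₘ Pₘ.1ₘ}
            (Pₘ.*ₘ-congˡ P {((t ^ N) • F̂) Pₘ.*ₘ P⁻¹} {(T Pₘ.*ₘ Z) Pₘ.*ₘ P⁻¹ +ₘ P⁻¹} inner)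
            (Pₘ.≋-trans {A = P Pₘ.*ₘ ((T Pₘ.*ₘ Z) Pₘ.*ₘ P⁻¹ +ₘ P⁻¹)} {P Pₘ.*ₘ ((T Pₘ.*ₘ Z) Pₘ.*ₘ P⁻¹) +ₘ P Pₘ.*ₘ P⁻¹} {(Λ Pₘ.*ₘ W) +ₘ Pₘ.1ₘ}
              (*ₘ-distribˡ P ((T Pₘ.*ₘ Z) Pₘ.*ₘ P⁻¹) P⁻¹)
              (λ i j → P.+-cong {(P Pₘ.*ₘ ((T Pₘ.*ₘ Z) Pₘ.*ₘ P⁻¹)) i j} {(Λ Pₘ.*ₘ W) i j} {(P Pₘ.*ₘ P⁻¹) i j} {Pₘ.1ₘ i j} (outer i j) (PP⁻¹ i j))))
          where
          inner : ((t ^ N) • F̂) Pₘ.*ₘ P⁻¹ Pₘ.≋ (T Pₘ.*ₘ Z) Pₘ.*ₘ P⁻¹ +ₘ P⁻¹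
          inner i j k = begin
            coefficient ((((t ^ N) • F̂) Pₘ.*ₘ P⁻¹) i j) k
              ≈⟨ Pₘ.*ₘ-congʳ {A = (t ^ N) • F̂} {(T Pₘ.*ₘ Z) +ₘ Pₘ.1ₘ} P⁻¹ tF̂ i j k ⟩
            coefficient ((((T Pₘ.*ₘ Z) +ₘ Pₘ.1ₘ) Pₘ.*ₘ P⁻¹) i j) k
              ≈⟨ *ₘ-distribʳ (T Pₘ.*ₘ Z) Pₘ.1ₘ P⁻¹ i j k ⟩
            coefficient (((T Pₘ.*ₘ Z) Pₘ.*ₘ P⁻¹ +ₘ Pₘ.1ₘ Pₘ.*ₘ P⁻¹) i j) k
              ≈⟨ P.+-congˡ {((T Pₘ.*ₘ Z) Pₘ.*ₘ P⁻¹) i j} {(Pₘ.1ₘ Pₘ.*ₘ P⁻¹) i j} {P⁻¹ i j} (Pₘ.*ₘ-identityˡ P⁻¹ i j) k ⟩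
            coefficient (((T Pₘ.*ₘ Z) Pₘ.*ₘ P⁻¹ +ₘ P⁻¹) i j) k ∎

          outer : P Pₘ.*ₘ ((T Pₘ.*ₘ Z) Pₘ.*ₘ P⁻¹) Pₘ.≋ Λ Pₘ.*ₘ W
          outer i j k = begin
            coefficient ((P Pₘ.*ₘ ((T Pₘ.*ₘ Z) Pₘ.*ₘ P⁻¹)) i j) k
              ≈⟨ Pₘ.*ₘ-congˡ P {(T Pₘ.*ₘ Z) Pₘ.*ₘ P⁻¹} {T Pₘ.*ₘ (Z Pₘ.*ₘ P⁻¹)} (Pₘ.*ₘ-assoc T Z P⁻¹) i j k ⟩
            coefficient ((P Pₘ.*ₘ (T Pₘ.*ₘ (Z Pₘ.*ₘ P⁻¹))) i j) k
              ≈⟨ Pₘ.*ₘ-assoc P T (Z Pₘ.*ₘ P⁻¹) i j k ⟨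
            coefficient (((P Pₘ.*ₘ T) Pₘ.*ₘ (Z Pₘ.*ₘ P⁻¹)) i j) k
              ≈⟨ Pₘ.*ₘ-congʳ {A = P Pₘ.*ₘ T} {Λ Pₘ.*ₘ Q⁻¹} (Z Pₘ.*ₘ P⁻¹) PA i j k ⟩
            coefficient (((Λ Pₘ.*ₘ Q⁻¹) Pₘ.*ₘ (Z Pₘ.*ₘ P⁻¹)) i j) k
              ≈⟨ Pₘ.*ₘ-assoc Λ Q⁻¹ (Z Pₘ.*ₘ P⁻¹) i j k ⟩
            coefficient ((Λ Pₘ.*ₘ W) i j) k ∎

      -- Row `ι` of `Λ` is zero off the diagonal, so the last diagonal entry of `tR` is a relation
      -- between single polynomials. The explicit form of `r` is kept so that its valuations can be
      -- estimated.
      remainder-identity : ∃[ r ] ∃[ w ] (λ-last *ₚ w ≈ₚ constant 1# +ₚ List.map -_ (t ^ N *ₚ r) × r ≡ (P Pₘ.*ₘ (constantₘ F Pₘ.*ₘ P⁻¹)) ι ι)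
      remainder-identity = R ι ι , P.- W ι ι , identity , ≡.refl
        where
        open RingProperties polynomialRing using () renaming (-‿distribʳ-* to ₚ-‿distribʳ-*)

        tr lw : Polynomial
        tr = t ^ N *ₚ R ι ι
        lw = λ-last *ₚ W ι ι

        tr≈ : ∀ k → coefficient tr k ≈ coefficient lw k + coefficient (constant 1#) k
        tr≈ k = begin
          coefficient tr k                                                       ≈⟨ tR ι ι k ⟩
          coefficient ((Λ Pₘ.*ₘ W) ι ι +ₚ Pₘ.1ₘ ι ι) k                           ≈⟨ coefficient-+ ((Λ Pₘ.*ₘ W) ι ι) (Pₘ.1ₘ ι ι) k ⟩
          coefficient ((Λ Pₘ.*ₘ W) ι ι) k + coefficient (Pₘ.1ₘ ι ι) k            ≈⟨ +-cong (Λ-last W ι k) (Pₘ.1ₘ-diagonal ι k) ⟩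
          coefficient lw k + coefficient (constant 1#) k                         ∎

        solve-neg : ∀ {x y z} → x ≈ y + z → - y ≈ z - x
        solve-neg {x} {y} {z} eq = begin
          - y                ≈⟨ +-identityˡ _ ⟨
          0# - y             ≈⟨ +-congʳ (-‿inverseʳ x) ⟨
          x - x - y          ≈⟨ +-congʳ (+-congʳ eq) ⟩
          y + z - x - y      ≈⟨ +-congʳ (+-assoc y z (- x)) ⟩
          y + (z - x) - y    ≈⟨ +-congʳ (+-comm y (z - x)) ⟩
          z - x + y - y      ≈⟨ +-assoc (z - x) y (- y) ⟩
          z - x + (y - y)    ≈⟨ +-congˡ (-‿inverseʳ y) ⟩
          z - x + 0#         ≈⟨ +-identityʳ _ ⟩
          z - x              ∎

        identity : λ-last *ₚ (P.- W ι ι) ≈ₚ constant 1# +ₚ List.map -_ tr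
        identity k = begin
          coefficient (λ-last *ₚ (P.- W ι ι)) k                        ≈⟨ ₚ-‿distribʳ-* λ-last (W ι ι) k ⟨
          coefficient (P.- lw) k                                       ≈⟨ coefficient-neg lw k ⟩
          - coefficient lw k                                           ≈⟨ solve-neg (tr≈ k) ⟩
          coefficient (constant 1#) k - coefficient tr k               ≈⟨ +-congˡ (coefficient-neg tr k) ⟨
          coefficient (constant 1#) k + coefficient (List.map -_ tr) k ≈⟨ coefficient-+ (constant 1#) (List.map -_ tr) k ⟨
          coefficient (constant 1# +ₚ List.map -_ tr) k                ∎

    -- The positive exponent keeps the constant coefficient of `t ^ suc N *ₚ r` zero, so the product
    -- with `w` has constant coefficient 1 and all others in `σ` 𝓞, which is the situation of
    -- `dominant-factor`.
    dominant-identity : ∀ N r w → + 1 ≤ₚ r → λ-last *ₚ w ≈ₚ constant 1# +ₚ List.map -_ (t ^ suc N *ₚ r) → Dominant λ-last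
    dominant-identity N r w 1≤r eq = dominant-factor λ-last w (≡.trans (v-cong head) v-1) tail
      where
      tr : Polynomial
      tr = t ^ suc N *ₚ r

      tr₀≈0 : coefficient tr 0 ≈ 0#
      tr₀≈0 = begin
        coefficient tr 0                                ≈⟨ coefficient-zero (t ^ suc N) r ⟩
        coefficient (t ^ suc N) 0 * coefficient r 0     ≈⟨ *-congʳ (t-* (t ^ N) 0) ⟩
        0# * coefficient r 0                            ≈⟨ zeroˡ _ ⟩
        0#                                              ∎

      coefficients : ∀ k → coefficient (λ-last *ₚ w) k ≈ coefficient (constant 1#) k - coefficient tr k
      coefficients k = trans (eq k) (trans (coefficient-+ (constant 1#) (List.map -_ tr) k) (+-congˡ (coefficient-neg tr k)))

      head : coefficient (λ-last *ₚ w) 0 ≈ 1#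
      head = trans (coefficients 0) (trans (+-congˡ (trans (-‿cong tr₀≈0) -0#≈0#)) (+-identityʳ 1#))

      tail : ∀ k → + 1 ≤v coefficient (λ-last *ₚ w) (suc k)
      tail k = ≤v-cong (sym (trans (coefficients (suc k)) (+-identityˡ _)))
        (≤v-neg (≤v-≡ (ℤ.+-identityˡ (+ 1)) (≤ₚ-* (t ^ suc N) r (t^-integral (suc N)) 1≤r (suc k))))

    smallInverse⇒dominant : ∀ {n} → 1 ≤ n → (F : Mat d d) → + 1 ≤ₘ F → D ^ₘ n *ₘ F ≋ 1ₘ → Dominant λ-last
    smallInverse⇒dominant {suc n} _ F 1≤F DF =
      let p  , P-bounded   = boundedₘ P
          p′ , P⁻¹-bounded = boundedₘ P⁻¹
      in power p p′ (λ i j → proj₂ (P-bounded i j)) (λ i j → proj₂ (P⁻¹-bounded i j))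
      where
      lemma : ∀ p p′ → ℤ.- p ℤ.+ (+ 1 ℤ.+ (p ℤ.+ p′) ℤ.+ ℤ.- p′) ≡ + 1
      lemma = solve-∀

      power : ∀ p p′ → (∀ i j → ℤ.- (+ p) ≤ₚ P i j) → (∀ i j → ℤ.- (+ p′) ≤ₚ P⁻¹ i j) → Dominant λ-last
      power p p′ P≥ P⁻¹≥ =
        -- `F ^ₘ M` has valuations of at least `M`, and conjugation by `P` loses at most `p + p′`,
        -- so one unit remains.
        let M = suc (p ℕ.+ p′)
            G = F ^ₘ M
            DG : D ^ₘ (M ℕ.* suc n) *ₘ G ≋ 1ₘ
            DG = ≋-trans (*ₘ-congʳ G (≋-sym (^ₘ-^ₘ D (suc n) M))) (^ₘ-inverse DF M)
            r , w , eq , r≡ = remainder-identity (M ℕ.* suc n) G DG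
            M≤Ĝ : ∀ i j → + M ≤ₚ constantₘ G i j
            M≤Ĝ i j = λ { zero → ^ₘ-≤ₘ 1≤F M i j ; (suc _) → ≤v-0 }
            1≤r : + 1 ≤ₚ r
            1≤r k = ≡.subst (λ r → + 1 ≤v coefficient r k) (≡.sym r≡) (≤v-≡ (lemma (+ p) (+ p′))
              (≤ₚ-*ₘ P (constantₘ G Pₘ.*ₘ P⁻¹) P≥ (≤ₚ-*ₘ (constantₘ G) P⁻¹ M≤Ĝ P⁻¹≥) ι ι k))
        -- `M * suc n` computes to the successor of this number.
        in dominant-identity (n ℕ.+ (p ℕ.+ p′) ℕ.* suc n) r w 1≤r eq

-- Assembly of the equivalences.

module Conditions {c ℓ : Level} (𝓛 : CompleteDiscretelyValuedSkewField c ℓ) where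

  open CompleteDiscretelyValuedSkewField 𝓛 using (rawRing)
  open Valuation 𝓛
  open ValuationProperties 𝓛 using (Mat)
  open Rank 𝓛
  open PowerRanks 𝓛
  open Newton 𝓛 using (slopesPositive⇒dominant; dominant⇒slopesPositive)
  open Slopes 𝓛 using (dominant⇒contraction)
  open SmallInverse 𝓛 using (smallInverse⇒dominant)
  open Matrices 𝓞 using (column; row)
  open Matrices rawRing using (_^ₘ_)
  open Polynomials rawRing using (Polynomial; InvariantFactors)

  module _ {d-1 : ℕ} (D : Mat (suc d-1) (suc d-1)) where

    private
      d = suc d-1

      bounded : ∀ n → PowersBoundedBelow D n (s D n)
      bounded n = LeastExponent.bounded (leastExponent D n)

    PowerRank ColumnRank RowRank : Set (c ⊔ ℓ)
    PowerRank  = ∃[ n ] Σ (1 ≤ n) λ 1≤n → HasRank (scaledPower D n n 1≤n ≤-refl) (s D n) d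
    ColumnRank = ∃[ n ] (1 ≤ n × HasRank (column (scaledPowers D n)) (s D n) d)
    RowRank    = ∃[ n ] (1 ≤ n × HasRank (row (scaledPowers D n)) (s D n) d)

    -- Forward the same `n` serves. Backward the exponent grows, and the scaling `s D N` changes
    -- with it; passing through the scale-free contraction bridges the two.
    powerRank⇔columnRank : PowerRank ⇔ ColumnRank
    powerRank⇔columnRank = mk⇔
      (λ (n , 1≤n , rank) → n , 1≤n , columnContraction⇒columnRank D 1≤n (s D n) (bounded n)
        (rank⇒columnContraction (D ^ₘ n) (s D n) (bounded n n 1≤n ≤-refl) rank))
      (λ (n , 1≤n , rank) →
        let N   = contractionExponent D 1≤n (s D n) (bounded n)
            1≤N = 1≤contractionExponent D 1≤n (s D n) (bounded n)
        in N , 1≤N , columnContraction⇒rank (D ^ₘ N) (s D N) (bounded N N 1≤N ≤-refl)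
             (columnRank⇒columnContraction D 1≤n (s D n) (bounded n) rank))

    powerRank⇔rowRank : PowerRank ⇔ RowRank
    powerRank⇔rowRank = mk⇔
      (λ (n , 1≤n , rank) → n , 1≤n , rowContraction⇒rowRank D 1≤n (s D n) (bounded n)
        (rank⇒rowContraction (D ^ₘ n) (s D n) (bounded n n 1≤n ≤-refl) rank))
      (λ (n , 1≤n , rank) →
        let N   = contractionExponent D 1≤n (s D n) (bounded n)
            1≤N = 1≤contractionExponent D 1≤n (s D n) (bounded n)
        in N , 1≤N , rowContraction⇒rank (D ^ₘ N) (s D N) (bounded N N 1≤N ≤-refl)
             (rowRank⇒rowContraction D 1≤n (s D n) (bounded n) rank))

    -- The rank of the square block is used in the shape that each direction needs: as a right
    -- inverse in `σ` 𝓞, whose powers become arbitrarily small, and as a contraction of row vectors,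
    -- which matches the right action on sequences.
    powerRank⇔slopesPositive : (λs : Vec Polynomial d) → InvariantFactors D λs →
                               PowerRank ⇔ AllSlopesPositive (last λs)
    powerRank⇔slopesPositive λs I = mk⇔
      (λ (n , 1≤n , rank) →
        let F , 1≤F , DF = rank⇒smallRightInverse (s D n) (D ^ₘ n) (bounded n n 1≤n ≤-refl) rank
        in dominant⇒slopesPositive {last λs} (smallInverse⇒dominant D λs I 1≤n F 1≤F DF))
      (λ positive →
        let N , 1≤N , contraction = dominant⇒contraction D λs I (slopesPositive⇒dominant (last λs) positive)
        in N , 1≤N , rowContraction⇒rank (D ^ₘ N) (s D N) (bounded N N 1≤N ≤-refl) contraction)

theorem4p1 :
    ∀ {c ℓ} (𝓛 : CompleteDiscretelyValuedSkewField c ℓ) →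
    let open CompleteDiscretelyValuedSkewField 𝓛 using (rawRing)
        open Valuation 𝓛
        open Matrices rawRing using (_≋_)
        open Matrices rawRing using (0ₘ)
        open Matrices 𝓞 using (column)
        open Matrices 𝓞 using (row)
        open Polynomials rawRing using (Polynomial)
        open Polynomials rawRing using (InvariantFactors)
    in
    (d-1 : ℕ) →
    let d = suc d-1 in
    (D : Matrix rawRing d d) → ¬ (D ≋ 0ₘ) →
    (λs : Vec Polynomial d) → InvariantFactors D λs →
    let ⟨1⟩  = ∃[ n ] Σ (1 ≤ n) λ 1≤n → HasRank (scaledPower D n n 1≤n ≤-refl) (s D n) d
        ⟨2⟩  = ∃[ n ] (1 ≤ n × HasRank (column (scaledPowers D n)) (s D n) d)
        ⟨2′⟩ = ∃[ n ] (1 ≤ n × HasRank (row (scaledPowers D n)) (s D n) d)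
        ⟨3⟩  = AllSlopesPositive (last λs)
    in
    (⟨1⟩ ⇔ ⟨2⟩) × (⟨1⟩ ⇔ ⟨2′⟩) × (⟨1⟩ ⇔ ⟨3⟩)
theorem4p1 𝓛 _ D _ λs I =
  powerRank⇔columnRank D , powerRank⇔rowRank D , powerRank⇔slopesPositive D λs I
  where open Conditions 𝓛
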